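{- Let $m\ge 3$ be an integer. Then every integer $N\ge 924m^3$ can be written as $p_{m+2}(x_1)+p_{m+2}(x_2)+p_{m+2}(x_3)+3p_{m+2}(x_4)$ with $x_1,x_2,x_3,x_4\in\mathbb{N}$.
   Context: $\mathbb{N}=\{0,1,2,\dots\}$. For integers $m\ge1$ and $n$, $p_{m+2}(n)=m\binom n2+n=\frac{mn^2-(m-2)n}{2}$. -}

module Defs where

open import Data.Nat using (ℕ; _+_; _*_)
open import Data.Nat.Combinatorics using (_C_)

-- polygonal m n = p_{m+2}(n) = m * binom(n,2) + n, for n ∈ ℕ
polygonal : ℕ → ℕ → ℕ
polygonal m n = m * (n C 2) + n

-- Put a = Σ' x², b = Σ' x, where Σ' gives x₄ the weight 3. Then N = m (a - b) / 2 + b, and 6a - b² = w² + 4(p² + pq + q²)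
-- with w = x₁ + x₂ + x₃ - 3x₄, p = x₁ - x₂, q = x₂ - x₃. For large N three consecutive b ≡ N (mod m) satisfy b² < 6a and
-- 5a < b² + 2b + 6, which make 6a - b² positive and the resulting xᵢ nonnegative, and for one of them 6a - b² is prime
-- to 3 or ≡ 3 (mod 9). It remains to represent every such k > 0 by the ternary form p² + pq + q² + w².
--
-- A positive ternary form of discriminant 3 is equivalent to this one by Hermite reduction, so it suffices to embed k in
-- such a form. That requires z and s with z s² in a prescribed class r modulo 4K and -K a square modulo z, where K = 3k or
-- K = k/3. Instead of choosing z prime by Dirichlet's theorem, let ψ = (-K / ·) and g(y) = Σ ψ(d) over d ∣ y. Then g ≥ 0,
-- and g(y) > 0 exactly if y = z s² with -K a square modulo z. The sums of g over y < Y² in the classes r and 1 differ by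
-- at most 3Y, because ψ = 1 on both classes, but g ≥ 1 at the values of x² + K w², which makes the sum over the class 1
-- exceed every fixed multiple of Y.
module Submission where

-- The total weight is 6 = 1 + 1 + 1 + 3, so 6a - b² is the defect in Cauchy's inequality. The
-- condition at 3 is forced, since p² + pq + q² + w² ≡ 6 (mod 9) has no solution. Replacing b by b +
-- m lowers (a - b) / 2 by one, so that a and b change together modulo 3 and one of three trials
-- succeeds. The two values of K come from the embedding. A form with coefficients z of Y², k of Z²
-- and s of XZ gets discriminant 3 from 4kD = zs² + 3, where -D has to be a square modulo z. Modulo
-- z this makes D equal to 3k up to squares; if 3 divides k, one takes 3s for s, and D is k/3 up to
-- squares. The factor s² does no harm, because s is a free coefficient: any y = zs² in the right
-- class serves, and such y are detected by g > 0, which can be proved on average. The Jacobi symbol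
-- is a product of signs over a half-system. For the moduli 4aq ± 1 it is read off from the position
-- of the multiples of a; multiplicativity in the modulus gives the other values that occur.

open import Defs

-- Finite sums and products over i < n in a commutative monoid

module BigOperators where
  open import Algebra.Structures using (IsCommutativeMonoid)
  open import Data.Nat using (ℕ; zero; suc; _+_; _*_; _≤_; _<_; z≤n; s≤s; _≟_)
  open import Data.Nat.Properties
  open import Relation.Binary.PropositionalEquality
  open import Relation.Nullary using (yes; no; Dec; ¬_; contradiction)

  module Big {A : Set} (_∙_ : A → A → A) (ε : A)
             (isCM : IsCommutativeMonoid _≡_ _∙_ ε) where
    open IsCommutativeMonoid isCM using (assoc; comm; identityˡ; identityʳ)
    open ≡-Reasoning

    ∑ : ℕ → (ℕ → A) → A
    ∑ zero    f = ε
    ∑ (suc n) f = ∑ n f ∙ f n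

    ∑-cong : ∀ n {f g : ℕ → A} → (∀ i → i < n → f i ≡ g i) → ∑ n f ≡ ∑ n g
    ∑-cong zero    e = refl
    ∑-cong (suc n) e = cong₂ _∙_ (∑-cong n (λ i i<n → e i (m<n⇒m<1+n i<n))) (e n ≤-refl)

    ∑-ε : ∀ n {f : ℕ → A} → (∀ i → i < n → f i ≡ ε) → ∑ n f ≡ ε
    ∑-ε zero    e = refl
    ∑-ε (suc n) e = trans (cong₂ _∙_ (∑-ε n (λ i i<n → e i (m<n⇒m<1+n i<n))) (e n ≤-refl)) (identityˡ ε)

    interchange : ∀ a b c d → (a ∙ b) ∙ (c ∙ d) ≡ (a ∙ c) ∙ (b ∙ d)
    interchange a b c d = begin
      (a ∙ b) ∙ (c ∙ d) ≡⟨ assoc a b (c ∙ d) ⟩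
      a ∙ (b ∙ (c ∙ d)) ≡⟨ cong (a ∙_) (assoc b c d) ⟨
      a ∙ ((b ∙ c) ∙ d) ≡⟨ cong (λ x → a ∙ (x ∙ d)) (comm b c) ⟩
      a ∙ ((c ∙ b) ∙ d) ≡⟨ cong (a ∙_) (assoc c b d) ⟩
      a ∙ (c ∙ (b ∙ d)) ≡⟨ assoc a c (b ∙ d) ⟨
      (a ∙ c) ∙ (b ∙ d) ∎

    ∑-∙ : ∀ n (f g : ℕ → A) → ∑ n (λ i → f i ∙ g i) ≡ ∑ n f ∙ ∑ n g
    ∑-∙ zero    f g = sym (identityˡ ε)
    ∑-∙ (suc n) f g = trans (cong (_∙ (f n ∙ g n)) (∑-∙ n f g)) (interchange _ _ _ _)

    ∑-comm : ∀ m n (f : ℕ → ℕ → A) → ∑ m (λ i → ∑ n (f i)) ≡ ∑ n (λ j → ∑ m (λ i → f i j))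
    ∑-comm zero    n f = sym (∑-ε n (λ _ _ → refl))
    ∑-comm (suc m) n f = trans (cong (_∙ ∑ n (f m)) (∑-comm m n f)) (sym (∑-∙ n _ _))

    ∑-split : ∀ m n (f : ℕ → A) → ∑ (m + n) f ≡ ∑ m f ∙ ∑ n (λ i → f (m + i))
    ∑-split m zero    f = trans (cong (λ k → ∑ k f) (+-identityʳ m)) (sym (identityʳ _))
    ∑-split m (suc n) f = begin
      ∑ (m + suc n) f                                ≡⟨ cong (λ k → ∑ k f) (+-suc m n) ⟩
      ∑ (m + n) f ∙ f (m + n)                        ≡⟨ cong (_∙ f (m + n)) (∑-split m n f) ⟩
      (∑ m f ∙ ∑ n (λ i → f (m + i))) ∙ f (m + n)    ≡⟨ assoc _ _ _ ⟩
      ∑ m f ∙ ∑ (suc n) (λ i → f (m + i))            ∎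

    ∑-head : ∀ n (f : ℕ → A) → ∑ (suc n) f ≡ f 0 ∙ ∑ n (λ i → f (suc i))
    ∑-head n f = trans (∑-split 1 n f) (cong (_∙ ∑ n (λ i → f (suc i))) (identityˡ (f 0)))

    ∑-blocks : ∀ m n (f : ℕ → A) → ∑ (m * n) f ≡ ∑ m (λ i → ∑ n (λ l → f (i * n + l)))
    ∑-blocks zero    n f = refl
    ∑-blocks (suc m) n f = begin
      ∑ (n + m * n) f                              ≡⟨ cong (λ k → ∑ k f) (+-comm n (m * n)) ⟩
      ∑ (m * n + n) f                              ≡⟨ ∑-split (m * n) n f ⟩
      ∑ (m * n) f ∙ ∑ n (λ l → f (m * n + l))      ≡⟨ cong (_∙ ∑ n (λ l → f (m * n + l))) (∑-blocks m n f) ⟩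
      ∑ (suc m) (λ i → ∑ n (λ l → f (i * n + l)))  ∎

    ∑-single : ∀ n {f : ℕ → A} i → i < n → (∀ j → j < n → j ≢ i → f j ≡ ε) → ∑ n f ≡ f i
    ∑-single (suc n) {f} i i<1+n e with i ≟ n
    ... | yes refl = trans (cong (_∙ f n) (∑-ε n (λ j j<n → e j (m<n⇒m<1+n j<n) (<⇒≢ j<n)))) (identityˡ _)
    ... | no  i≢n  = trans (cong₂ _∙_ (∑-single n i (≤∧≢⇒< (≤-pred i<1+n) i≢n) (λ j j<n → e j (m<n⇒m<1+n j<n)))
                                       (e n ≤-refl (λ n≡i → i≢n (sym n≡i))))
                           (identityʳ _)

    -- Iverson bracket with value `ε` where the condition fails, so that restricting a range only
    -- changes the summand.
    [_⇒_] : ∀ {P : Set} → Dec P → A → A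
    [ yes _ ⇒ x ] = x
    [ no  _ ⇒ x ] = ε

    [yes] : ∀ {P : Set} (d : Dec P) {x} → P → [ d ⇒ x ] ≡ x
    [yes] (yes _) p = refl
    [yes] (no ¬p) p = contradiction p ¬p

    [no] : ∀ {P : Set} (d : Dec P) {x} → ¬ P → [ d ⇒ x ] ≡ ε
    [no] (yes p) ¬p = contradiction p ¬p
    [no] (no _)  ¬p = refl

    [cong] : ∀ {P Q : Set} (d : Dec P) (d′ : Dec Q) {x y} → (P → Q) → (Q → P) → (P → x ≡ y) →
             [ d ⇒ x ] ≡ [ d′ ⇒ y ]
    [cong] (yes p) (yes q) pq qp e = e p
    [cong] (yes p) (no ¬q) pq qp e = contradiction (pq p) ¬q
    [cong] (no ¬p) (yes q) pq qp e = contradiction (qp q) ¬p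
    [cong] (no ¬p) (no ¬q) pq qp e = refl

    -- Both sides equal the double sum of f over the graph of π.
    ∑-permute : ∀ n (π π⁻¹ : ℕ → ℕ) →
                (∀ i → i < n → π i < n) → (∀ i → i < n → π⁻¹ i < n) →
                (∀ i → i < n → π⁻¹ (π i) ≡ i) → (∀ i → i < n → π (π⁻¹ i) ≡ i) →
                ∀ (f : ℕ → A) → ∑ n (λ i → f (π i)) ≡ ∑ n f
    ∑-permute n π π⁻¹ π< π⁻¹< left right f = begin
      ∑ n (λ i → f (π i))
        ≡⟨ ∑-cong n (λ i i<n → trans (sym ([yes] (π i ≟ π i) refl))
             (sym (∑-single n (π i) (π< i i<n) (λ j _ j≢ → [no] (j ≟ π i) j≢)))) ⟩
      ∑ n (λ i → ∑ n (λ j → [ j ≟ π i ⇒ f j ]))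
        ≡⟨ ∑-comm n n _ ⟩
      ∑ n (λ j → ∑ n (λ i → [ j ≟ π i ⇒ f j ]))
        ≡⟨ ∑-cong n (λ j j<n → trans
             (∑-single n (π⁻¹ j) (π⁻¹< j j<n)
               (λ i i<n i≢ → [no] (j ≟ π i) (λ j≡ → i≢ (trans (sym (left i i<n)) (cong π⁻¹ (sym j≡))))))
             ([yes] (j ≟ π (π⁻¹ j)) (sym (right j j<n)))) ⟩
      ∑ n f ∎

    -- Pairing i with ι i cancels all terms but the fixed ones when the operation is an exponent-two group.
    ∑-involution : (∀ x → x ∙ x ≡ ε) → ∀ n (ι : ℕ → ℕ) →
                   (∀ i → i < n → ι i < n) → (∀ i → i < n → ι (ι i) ≡ i) →
                   ∀ (f : ℕ → A) → (∀ i → i < n → f (ι i) ≡ f i) →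
                   ∑ n f ≡ ∑ n (λ i → [ ι i ≟ i ⇒ f i ])
    ∑-involution sq n ι ι< ιι f fι = begin
      ∑ n f                            ≡⟨ ∑-cong n (λ i _ → split i) ⟩
      ∑ n (λ i → (lt i ∙ gt i) ∙ eq i) ≡⟨ ∑-∙ n _ eq ⟩
      ∑ n (λ i → lt i ∙ gt i) ∙ ∑ n eq ≡⟨ cong (_∙ ∑ n eq) (∑-∙ n lt gt) ⟩
      (∑ n lt ∙ ∑ n gt) ∙ ∑ n eq       ≡⟨ cong (λ x → (x ∙ ∑ n gt) ∙ ∑ n eq) lt≡gt ⟩
      (∑ n gt ∙ ∑ n gt) ∙ ∑ n eq       ≡⟨ cong (_∙ ∑ n eq) (sq _) ⟩
      ε ∙ ∑ n eq                       ≡⟨ identityˡ _ ⟩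
      ∑ n eq                           ∎
      where
      lt gt eq : ℕ → A
      lt i = [ ι i <? i ⇒ f i ]
      gt i = [ i <? ι i ⇒ f i ]
      eq i = [ ι i ≟ i ⇒ f i ]

      split : ∀ i → f i ≡ (lt i ∙ gt i) ∙ eq i
      split i with ι i <? i | i <? ι i | ι i ≟ i
      ... | yes p | yes q | _      = contradiction (<-trans p q) (n≮n _)
      ... | yes p | no _  | yes r  = contradiction r (<⇒≢ p)
      ... | yes _ | no _  | no _   = sym (trans (identityʳ _) (identityʳ _))
      ... | no _  | yes q | yes r  = contradiction (sym r) (<⇒≢ q)
      ... | no _  | yes _ | no _   = sym (trans (identityʳ _) (identityˡ _))
      ... | no _  | no _  | yes _  = sym (trans (cong (_∙ f i) (identityˡ _)) (identityˡ _))
      ... | no p  | no q  | no r   = contradiction (≤-antisym (≮⇒≥ q) (≮⇒≥ p)) r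

      -- Reindexing by `ι` carries the indices that `ι` lowers to those that it raises.
      lt≡gt : ∑ n lt ≡ ∑ n gt
      lt≡gt = trans
        (∑-cong n (λ i i<n → [cong] (ι i <? i) (ι i <? ι (ι i))
          (λ p → subst (ι i <_) (sym (ιι i i<n)) p) (λ p → subst (ι i <_) (ιι i i<n) p) (λ _ → sym (fι i i<n))))
        (∑-permute n ι ι ι< ι< ιι ιι gt)

module PolygonalSums where
  open BigOperators using (module Big)
  open import Data.Empty using (⊥)
  open import Data.Integer using (ℤ; +_; _+_; _*_; -_; _-_; _%ℕ_; _/ℕ_; 0ℤ; 1ℤ) renaming (∣_∣ to abs)
  open import Data.Integer as ℤ using ()
  open import Data.Integer.DivMod using (n%ℕd<d; a≡a%ℕn+[a/ℕn]*n)
  open import Data.Integer.Divisibility.Signed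
  open import Data.Integer.Properties as ℤ using ()
  open import Data.Integer.Tactic.RingSolver using (solve-∀)
  open import Data.List using ([]; _∷_)
  open import Data.List.Relation.Unary.All using (_∷_)
  open import Data.Nat as ℕ using (ℕ; zero; suc; z≤n; s≤s; _<_; _≤_; _≤?_; _^_; ⌊_/2⌋)
  open import Data.Nat.Combinatorics using (_C_; nC1≡n; nCk+nC[k+1]≡[n+1]C[k+1])
  open import Data.Nat.Coprimality using (Coprime; coprime?; coprime-divisor; prime⇒coprime; coprime-Bézout)
  open import Data.Nat.DivMod as ℕ using ()
  open import Data.Nat.Divisibility as D using (>⇒∤)
  open import Data.Nat.GCD using (module Bézout)
  open import Data.Nat.Induction using (<-rec)
  open import Data.Nat.Primality using (Prime; euclidsLemma; prime⇒nonZero; prime⇒nonTrivial; prime⇒irreducible)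
  open import Data.Nat.Primality.Factorisation using (factorise)
  open import Data.Nat.Properties as ℕ using ()
  open import Data.Nat.Tactic.RingSolver as ℕ-solver using ()
  open import Data.Product using (_,_; _×_; proj₁; proj₂; ∃-syntax)
  open import Data.Sign as Sign using (Sign; opposite)
  open import Data.Sign.Properties as Sign using ()
  open import Data.Sum using (_⊎_; inj₁; inj₂; [_,_]′)
  open import Function using (_∘_)
  open import Function.Bundles using (_⇔_; mk⇔; Equivalence)
  open import Relation.Binary.PropositionalEquality hiding (J)
  open import Relation.Nullary using (yes; no; Dec; ¬_; contradiction)

  -- The Jacobi symbol

  ∣-resp : ∀ {n x y : ℤ} → x ≡ y → n ∣ x → n ∣ y
  ∣-resp e = subst (_ ∣_) e

  infixl 7 _·_
  _·_ : Sign → Sign → Sign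
  _·_ = Sign._*_

  module Π = Big Sign._*_ Sign.+ Sign.*-isCommutativeMonoid

  Π : ℕ → (ℕ → Sign) → Sign
  Π = Π.∑

  -- In a group of exponent two each of the equations says that the product of all four signs is
  -- `+`.
  sign-swap : ∀ p q r s → p · q ≡ r · s → p · r ≡ q · s
  sign-swap Sign.+ Sign.+ Sign.+ Sign.+ _ = refl
  sign-swap Sign.+ Sign.+ Sign.- Sign.- _ = refl
  sign-swap Sign.+ Sign.- Sign.+ Sign.- _ = refl
  sign-swap Sign.+ Sign.- Sign.- Sign.+ _ = refl
  sign-swap Sign.- Sign.+ Sign.+ Sign.- _ = refl
  sign-swap Sign.- Sign.+ Sign.- Sign.+ _ = refl
  sign-swap Sign.- Sign.- Sign.+ Sign.+ _ = refl
  sign-swap Sign.- Sign.- Sign.- Sign.- _ = refl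

  Π-double-const : ∀ q s → Π (q ℕ.+ q) (λ _ → s) ≡ Sign.+
  Π-double-const q s = trans (Π.∑-split q q (λ _ → s)) (Sign.s*s≡+ (Π q (λ _ → s)))

  small-multiple : ∀ n (x : ℤ) → + n ∣ x → abs x < n → x ≡ 0ℤ
  small-multiple n x n∣x x<n with abs x in eq
  ... | zero  = ℤ.∣i∣≡0⇒i≡0 eq
  ... | suc k = contradiction (subst (n D.∣_) eq (∣⇒∣ᵤ n∣x)) (>⇒∤ x<n)

  -- An odd modulus is given through h = (n - 1) / 2, because 0,...,h represent the classes up to
  -- sign; this is the half-system of Gauss's lemma.
  module Mod (h : ℕ) where

    n : ℕ
    n = suc (h ℕ.+ h)

    N : ℤ
    N = + n

    infix 4 _≋_ _≈_
    -- A record, so that `x` and `y` can be recovered by unification, which the bare difference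
    -- would prevent.
    record _≋_ (x y : ℤ) : Set where
      constructor mod
      field N∣ : N ∣ x - y
    open _≋_ public

    data _≈_ (x y : ℤ) : Set where
      same : x ≋ y → x ≈ y
      anti : x ≋ - y → x ≈ y

    -- Coprimality to n as an explicit inverse, which stays an inverse modulo every divisor of n.
    record Unit (a : ℤ) : Set where
      constructor unit
      field
        inv   : ℤ
        inv-≋ : a * inv ≋ 1ℤ

    ≋-refl : ∀ {x} → x ≋ x
    ≋-refl {x} = mod (divides 0ℤ (ℤ.+-inverseʳ x))

    ≋-sym : ∀ {x y} → x ≋ y → y ≋ x
    ≋-sym {x} {y} (mod p) = mod (∣-resp (alg x y) (∣n⇒∣m*n (- 1ℤ) p))
      where alg : ∀ x y → - 1ℤ * (x - y) ≡ y - x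
            alg = solve-∀

    ≋-trans : ∀ {x y z} → x ≋ y → y ≋ z → x ≋ z
    ≋-trans {x} {y} {z} (mod p) (mod q) = mod (∣-resp (alg x y z) (∣m∣n⇒∣m+n p q))
      where alg : ∀ x y z → (x - y) + (y - z) ≡ x - z
            alg = solve-∀

    ≋-reflexive : ∀ {x y} → x ≡ y → x ≋ y
    ≋-reflexive refl = ≋-refl

    ≋-*ˡ : ∀ a {x y} → x ≋ y → a * x ≋ a * y
    ≋-*ˡ a {x} {y} (mod p) = mod (∣-resp (alg a x y) (∣n⇒∣m*n a p))
      where alg : ∀ a x y → a * (x - y) ≡ a * x - a * y
            alg = solve-∀

    ≋-*ʳ : ∀ a {x y} → x ≋ y → x * a ≋ y * a
    ≋-*ʳ a {x} {y} p = subst₂ _≋_ (ℤ.*-comm a x) (ℤ.*-comm a y) (≋-*ˡ a p)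

    ≋-* : ∀ {x y u v} → x ≋ y → u ≋ v → x * u ≋ y * v
    ≋-* {y = y} {u = u} p q = ≋-trans (≋-*ʳ u p) (≋-*ˡ y q)

    ≋-neg : ∀ {x y} → x ≋ y → - x ≋ - y
    ≋-neg {x} {y} (mod p) = mod (∣-resp (alg x y) (∣n⇒∣m*n (- 1ℤ) p))
      where alg : ∀ x y → - 1ℤ * (x - y) ≡ - x - (- y)
            alg = solve-∀

    0⇒∣ : ∀ {x} → x ≋ 0ℤ → N ∣ x
    0⇒∣ {x} (mod p) = ∣-resp (ℤ.+-identityʳ x) p

    ∣⇒0 : ∀ {x} → N ∣ x → x ≋ 0ℤ
    ∣⇒0 {x} p = mod (∣-resp (sym (ℤ.+-identityʳ x)) p)

    ≈-sym : ∀ {x y} → x ≈ y → y ≈ x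
    ≈-sym (same p) = same (≋-sym p)
    ≈-sym {x} {y} (anti p) = anti (≋-trans (≋-reflexive (sym (ℤ.neg-involutive y))) (≋-neg (≋-sym p)))

    ≈-trans : ∀ {x y z} → x ≈ y → y ≈ z → x ≈ z
    ≈-trans (same p) (same q) = same (≋-trans p q)
    ≈-trans (same p) (anti q) = anti (≋-trans p q)
    ≈-trans (anti p) (same q) = anti (≋-trans p (≋-neg q))
    ≈-trans {z = z} (anti p) (anti q) = same (≋-trans p (≋-trans (≋-neg q) (≋-reflexive (ℤ.neg-involutive z))))

    ≈-*ˡ : ∀ a {x y} → x ≈ y → a * x ≈ a * y
    ≈-*ˡ a (same p) = same (≋-*ˡ a p)
    ≈-*ˡ a {y = y} (anti p) = anti (≋-trans (≋-*ˡ a p) (≋-reflexive (sym (ℤ.neg-distribʳ-* a y))))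

    unit-cancel : ∀ {a} → Unit a → ∀ x → N ∣ a * x → N ∣ x
    unit-cancel {a} (unit a′ p) x q = 0⇒∣ (≋-trans (≋-sym (≋-trans (≋-*ʳ x p) (≋-reflexive (ℤ.*-identityˡ x))))
      (≋-trans (≋-reflexive (alg a a′ x)) (∣⇒0 (∣n⇒∣m*n a′ q))))
      where alg : ∀ a a′ x → a * a′ * x ≡ a′ * (a * x)
            alg = solve-∀

    unit-* : ∀ {a b} → Unit a → Unit b → Unit (a * b)
    unit-* {a} {b} (unit a′ p) (unit b′ q) = unit (a′ * b′) (≋-trans (≋-reflexive (alg a a′ b b′)) (≋-* p q))
      where alg : ∀ a a′ b b′ → a * b * (a′ * b′) ≡ a * a′ * (b * b′)
            alg = solve-∀

    unit-≋ : ∀ {x y} → x ≋ y → Unit x → Unit y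
    unit-≋ d (unit x′ p) = unit x′ (≋-trans (≋-*ʳ x′ (≋-sym d)) p)

    unit-factor : ∀ a b → Unit (a * b) → Unit a
    unit-factor a b (unit x p) = unit (b * x) (≋-trans (≋-reflexive (sym (ℤ.*-assoc a b x))) p)

    unit-factorʳ : ∀ a b → Unit (a * b) → Unit b
    unit-factorʳ a b u = unit-factor b a (unit-≋ (≋-reflexive (ℤ.*-comm a b)) u)

    unit-neg : ∀ {a} → Unit a → Unit (- a)
    unit-neg {a} (unit a′ p) = unit (- a′) (≋-trans (≋-reflexive (alg a a′)) p)
      where alg : ∀ a b → - a * - b ≡ a * b
            alg = solve-∀

    unit-1 : Unit 1ℤ
    unit-1 = unit 1ℤ ≋-refl

    res : ℤ → ℕ
    res x = x %ℕ n

    res< : ∀ x → res x < n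
    res< x = n%ℕd<d x n

    res-≋ : ∀ x → x ≋ + res x
    res-≋ x = mod (divides (x /ℕ n) (trans (cong (λ z → z - + res x) (a≡a%ℕn+[a/ℕn]*n x n)) (alg (+ res x) ((x /ℕ n) * N))))
      where alg : ∀ r q → r + q - r ≡ q
            alg = solve-∀

    res-unique′ : ∀ i j → i < n → j < n → + i ≋ + j → i ≡ j
    res-unique′ i j i<n j<n (mod d) = ℤ.+-injective (ℤ.i-j≡0⇒i≡j (+ i) (+ j) (small-multiple n (+ i - + j) d lt))
      where
      lt : abs (+ i - + j) < n
      lt rewrite ℤ.m-n≡m⊖n i j = ℕ.≤-<-trans (ℤ.∣m⊝n∣≤m⊔n i j) (ℕ.⊔-lub i<n j<n)

    res-unique : ∀ x i → i < n → x ≋ + i → res x ≡ i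
    res-unique x i i<n d = res-unique′ (res x) i (res< x) i<n (≋-trans (≋-sym (res-≋ x)) d)

    res-cong : ∀ x y → x ≋ y → res x ≡ res y
    res-cong x y d = res-unique x (res y) (res< y) (≋-trans d (res-≋ y))

    -- The absolute value of the absolutely least residue.
    fold : ℤ → ℕ
    fold x with res x ≤? h
    ... | yes _ = res x
    ... | no  _ = n ℕ.∸ res x

    fold≤ : ∀ x → fold x ≤ h
    fold≤ x with res x ≤? h
    ... | yes p = p
    ... | no ¬p = ℕ.≤-trans (ℕ.∸-monoʳ-≤ n (ℕ.≰⇒> ¬p)) (ℕ.≤-reflexive (ℕ.m+n∸m≡n (suc h) h))

    pos-∸ : ∀ {a b} → b ≤ a → + (a ℕ.∸ b) ≡ + a - + b
    pos-∸ {a} {b} b≤a = trans (sym (ℤ.⊖-≥ b≤a)) (sym (ℤ.m-n≡m⊖n a b))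

    n∸-≋ : ∀ {r} → r < n → + (n ℕ.∸ r) ≋ - (+ r)
    n∸-≋ {r} r<n = ≋-trans (≋-reflexive (pos-∸ (ℕ.<⇒≤ r<n))) (mod (∣-resp (alg N (+ r)) ∣-refl))
      where alg : ∀ N r → N ≡ N - r - (- r)
            alg = solve-∀

    ≈-fold : ∀ x → x ≈ + fold x
    ≈-fold x with res x ≤? h
    ... | yes p = same (res-≋ x)
    ... | no ¬p = anti (≋-trans (≋-trans (res-≋ x) (≋-reflexive (sym (ℤ.neg-involutive (+ res x)))))
                          (≋-neg (≋-sym (n∸-≋ (res< x)))))

    ≤h⇒<n : ∀ {i} → i ≤ h → i < n
    ≤h⇒<n i≤h = s≤s (ℕ.≤-trans i≤h (ℕ.m≤m+n h h))

    half-unique : ∀ i j → i ≤ h → j ≤ h → + i ≈ + j → i ≡ j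
    half-unique i j i≤h j≤h (same d) = res-unique′ i j (≤h⇒<n i≤h) (≤h⇒<n j≤h) d
    half-unique i j i≤h j≤h (anti (mod d)) = trans (ℕ.m+n≡0⇒m≡0 i sum≡0) (sym (ℕ.m+n≡0⇒n≡0 i sum≡0))
      where
      sum≡0 : i ℕ.+ j ≡ 0
      sum≡0 = ℤ.+-injective (small-multiple n (+ (i ℕ.+ j))
        (∣-resp (cong (_+_ (+ i)) (ℤ.neg-involutive (+ j))) d) (s≤s (ℕ.+-mono-≤ i≤h j≤h)))

    -- Multiplication by a unit permutes the half-system {0,…,h}.
    Π-unit : ∀ (η : ℤ → Sign) → (∀ x y → x ≈ y → η x ≡ η y) → ∀ {a} → Unit a →
             Π (suc h) (λ j → η (a * + j)) ≡ Π (suc h) (λ j → η (+ j))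
    Π-unit η even {a} (unit a′ inv) = trans
      (Π.∑-cong (suc h) (λ j _ → even (a * + j) (+ π j) (≈-fold (a * + j))))
      (Π.∑-permute (suc h) π π⁻¹ (λ j _ → s≤s (fold≤ (a * + j))) (λ j _ → s≤s (fold≤ (a′ * + j)))
        (λ j j<sh → back a a′ inv j (ℕ.≤-pred j<sh))
        (λ j j<sh → back a′ a (≋-trans (≋-reflexive (ℤ.*-comm a′ a)) inv) j (ℕ.≤-pred j<sh))
        (λ j → η (+ j)))
      where
      π π⁻¹ : ℕ → ℕ
      π j = fold (a * + j)
      π⁻¹ j = fold (a′ * + j)
      back : ∀ a a′ → a * a′ ≋ 1ℤ → ∀ j → j ≤ h → fold (a′ * + fold (a * + j)) ≡ j
      back a a′ inv j j≤h = half-unique _ j (fold≤ (a′ * + fold (a * + j))) j≤h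
        (≈-trans (≈-sym (≈-fold (a′ * + fold (a * + j)))) (≈-trans (≈-*ˡ a′ (≈-sym (≈-fold (a * + j))))
          (same (≋-trans (≋-reflexive (alg a a′ (+ j))) (≋-trans (≋-*ʳ (+ j) inv) (≋-reflexive (ℤ.*-identityˡ (+ j))))))))
        where alg : ∀ a a′ x → a′ * (a * x) ≡ a * a′ * x
              alg = solve-∀

    -- The sign of the absolutely least residue, with `+` for the residue 0.
    side : ℕ → Sign
    side r with r ≤? h
    ... | yes _ = Sign.+
    ... | no  _ = Sign.-

    ε : ℤ → Sign
    ε x = side (res x)

    ε-low : ∀ x ρ → ρ ≤ h → x ≋ + ρ → ε x ≡ Sign.+
    ε-low x ρ ρ≤h d with res x ≤? h
    ... | yes _ = refl
    ... | no ¬p = contradiction (subst (_≤ h) (sym (res-unique x ρ (≤h⇒<n ρ≤h) d)) ρ≤h) ¬p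

    ε-high : ∀ x ρ → h < ρ → ρ < n → x ≋ + ρ → ε x ≡ Sign.-
    ε-high x ρ h<ρ ρ<n d with res x ≤? h
    ... | yes p = contradiction (subst (_≤ h) (res-unique x ρ ρ<n d) p) (ℕ.<⇒≱ h<ρ)
    ... | no _ = refl

    ε-half : ∀ j → j ≤ h → ε (+ j) ≡ Sign.+
    ε-half j j≤h = ε-low (+ j) j j≤h ≋-refl

    -- Oddness is asked only off the multiples of n, where x and - x are incongruent; at a multiple
    -- of n it would contradict periodicity.
    record Odd (f : ℤ → Sign) : Set where
      field
        periodic : ∀ x y → x ≋ y → f x ≡ f y
        odd      : ∀ x → ¬ N ∣ x → f (- x) ≡ opposite (f x)

    open Odd

    ε-odd : Odd ε
    periodic ε-odd x y d = cong side (res-cong x y d)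
    odd ε-odd x ¬d with res x ≤? h
    ... | yes p = ε-high (- x) (n ℕ.∸ res x)
                    (ℕ.≤-trans (ℕ.≤-reflexive (sym (ℕ.m+n∸n≡m (suc h) h))) (ℕ.∸-monoʳ-≤ n p))
                    (lt (res x) refl) (≋-trans (≋-neg (res-≋ x)) (≋-sym (n∸-≋ (res< x))))
      where
      lt : ∀ r → res x ≡ r → n ℕ.∸ r < n
      lt zero    e = contradiction (0⇒∣ (subst (λ r → x ≋ + r) e (res-≋ x))) ¬d
      lt (suc r) _ = s≤s (ℕ.m∸n≤m (h ℕ.+ h) r)
    ... | no ¬p = ε-low (- x) (n ℕ.∸ res x)
                    (ℕ.≤-trans (ℕ.∸-monoʳ-≤ n (ℕ.≰⇒> ¬p)) (ℕ.≤-reflexive (ℕ.m+n∸m≡n (suc h) h)))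
                    (≋-trans (≋-neg (res-≋ x)) (≋-sym (n∸-≋ (res< x))))

    opposite-· : ∀ s t → opposite s · opposite t ≡ s · t
    opposite-· Sign.+ Sign.+ = refl
    opposite-· Sign.+ Sign.- = refl
    opposite-· Sign.- Sign.+ = refl
    opposite-· Sign.- Sign.- = refl

    odd·odd-even : ∀ {f g} → Odd f → Odd g → ∀ x y → x ≈ y → f x · g x ≡ f y · g y
    odd·odd-even of og x y (same d) = cong₂ _·_ (periodic of x y d) (periodic og x y d)
    odd·odd-even {f} {g} of og x y (anti d) with N ∣? y
    -- Oddness says nothing at a multiple of n, but there - y and y are congruent and periodicity
    -- suffices.
    ... | yes e = cong₂ _·_ (periodic of x y x≋y) (periodic og x y x≋y)
      where
      x≋y : x ≋ y
      x≋y = ≋-trans d (≋-trans (≋-neg (∣⇒0 e)) (≋-sym (∣⇒0 e)))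
    ... | no ¬e = trans (cong₂ _·_ (trans (periodic of x (- y) d) (odd of y ¬e)) (trans (periodic og x (- y) d) (odd og y ¬e)))
                        (opposite-· (f y) (g y))

    -- The product f · g is even, so dilation by a unit does not change its product over the
    -- half-system; the rest is rearrangement in a group of exponent two. This allows `ε` to be
    -- exchanged for a more convenient odd function.
    Π-odd-independent : ∀ {f g} → Odd f → Odd g → ∀ {a} → Unit a →
      Π (suc h) (λ j → f (a * + j) · f (+ j)) ≡ Π (suc h) (λ j → g (a * + j) · g (+ j))
    Π-odd-independent {f} {g} of og {a} u = begin
      Π (suc h) (λ j → f (a * + j) · f (+ j))
        ≡⟨ Π.∑-∙ (suc h) (λ j → f (a * + j)) (λ j → f (+ j)) ⟩
      Π (suc h) (λ j → f (a * + j)) · Π (suc h) (λ j → f (+ j))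
        ≡⟨ sign-swap (Π (suc h) (λ j → f (a * + j))) (Π (suc h) (λ j → g (a * + j))) (Π (suc h) (λ j → f (+ j))) (Π (suc h) (λ j → g (+ j))) eq ⟩
      Π (suc h) (λ j → g (a * + j)) · Π (suc h) (λ j → g (+ j))
        ≡⟨ Π.∑-∙ (suc h) (λ j → g (a * + j)) (λ j → g (+ j)) ⟨
      Π (suc h) (λ j → g (a * + j) · g (+ j)) ∎
      where
      open ≡-Reasoning
      eq : Π (suc h) (λ j → f (a * + j)) · Π (suc h) (λ j → g (a * + j)) ≡ Π (suc h) (λ j → f (+ j)) · Π (suc h) (λ j → g (+ j))
      eq = trans (sym (Π.∑-∙ (suc h) (λ j → f (a * + j)) (λ j → g (a * + j)))) (trans
             (Π-unit (λ x → f x · g x) (odd·odd-even of og) u)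
             (Π.∑-∙ (suc h) (λ j → f (+ j)) (λ j → g (+ j))))

    -- For a prime to n this is the Jacobi symbol (a / n), by Schering's extension of Gauss's lemma.
    J : ℤ → Sign
    J a = Π (suc h) (λ j → ε (a * + j))

    -- The inserted factors are all `+`. They bring `J` into the form to which `Π-odd-independent`
    -- applies.
    J≡ΠJ : ∀ a → J a ≡ Π (suc h) (λ j → ε (a * + j) · ε (+ j))
    J≡ΠJ a = Π.∑-cong (suc h) (λ j j<sh → sym (trans (cong (ε (a * + j) ·_) (ε-half j (ℕ.≤-pred j<sh))) (Sign.*-identityʳ (ε (a * + j)))))

    J-cong : ∀ a b → a ≋ b → J a ≡ J b
    J-cong a b d = Π.∑-cong (suc h) (λ j _ → periodic ε-odd (a * + j) (b * + j) (≋-*ʳ (+ j) d))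

    dilate-odd : ∀ {f} → Odd f → ∀ {a} → Unit a → Odd (λ x → f (a * x))
    periodic (dilate-odd of {a} u) x y d = periodic of (a * x) (a * y) (≋-*ˡ a d)
    odd (dilate-odd {f} of {a} u) x ¬d =
      trans (cong f (sym (ℤ.neg-distribʳ-* a x))) (odd of (a * x) (λ e → ¬d (unit-cancel u x e)))

    -- The function x ↦ ε(ax) ε(x) is even, so its product over the half-system is the same at the
    -- points bj as at the points j. This reads J(ab) J(b) = J(a).
    J-* : ∀ {a b} → Unit a → Unit b → J (a * b) ≡ J a · J b
    J-* {a} {b} ua ub = begin
      J (a * b)                              ≡⟨ Sign.*-identityʳ (J (a * b)) ⟨
      J (a * b) · Sign.+                     ≡⟨ sign-swap (J (a * b)) (J b) Sign.+ (J a) eq ⟩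
      J b · J a                              ≡⟨ Sign.*-comm (J b) (J a) ⟩
      J a · J b                              ∎
      where
      open ≡-Reasoning
      eq : J (a * b) · J b ≡ J a
      eq = begin
        J (a * b) · J b
          ≡⟨ Π.∑-∙ (suc h) (λ j → ε (a * b * + j)) (λ j → ε (b * + j)) ⟨
        Π (suc h) (λ j → ε (a * b * + j) · ε (b * + j))
          ≡⟨ Π.∑-cong (suc h) (λ j _ → cong (λ x → ε x · ε (b * + j)) (ℤ.*-assoc a b (+ j))) ⟩
        Π (suc h) (λ j → ε (a * (b * + j)) · ε (b * + j))
          ≡⟨ Π-unit (λ x → ε (a * x) · ε x) (odd·odd-even (dilate-odd ε-odd ua) ε-odd) ub ⟩
        Π (suc h) (λ j → ε (a * + j) · ε (+ j))
          ≡⟨ J≡ΠJ a ⟨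
        J a ∎

    J-square : ∀ {a} → Unit a → J (a * a) ≡ Sign.+
    J-square {a} u = trans (J-* u u) (Sign.s*s≡+ (J a))

    J-1 : J 1ℤ ≡ Sign.+
    J-1 = Π.∑-ε (suc h) (λ j j<sh → trans (cong ε (ℤ.*-identityˡ (+ j))) (ε-half j (ℕ.≤-pred j<sh)))

    -- Each of the h indices above 0 contributes `-`, and h is even.
    J-neg1 : ∀ q → h ≡ q ℕ.+ q → J (- 1ℤ) ≡ Sign.+
    J-neg1 q h≡ = trans (Π.∑-head h (λ j → ε (- 1ℤ * + j))) (cong₂ _·_ (ε-half 0 z≤n)
      (trans (Π.∑-cong h (λ j j<h → trans (cong ε (ℤ.-1*i≡-i (+ suc j))) (ε-neg j j<h)))
             (trans (cong (λ k → Π k (λ _ → Sign.-)) h≡) (Π-double-const q Sign.-))))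
      where
      ε-neg : ∀ j → j < h → ε (- (+ suc j)) ≡ Sign.-
      ε-neg j j<h = trans
        (odd ε-odd (+ suc j) (λ d → contradiction (small-multiple n (+ suc j) d (≤h⇒<n j<h)) (λ ())))
        (cong opposite (ε-half (suc j) j<h))

  -- Reciprocity for the moduli 4aq ± 1

  even∨odd : ∀ i → ∃[ u ] (i ≡ u ℕ.+ u ⊎ i ≡ suc (u ℕ.+ u))
  even∨odd zero = 0 , inj₁ refl
  even∨odd (suc i) with even∨odd i
  ... | u , inj₁ refl = u , inj₂ refl
  ... | u , inj₂ refl = suc u , inj₁ (cong suc (sym (ℕ.+-suc u u)))

  lift-≋ : ∀ h a j ρ u → a ℕ.* j ≡ ρ ℕ.+ u ℕ.* Mod.n h → Mod._≋_ h (+ a * + j) (+ ρ)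
  lift-≋ h a j ρ u e = Mod.mod (divides (+ u) (trans (cong (λ z → z - + ρ) (trans (sym (ℤ.pos-* a j)) (trans (cong +_ e)
    (trans (ℤ.pos-+ ρ (u ℕ.* Mod.n h)) (cong (_+_ (+ ρ)) (ℤ.pos-* u (Mod.n h))))))) (alg (+ ρ) (+ u * + Mod.n h))))
    where alg : ∀ r q → r + q - r ≡ q
          alg = solve-∀

  -- For n = 4aq ± 1 the index range splits into a blocks of length 2q on each of which ⌊2aj/n⌋ is constant.
  J-4aq+1 : ∀ a q → Mod.J (a ℕ.* (q ℕ.+ q)) (+ a) ≡ Sign.+
  J-4aq+1 a q = trans (Π.∑-head h (λ j → ε (+ a * + j))) (cong₂ _·_
    (trans (cong ε (ℤ.*-zeroʳ (+ a))) (ε-half 0 z≤n))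
    (trans (Π.∑-blocks a (q ℕ.+ q) (λ j → ε (+ a * + suc j))) (Π.∑-ε a (λ i i<a → block i i<a (even∨odd i)))))
    where
    h = a ℕ.* (q ℕ.+ q)
    open Mod h using (ε; ε-half; ε-low; ε-high; n)

    al≤ : ∀ l → l < q ℕ.+ q → a ℕ.* suc l ≤ h
    al≤ l l< = ℕ.*-monoʳ-≤ a l<

    u≤a : ∀ {u i} l → i < a → u ℕ.+ u ≤ i → u < a ℕ.* suc l
    u≤a {u} l i<a 2u≤i = ℕ.≤-trans (ℕ.≤-<-trans (ℕ.≤-trans (ℕ.m≤m+n u u) 2u≤i) i<a) (ℕ.m≤m*n a (suc l))

    block : ∀ i → i < a → ∃[ u ] (i ≡ u ℕ.+ u ⊎ i ≡ suc (u ℕ.+ u)) →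
            Π (q ℕ.+ q) (λ l → ε (+ a * + suc (i ℕ.* (q ℕ.+ q) ℕ.+ l))) ≡ Sign.+
    -- The index is j = 4uq + l + 1, and aj = un + ρ with ρ = a(l + 1) - u between 0 and h.
    block i i<a (u , inj₁ refl) = Π.∑-ε (q ℕ.+ q) λ l l<2q →
      let ρ , u+ρ≡ = ℕ.m≤n⇒∃[o]m+o≡n (ℕ.<⇒≤ (u≤a {u} l i<a ℕ.≤-refl)) in
      ε-low _ ρ (ℕ.≤-trans (ℕ.m≤n+m ρ u) (ℕ.≤-trans (ℕ.≤-reflexive u+ρ≡) (al≤ l l<2q)))
        (lift-≋ h a (suc (i ℕ.* (q ℕ.+ q) ℕ.+ l)) ρ u
          (trans (alg a q u l) (trans (cong (ℕ._+ u ℕ.* (h ℕ.+ h)) (sym u+ρ≡)) (alg2 u ρ h))))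
      where
      alg : ∀ a q u l → a ℕ.* suc ((u ℕ.+ u) ℕ.* (q ℕ.+ q) ℕ.+ l) ≡ a ℕ.* suc l ℕ.+ u ℕ.* (a ℕ.* (q ℕ.+ q) ℕ.+ a ℕ.* (q ℕ.+ q))
      alg = ℕ-solver.solve-∀
      alg2 : ∀ u ρ h → u ℕ.+ ρ ℕ.+ u ℕ.* (h ℕ.+ h) ≡ ρ ℕ.+ u ℕ.* suc (h ℕ.+ h)
      alg2 = ℕ-solver.solve-∀
    -- Now aj = un + h + ρ with 0 < ρ ≤ h, so every sign in the block is `-`, and there are 2q of
    -- them.
    block i i<a (u , inj₂ refl) = trans (Π.∑-cong (q ℕ.+ q) (λ l l<2q → neg l l<2q)) (Π-double-const q Sign.-)
      where
      alg : ∀ a q u l → a ℕ.* suc (suc (u ℕ.+ u) ℕ.* (q ℕ.+ q) ℕ.+ l) ≡ a ℕ.* suc l ℕ.+ (u ℕ.* (a ℕ.* (q ℕ.+ q) ℕ.+ a ℕ.*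
          (q ℕ.+ q)) ℕ.+ a ℕ.* (q ℕ.+ q))
      alg = ℕ-solver.solve-∀
      alg2 : ∀ u ρ h → u ℕ.+ ρ ℕ.+ (u ℕ.* (h ℕ.+ h) ℕ.+ h) ≡ (h ℕ.+ ρ) ℕ.+ u ℕ.* suc (h ℕ.+ h)
      alg2 = ℕ-solver.solve-∀
      neg : ∀ l → l < q ℕ.+ q → ε (+ a * + suc (i ℕ.* (q ℕ.+ q) ℕ.+ l)) ≡ Sign.-
      neg l l<2q = ε-high _ (h ℕ.+ ρ)
          (ℕ.m<m+n h (ℕ.+-cancelˡ-< u 0 ρ (subst₂ _<_ (sym (ℕ.+-identityʳ u)) (sym u+ρ≡) (u≤a {u} l i<a (ℕ.n≤1+n _)))))
          (s≤s (ℕ.+-monoʳ-≤ h (ℕ.≤-trans (ℕ.m≤n+m ρ u) (ℕ.≤-trans (ℕ.≤-reflexive u+ρ≡) (al≤ l l<2q)))))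
          (lift-≋ h a (suc (i ℕ.* (q ℕ.+ q) ℕ.+ l)) (h ℕ.+ ρ) u
            (trans (alg a q u l) (trans (cong (ℕ._+ (u ℕ.* (h ℕ.+ h) ℕ.+ h)) (sym u+ρ≡)) (alg2 u ρ h))))
        where
        split = ℕ.m≤n⇒∃[o]m+o≡n (ℕ.<⇒≤ (u≤a {u} l i<a (ℕ.n≤1+n _)))
        ρ = proj₁ split
        u+ρ≡ = proj₂ split

  J-4aq-1 : ∀ a q h → suc h ≡ a ℕ.* (q ℕ.+ q) → Mod.J h (+ a) ≡ Sign.+
  -- Here h + 1 = 2aq, so the indices 0,...,h themselves fill the a blocks; for 4aq + 1 the index 0
  -- had to be split off.
  J-4aq-1 a q h sh≡ = trans (cong (λ k → Π k (λ j → ε (+ a * + j))) sh≡)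
    (trans (Π.∑-blocks a (q ℕ.+ q) (λ j → ε (+ a * + j))) (Π.∑-ε a (λ i i<a → block i i<a (even∨odd i))))
    where
    open Mod h using (ε; ε-half; ε-low; ε-high; n)

    bound : ∀ u l → u < a → l < q ℕ.+ q → u ℕ.+ a ℕ.* l < suc h
    bound u l u<a l<2q = subst (u ℕ.+ a ℕ.* l <_) (sym sh≡)
      (ℕ.<-≤-trans (ℕ.+-monoˡ-< (a ℕ.* l) u<a) (ℕ.≤-trans (ℕ.≤-reflexive (sym (ℕ.*-suc a l))) (ℕ.*-monoʳ-≤ a l<2q)))

    block : ∀ i → i < a → ∃[ u ] (i ≡ u ℕ.+ u ⊎ i ≡ suc (u ℕ.+ u)) →
            Π (q ℕ.+ q) (λ l → ε (+ a * + (i ℕ.* (q ℕ.+ q) ℕ.+ l))) ≡ Sign.+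
    block i i<a (u , inj₁ refl) = Π.∑-ε (q ℕ.+ q) λ l l<2q →
      ε-low _ (u ℕ.+ a ℕ.* l) (ℕ.≤-pred (bound u l (ℕ.≤-<-trans (ℕ.m≤m+n u u) i<a) l<2q))
        (lift-≋ h a (i ℕ.* (q ℕ.+ q) ℕ.+ l) (u ℕ.+ a ℕ.* l) u
          (trans (alg a q u l) (trans (cong (λ s → a ℕ.* l ℕ.+ u ℕ.* (s ℕ.+ s)) (sym sh≡)) (alg2 a u l h))))
      where
      alg : ∀ a q u l → a ℕ.* ((u ℕ.+ u) ℕ.* (q ℕ.+ q) ℕ.+ l) ≡ a ℕ.* l ℕ.+ u ℕ.* (a ℕ.* (q ℕ.+ q) ℕ.+ a ℕ.* (q ℕ.+ q))
      alg = ℕ-solver.solve-∀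
      alg2 : ∀ a u l h → a ℕ.* l ℕ.+ u ℕ.* (suc h ℕ.+ suc h) ≡ u ℕ.+ a ℕ.* l ℕ.+ u ℕ.* suc (h ℕ.+ h)
      alg2 = ℕ-solver.solve-∀
    block i i<a (u , inj₂ refl) = trans (Π.∑-cong (q ℕ.+ q) (λ l l<2q → neg l l<2q)) (Π-double-const q Sign.-)
      where
      alg : ∀ a q u l → a ℕ.* (suc (u ℕ.+ u) ℕ.* (q ℕ.+ q) ℕ.+ l) ≡ a ℕ.* l ℕ.+ (u ℕ.* (a ℕ.* (q ℕ.+ q) ℕ.+ a ℕ.* (q ℕ.+ q)) ℕ.+ a ℕ.* (q ℕ.+ q))
      alg = ℕ-solver.solve-∀
      alg2 : ∀ a u l h → a ℕ.* l ℕ.+ (u ℕ.* (suc h ℕ.+ suc h) ℕ.+ suc h) ≡ (suc h ℕ.+ (u ℕ.+ a ℕ.* l)) ℕ.+ u ℕ.* suc (h ℕ.+ h)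
      alg2 = ℕ-solver.solve-∀
      neg : ∀ l → l < q ℕ.+ q → ε (+ a * + (i ℕ.* (q ℕ.+ q) ℕ.+ l)) ≡ Sign.-
      neg l l<2q = ε-high _ (suc h ℕ.+ (u ℕ.+ a ℕ.* l)) (s≤s (ℕ.m≤m+n h _))
          (s≤s (ℕ.+-monoʳ-< h (ℕ.≤-pred (bound (suc u) l (ℕ.≤-<-trans (s≤s (ℕ.m≤m+n u u)) i<a) l<2q))))
          (lift-≋ h a (i ℕ.* (q ℕ.+ q) ℕ.+ l) (suc h ℕ.+ (u ℕ.+ a ℕ.* l)) u
            (trans (alg a q u l) (trans (cong (λ s → a ℕ.* l ℕ.+ (u ℕ.* (s ℕ.+ s) ℕ.+ s)) (sym sh≡)) (alg2 a u l h))))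

  -- Multiplicativity of the symbol in the modulus

  module Composite (h g : ℕ) where
    open Mod using (mod; anti; unit)
    open Mod.Odd

    private
      module H = Mod h
      module G = Mod g

    half : ℕ
    half = g ℕ.* H.n ℕ.+ h

    private
      module HG = Mod half

    n-* : HG.n ≡ G.n ℕ.* H.n
    n-* = alg h g
      where alg : ∀ h g → suc ((g ℕ.* suc (h ℕ.+ h) ℕ.+ h) ℕ.+ (g ℕ.* suc (h ℕ.+ h) ℕ.+ h)) ≡ suc (g ℕ.+ g) ℕ.* suc (h ℕ.+ h)
            alg = ℕ-solver.solve-∀

    N-* : HG.N ≡ G.N * H.N
    N-* = trans (cong +_ n-*) (ℤ.pos-* G.n H.n)

    HG⇒H : ∀ {x y} → x HG.≋ y → x H.≋ y
    HG⇒H (mod d) = mod (∣-trans (∣-resp (sym N-*) (∣n⇒∣m*n G.N ∣-refl)) d)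

    unit-H : ∀ {a} → HG.Unit a → H.Unit a
    unit-H (unit a′ p) = unit a′ (HG⇒H p)

    -- Another odd sign function modulo HG.N: the sign modulo H.N where that is defined, else the sign of x / H.N modulo G.N.
    ε′ : ℤ → Sign
    ε′ x with H.N ∣? x
    ... | yes d = G.ε (quotient d)
    ... | no _  = H.ε x

    ε′-∣ : ∀ q → ε′ (q * H.N) ≡ G.ε q
    ε′-∣ q with H.N ∣? (q * H.N)
    ... | yes d = cong G.ε (sym (ℤ.*-cancelʳ-≡ q (quotient d) H.N (_∣_.equality d)))
    ... | no ¬d = contradiction (divides q refl) ¬d

    ε′-∤ : ∀ x → ¬ H.N ∣ x → ε′ x ≡ H.ε x
    ε′-∤ x ¬d with H.N ∣? x
    ... | yes d = contradiction d ¬d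
    ... | no _  = refl

    G≋⇐ : ∀ p q → p * H.N HG.≋ q * H.N → p G.≋ q
    G≋⇐ p q (mod (divides t e)) = mod (divides t (ℤ.*-cancelʳ-≡ (p - q) (t * G.N) H.N
      (trans (alg p q H.N) (trans e (trans (cong (_*_ t) N-*) (sym (ℤ.*-assoc t G.N H.N)))))))
      where alg : ∀ p q n → (p - q) * n ≡ p * n - q * n
            alg = solve-∀

    ε′-odd : HG.Odd ε′
    periodic ε′-odd x y d with H.N ∣? x | H.N ∣? y
    ... | yes (divides p refl) | yes (divides q refl) = periodic G.ε-odd p q (G≋⇐ p q d)
    ... | yes e | no ¬e = contradiction (H.0⇒∣ (H.≋-trans (H.≋-sym (HG⇒H d)) (H.∣⇒0 e))) ¬e
    ... | no ¬e | yes e = contradiction (H.0⇒∣ (H.≋-trans (HG⇒H d) (H.∣⇒0 e))) ¬e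
    ... | no _  | no _  = periodic H.ε-odd x y (HG⇒H d)
    odd ε′-odd x ¬d with H.N ∣? x
    ... | yes (divides q refl) = trans (cong ε′ (ℤ.neg-distribˡ-* q H.N)) (trans (ε′-∣ (- q)) (odd G.ε-odd q
            (λ { (divides t e) → ¬d (divides t (trans (cong (_* H.N) e) (trans (ℤ.*-assoc t G.N H.N) (cong (_*_ t) (sym N-*))))) })))
    ... | no ¬e = trans (ε′-∤ (- x) (λ e → ¬e (∣-resp (ℤ.neg-involutive x) (∣-neg (- x) e)))) (odd H.ε-odd x ¬e)
      where ∣-neg : ∀ {n} y → n ∣ y → n ∣ - y
            ∣-neg y (divides q refl) = divides (- q) (ℤ.neg-distribˡ-* q _)

    -- With `ε′` as the odd function, the multiples of `H.n` in the half-system contribute `G.J a`.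
    -- The remaining indices form g complete blocks, in which l and `H.n` - l cancel because `φH` is
    -- even, and one half block 1,...,h, which contributes `H.J a`.
    J-modulus-* : ∀ {a} → HG.Unit a → HG.J a ≡ G.J a · H.J a
    J-modulus-* {a} ua = begin
      HG.J a
        ≡⟨ HG.J≡ΠJ a ⟩
      Π (suc half) (λ j → HG.ε (a * + j) · HG.ε (+ j))
        ≡⟨ HG.Π-odd-independent HG.ε-odd ε′-odd ua ⟩
      Π (suc half) F
        ≡⟨ cong (λ k → Π k F) (sym (ℕ.+-suc (g ℕ.* H.n) h)) ⟩
      Π (g ℕ.* H.n ℕ.+ suc h) F
        ≡⟨ Π.∑-split (g ℕ.* H.n) (suc h) F ⟩
      Π (g ℕ.* H.n) F · Π (suc h) (λ l → F (g ℕ.* H.n ℕ.+ l))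
        ≡⟨ cong₂ _·_ (trans (Π.∑-blocks g H.n F) (Π.∑-cong g (λ i i<g → block i)))
                     (trans (Π.∑-head h (λ l → F (g ℕ.* H.n ℕ.+ l))) (cong₂ _·_ (multiple g) (Π.∑-cong h (λ l l<h → non-multiple g (suc l)
                         (s≤s z≤n) (H.≤h⇒<n l<h))))) ⟩
      Π g (λ i → φG i) · (φG g · Π h (λ l → φH (suc l)))
        ≡⟨ Sign.*-assoc (Π g (λ i → φG i)) (φG g) (Π h (λ l → φH (suc l))) ⟨
      Π (suc g) (λ i → φG i) · Π h (λ l → φH (suc l))
        ≡⟨ cong₂ _·_ (sym (G.J≡ΠJ a)) (sym (trans (H.J≡ΠJ a) (trans (Π.∑-head h φH) (cong (_· Π h (λ l → φH (suc l))) φ0)))) ⟩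
      G.J a · H.J a ∎
      where
      open ≡-Reasoning

      F : ℕ → Sign
      F j = ε′ (a * + j) · ε′ (+ j)
      φG φH : ℕ → Sign
      φG i = G.ε (a * + i) · G.ε (+ i)
      φH l = H.ε (a * + l) · H.ε (+ l)

      φ0 : φH 0 ≡ Sign.+
      φ0 = cong₂ _·_ (trans (cong H.ε (ℤ.*-zeroʳ a)) (H.ε-half 0 z≤n)) (H.ε-half 0 z≤n)

      multiple : ∀ i → F (i ℕ.* H.n ℕ.+ 0) ≡ φG i
      multiple i = cong₂ _·_ (trans (cong ε′ (trans (cong (_*_ a) e) (sym (ℤ.*-assoc a (+ i) H.N)))) (ε′-∣ (a * + i)))
                             (trans (cong ε′ e) (ε′-∣ (+ i)))
        where
        e : + (i ℕ.* H.n ℕ.+ 0) ≡ + i * H.N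
        e = trans (cong +_ (ℕ.+-identityʳ (i ℕ.* H.n))) (ℤ.pos-* i H.n)

      non-multiple : ∀ i l → 0 < l → l < H.n → F (i ℕ.* H.n ℕ.+ l) ≡ φH l
      non-multiple i l 0<l l<n = cong₂ _·_
        (trans (ε′-∤ (a * + j) (λ d → ¬d (H.unit-cancel (unit-H ua) (+ j) d))) (periodic H.ε-odd (a * + j) (a * + l) (H.≋-*ˡ a j≋l)))
        (trans (ε′-∤ (+ j) ¬d) (periodic H.ε-odd (+ j) (+ l) j≋l))
        where
        j = i ℕ.* H.n ℕ.+ l
        alg : ∀ x y → x + y - y ≡ x
        alg = solve-∀
        j≋l : + j H.≋ + l
        j≋l = mod (divides (+ i) (trans (cong (λ z → z - + l) (trans (ℤ.pos-+ (i ℕ.* H.n) l) (cong (_+ + l) (ℤ.pos-* i H.n)))) (alg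
            (+ i * H.N) (+ l))))
        ¬d : ¬ H.N ∣ + j
        ¬d d = ℕ.<⇒≢ 0<l (sym (ℤ.+-injective (small-multiple H.n (+ l) (H.0⇒∣ (H.≋-trans (H.≋-sym j≋l) (H.∣⇒0 d))) l<n)))

      φH-reflect : ∀ l → l < h → φH (suc h ℕ.+ l) ≡ φH (suc (h ℕ.∸ suc l))
      φH-reflect l l<h = H.odd·odd-even (H.dilate-odd H.ε-odd (unit-H ua)) H.ε-odd (+ (suc h ℕ.+ l)) (+ suc (h ℕ.∸ suc l))
        (anti (mod (divides 1ℤ (trans (cong (_+_ (+ (suc h ℕ.+ l))) (ℤ.neg-involutive (+ suc (h ℕ.∸ suc l))))
          (trans (cong +_ (sum (h ℕ.∸ suc l) (ℕ.m∸n+n≡m l<h))) (sym (ℤ.*-identityˡ H.N)))))))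
        where
        alg : ∀ k l h → suc h ℕ.+ l ℕ.+ suc k ≡ suc (h ℕ.+ (k ℕ.+ suc l))
        alg = ℕ-solver.solve-∀
        sum : ∀ k → k ℕ.+ suc l ≡ h → suc h ℕ.+ l ℕ.+ suc k ≡ H.n
        sum k e = trans (alg k l h) (cong (λ z → suc (h ℕ.+ z)) e)

      reverse : ∀ (f : ℕ → Sign) → Π h (λ l → f (h ℕ.∸ suc l)) ≡ Π h f
      reverse f = Π.∑-permute h (λ l → h ℕ.∸ suc l) (λ l → h ℕ.∸ suc l) lt lt inv inv f
        where
        lt : ∀ l → l < h → h ℕ.∸ suc l < h
        lt l l<h = ℕ.∸-monoʳ-< {h} {suc l} {0} (s≤s z≤n) l<h
        inv : ∀ l → l < h → h ℕ.∸ suc (h ℕ.∸ suc l) ≡ l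
        inv l l<h = trans (cong (h ℕ.∸_) (sym (ℕ.+-∸-assoc 1 l<h))) (ℕ.m∸[m∸n]≡n (ℕ.<⇒≤ l<h))

      block : ∀ i → Π H.n (λ l → F (i ℕ.* H.n ℕ.+ l)) ≡ φG i
      block i = begin
        Π H.n (λ l → F (i ℕ.* H.n ℕ.+ l))
          ≡⟨ Π.∑-head (h ℕ.+ h) (λ l → F (i ℕ.* H.n ℕ.+ l)) ⟩
        F (i ℕ.* H.n ℕ.+ 0) · Π (h ℕ.+ h) (λ l → F (i ℕ.* H.n ℕ.+ suc l))
          ≡⟨ cong₂ _·_ (multiple i) (Π.∑-cong (h ℕ.+ h) (λ l l<2h → non-multiple i (suc l) (s≤s z≤n) (s≤s l<2h))) ⟩
        φG i · Π (h ℕ.+ h) (λ l → φH (suc l))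
          ≡⟨ cong (φG i ·_) (Π.∑-split h h (λ l → φH (suc l))) ⟩
        φG i · (Π h (λ l → φH (suc l)) · Π h (λ l → φH (suc (h ℕ.+ l))))
          ≡⟨ cong (λ s → φG i · (Π h (λ l → φH (suc l)) · s))
               (trans (Π.∑-cong h φH-reflect) (reverse (λ l → φH (suc l)))) ⟩
        φG i · (Π h (λ l → φH (suc l)) · Π h (λ l → φH (suc l)))
          ≡⟨ cong (φG i ·_) (Sign.s*s≡+ (Π h (λ l → φH (suc l)))) ⟩
        φG i · Sign.+
          ≡⟨ Sign.*-identityʳ (φG i) ⟩
        φG i ∎

  -- Squares modulo an odd prime

  module PrimeModulus (h : ℕ) (pr : Prime (Mod.n h)) where
    open Mod h
    open Odd

    euclid : ∀ x y → N ∣ x * y → N ∣ x ⊎ N ∣ y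
    euclid x y d with euclidsLemma (abs x) (abs y) pr (subst (n D.∣_) (ℤ.abs-* x y) (∣⇒∣ᵤ d))
    ... | inj₁ e = inj₁ (∣ᵤ⇒∣ e)
    ... | inj₂ e = inj₂ (∣ᵤ⇒∣ e)

    abstract
      unit-residue : ∀ r → 0 < r → r < n → Unit (+ r)
      unit-residue r@(suc _) 0<r r<n with coprime-Bézout (prime⇒coprime pr r<n)
      ... | Bézout.Identity.+- x y e = unit (- (+ y)) (mod (divides (- (+ x)) (alg (+ r) (+ x) (+ y) N (lift e))))
        where
        lift : 1 ℕ.+ y ℕ.* r ≡ x ℕ.* n → 1ℤ + + y * + r ≡ + x * N
        lift e = trans (cong (_+_ 1ℤ) (sym (ℤ.pos-* y r))) (trans (cong +_ e) (ℤ.pos-* x n))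
        alg : ∀ r x y n → 1ℤ + y * r ≡ x * n → r * (- y) - 1ℤ ≡ (- x) * n
        alg r x y n e = trans (alg1 r y) (trans (cong -_ e) (ℤ.neg-distribˡ-* x n))
          where alg1 : ∀ r y → r * (- y) - 1ℤ ≡ - (1ℤ + y * r)
                alg1 = solve-∀
      ... | Bézout.Identity.-+ x y e = unit (+ y) (mod (divides (+ x) (trans (cong (λ z → z - 1ℤ) (trans (ℤ.*-comm (+ r) (+ y)) (sym
          (lift e)))) (alg (+ x * N)))))
        where
        lift : 1 ℕ.+ x ℕ.* n ≡ y ℕ.* r → 1ℤ + + x * N ≡ + y * + r
        lift e = trans (cong (_+_ 1ℤ) (sym (ℤ.pos-* x n))) (trans (cong +_ e) (ℤ.pos-* y r))
        alg : ∀ z → 1ℤ + z - 1ℤ ≡ z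
        alg = solve-∀

    ∤⇒unit : ∀ x → ¬ N ∣ x → Unit x
    ∤⇒unit x ¬d = unit-≋ (≋-sym (res-≋ x)) (unit-residue (res x) (ℕ.n≢0⇒n>0 (λ e → ¬d (0⇒∣ (subst (λ r → x ≋ + r) e (res-≋ x))))) (res< x))

    1<n : 1 < n
    1<n = ℕ.nonTrivial⇒n>1 n ⦃ prime⇒nonTrivial pr ⦄

    ¬1≋0 : ¬ 1ℤ ≋ 0ℤ
    ¬1≋0 d = contradiction (res-unique′ 1 0 1<n (ℕ.<-trans (s≤s z≤n) 1<n) d) (λ ())

    unit⇒∤ : ∀ {x} → Unit x → ¬ N ∣ x
    unit⇒∤ {x} (unit x′ p) d = ¬1≋0 (≋-trans (≋-sym p) (≋-trans (≋-*ʳ x′ (∣⇒0 d)) (≋-reflexive (ℤ.*-zeroˡ x′))))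

    abstract
      -- The value 0 at multiples of n makes `Pairing.ι` fix the index 0 with sign `+`, so that `ι`
      -- acts on the whole half-system.
      inv : ℤ → ℤ
      inv x with N ∣? x
      ... | yes _ = 0ℤ
      ... | no ¬d = Unit.inv (∤⇒unit x ¬d)

      inv-≋ : ∀ x → ¬ N ∣ x → x * inv x ≋ 1ℤ
      inv-≋ x ¬d with N ∣? x
      ... | yes d = contradiction d ¬d
      ... | no ¬e = Unit.inv-≋ (∤⇒unit x ¬e)

      inv-0 : inv 0ℤ ≡ 0ℤ
      inv-0 with N ∣? 0ℤ
      ... | yes _ = refl
      ... | no ¬d = contradiction (0⇒∣ ≋-refl) ¬d

    ¬N∣suc : ∀ j → suc j ≤ h → ¬ N ∣ + suc j
    ¬N∣suc j j<h d = contradiction (small-multiple n (+ suc j) d (≤h⇒<n j<h)) (λ ())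

    Square : ℤ → Set
    Square a = ∃[ x ] a ≋ x * x

    square? : ∀ a → Dec (Square a)
    square? a with ℕ.anyUpTo? (λ x → N ∣? (a - + x * + x)) n
    ... | yes (x , _ , d) = yes (+ x , mod d)
    ... | no ¬p = no λ { (x , d) → ¬p (res x , res< x , N∣ (≋-trans d (≋-* (res-≋ x) (res-≋ x)))) }

    ε-fold : ∀ x → (ε x ≡ Sign.+ × x ≋ + fold x) ⊎ (ε x ≡ Sign.- × x ≋ - (+ fold x))
    ε-fold x with res x ≤? h
    ... | yes _ = inj₁ (refl , res-≋ x)
    ... | no  _ = inj₂ (refl , ≋-trans (≋-trans (res-≋ x) (≋-reflexive (sym (ℤ.neg-involutive (+ res x))))) (≋-neg (≋-sym (n∸-≋ (res< x)))))

    -- For a prime to n, ι pairs j with the element i of the half-system for which ij ≡ ±a, and τ j is the sign.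
    module Pairing (a : ℤ) (ua : Unit a) where
      ι : ℕ → ℕ
      ι j = fold (a * inv (+ j))

      τ : ℕ → Sign
      τ j = ε (a * inv (+ j))

      ι≤ : ∀ j → ι j ≤ h
      ι≤ j = fold≤ (a * inv (+ j))

      fold-0 : fold 0ℤ ≡ 0
      fold-0 with res 0ℤ ≤? h
      ... | yes _ = refl
      ... | no ¬p = contradiction z≤n ¬p

      ι-0 : ι 0 ≡ 0
      ι-0 = trans (cong fold (trans (cong (_*_ a) inv-0) (ℤ.*-zeroʳ a))) fold-0

      τ-0 : τ 0 ≡ Sign.+
      τ-0 = trans (cong ε (trans (cong (_*_ a) inv-0) (ℤ.*-zeroʳ a))) (ε-half 0 z≤n)

      τ-ι : ∀ j → suc j ≤ h →
            (τ (suc j) ≡ Sign.+ × a ≋ + ι (suc j) * + suc j) ⊎ (τ (suc j) ≡ Sign.- × a ≋ - (+ ι (suc j)) * + suc j)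
      τ-ι j j<h with ε-fold (a * inv (+ suc j))
      ... | inj₁ (e , d) = inj₁ (e , ≋-trans (unfold a (+ suc j) (inv (+ suc j)) (inv-≋ (+ suc j) (¬N∣suc j j<h))) (≋-*ʳ (+ suc j) d))
        where unfold : ∀ a j i → j * i ≋ 1ℤ → a ≋ a * i * j
              unfold a j i p = ≋-trans (≋-reflexive (sym (ℤ.*-identityʳ a))) (≋-trans (≋-*ˡ a (≋-sym p)) (≋-reflexive (alg a i j)))
                where alg : ∀ a i j → a * (j * i) ≡ a * i * j
                      alg = solve-∀
      ... | inj₂ (e , d) = inj₂ (e , ≋-trans (unfold a (+ suc j) (inv (+ suc j)) (inv-≋ (+ suc j) (¬N∣suc j j<h))) (≋-*ʳ (+ suc j) d))
        where unfold : ∀ a j i → j * i ≋ 1ℤ → a ≋ a * i * j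
              unfold a j i p = ≋-trans (≋-reflexive (sym (ℤ.*-identityʳ a))) (≋-trans (≋-*ˡ a (≋-sym p)) (≋-reflexive (alg a i j)))
                where alg : ∀ a i j → a * (j * i) ≡ a * i * j
                      alg = solve-∀

      ι≢0 : ∀ j → suc j ≤ h → ι (suc j) ≢ 0
      ι≢0 j j<h e with τ-ι j j<h
      ... | inj₁ (_ , d) = unit⇒∤ ua (0⇒∣ (subst (λ i → a ≋ + i * + suc j) e d))
      ... | inj₂ (_ , d) = unit⇒∤ ua (0⇒∣ (subst (λ i → a ≋ - (+ i) * + suc j) e d))

      quot : ∀ i (s : ℤ) → suc i ≤ h → a ≋ s * + suc i → a * inv (+ suc i) ≋ s
      quot i s i<h d = ≋-trans (≋-*ʳ (inv (+ suc i)) d) (≋-trans (≋-reflexive (ℤ.*-assoc s (+ suc i) (inv (+ suc i))))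
        (≋-trans (≋-*ˡ s (inv-≋ (+ suc i) (¬N∣suc i i<h))) (≋-reflexive (ℤ.*-identityʳ s))))

      -- The relation ij ≡ ±a is symmetric and determines each index and the sign from the other
      -- index. `ι (suc j)` enters through a variable `i` so that it can be split into zero and
      -- successor.
      involutive : ∀ j → suc j ≤ h → ∀ i → ι (suc j) ≡ i → ι i ≡ suc j × τ i ≡ τ (suc j)
      involutive j j<h zero    e = contradiction e (ι≢0 j j<h)
      involutive j j<h (suc i) e with τ-ι j j<h
      ... | inj₁ (f , d) =
          half-unique (ι (suc i)) (suc j) (ι≤ (suc i)) j<h (≈-trans (≈-sym (≈-fold (a * inv (+ suc i)))) (same q)) ,
          trans (trans (periodic ε-odd (a * inv (+ suc i)) (+ suc j) q) (ε-half (suc j) j<h)) (sym f)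
        where q = quot i (+ suc j) (subst (_≤ h) e (ι≤ (suc j)))
                    (≋-trans d (≋-reflexive (trans (cong (λ k → + k * + suc j) e) (ℤ.*-comm (+ suc i) (+ suc j)))))
      ... | inj₂ (f , d) =
          half-unique (ι (suc i)) (suc j) (ι≤ (suc i)) j<h (≈-trans (≈-sym (≈-fold (a * inv (+ suc i)))) (anti q)) ,
          trans (trans (periodic ε-odd (a * inv (+ suc i)) (- (+ suc j)) q)
                       (trans (odd ε-odd (+ suc j) (¬N∣suc j j<h)) (cong opposite (ε-half (suc j) j<h)))) (sym f)
        where q = quot i (- (+ suc j)) (subst (_≤ h) e (ι≤ (suc j)))
                    (≋-trans d (≋-reflexive (trans (cong (λ k → - (+ k) * + suc j) e) (alg (+ suc i) (+ suc j)))))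
                where alg : ∀ i j → - i * j ≡ - j * i
                      alg = solve-∀

      ιι : ∀ j → j ≤ h → ι (ι j) ≡ j
      ιι zero    _   = trans (cong ι ι-0) ι-0
      ιι (suc j) j<h = proj₁ (involutive j j<h (ι (suc j)) refl)

      τι : ∀ j → j ≤ h → τ (ι j) ≡ τ j
      τι zero    _   = cong τ ι-0
      τι (suc j) j<h = proj₂ (involutive j j<h (ι (suc j)) refl)

      A : Sign
      A = Π (suc h) τ

      fixed : ℕ → Sign
      fixed j = Π.[ ι j ℕ.≟ j ⇒ τ j ]

      A≡fixed : A ≡ Π (suc h) fixed
      A≡fixed = Π.∑-involution Sign.s*s≡+ (suc h) ι (λ j _ → s≤s (ι≤ j)) (λ j j<sh → ιι j (ℕ.≤-pred j<sh)) τ (λ j j<sh → τι j (ℕ.≤-pred j<sh))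

      fixed-minus : ∀ j → j ≤ h → fixed j ≡ Sign.- → - a ≋ + j * + j
      fixed-minus zero _ e with ι 0 ℕ.≟ 0
      ... | yes _ = contradiction (trans (sym τ-0) e) (λ ())
      fixed-minus (suc j) j<h e with ι (suc j) ℕ.≟ suc j
      fixed-minus (suc j) j<h e | yes p with τ-ι j j<h
      ... | inj₁ (f , _) = contradiction (trans (sym f) e) (λ ())
      ... | inj₂ (_ , d) = ≋-trans (≋-neg d) (≋-reflexive (trans (alg (+ ι (suc j)) (+ suc j)) (cong (λ i → + i * + suc j) p)))
        where alg : ∀ i j → - (- i * j) ≡ i * j
              alg = solve-∀

      -- Only fixed indices survive in `A`, and a fixed j of sign `-` satisfies - a ≡ j².
      A-nonsquare : ¬ Square (- a) → A ≡ Sign.+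
      A-nonsquare ¬s = trans A≡fixed (Π.∑-ε (suc h) (λ j j<sh → plus j (ℕ.≤-pred j<sh) (fixed j) refl))
        where
        plus : ∀ j → j ≤ h → ∀ s → fixed j ≡ s → fixed j ≡ Sign.+
        plus j j≤h Sign.+ e = e
        plus j j≤h Sign.- e = contradiction (+ j , fixed-minus j j≤h e) ¬s

      -- Modulo a prime the root of - a is unique up to sign, so exactly one element of the
      -- half-system is fixed with sign `-`.
      A-square : Square (- a) → A ≡ Sign.-
      A-square (x , d) = trans A≡fixed (trans (Π.∑-single (suc h) i (s≤s (fold≤ x)) (λ j j<sh j≢i → plus j (ℕ.≤-pred j<sh) j≢i (fixed j) refl)) at-i)
        where
        i = fold x
        x²≋ : ∀ {x y} → x ≈ y → x * x ≋ y * y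
        x²≋ (same p) = ≋-* p p
        x²≋ {y = y} (anti p) = ≋-trans (≋-* p p) (≋-reflexive (alg y))
          where alg : ∀ y → (- y) * (- y) ≡ y * y
                alg = solve-∀
        roots : ∀ x y → x * x ≋ y * y → x ≈ y
        roots x y (mod e) =
          [ (λ f → same (mod f)) , (λ f → anti (mod (∣-resp (cong (_+_ x) (sym (ℤ.neg-involutive y))) f))) ]′
          (euclid (x - y) (x + y) (∣-resp (alg x y) e))
          where alg : ∀ x y → x * x - y * y ≡ (x - y) * (x + y)
                alg = solve-∀
        plus : ∀ j → j ≤ h → j ≢ i → ∀ s → fixed j ≡ s → fixed j ≡ Sign.+
        plus j j≤h j≢i Sign.+ e = e
        plus j j≤h j≢i Sign.- e = contradiction (half-unique j i j≤h (fold≤ x)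
          (≈-trans (roots (+ j) x (≋-trans (≋-sym (fixed-minus j j≤h e)) d)) (≈-fold x))) j≢i
        -a≋i² : - a ≋ + i * + i
        -a≋i² = ≋-trans d (x²≋ (≈-fold x))
        a≋ : a ≋ - (+ i) * + i
        a≋ = ≋-trans (≋-reflexive (sym (ℤ.neg-involutive a))) (≋-trans (≋-neg -a≋i²) (≋-reflexive (ℤ.neg-distribˡ-* (+ i) (+ i))))
        at : ∀ i → i ≤ h → a ≋ - (+ i) * + i → fixed i ≡ Sign.-
        at zero    _   a≋ = contradiction (0⇒∣ a≋) (unit⇒∤ ua)
        at (suc k) k<h a≋ = trans (Π.[yes] (ι (suc k) ℕ.≟ suc k) (half-unique (ι (suc k)) (suc k) (ι≤ (suc k)) k<h (≈-trans (≈-sym (≈-fold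
            (a * inv (+ suc k)))) (anti q))))
          (trans (periodic ε-odd (a * inv (+ suc k)) (- (+ suc k)) q) (trans (odd ε-odd (+ suc k) (¬N∣suc k k<h)) (cong opposite (ε-half
              (suc k) k<h))))
          where q = quot k (- (+ suc k)) k<h a≋
        at-i : fixed i ≡ Sign.-
        at-i = at i (fold≤ x) a≋

    open Pairing using (A; A-square; A-nonsquare)

    -- Since x ↦ ε(ax) ε(x) is even, j may be replaced by its inverse in the product for `J a`; this
    -- turns it into the product of all ε(a/j) ε(1/j), that is, of `A` for a and `A` for 1.
    A≡J·A1 : ∀ a (ua : Unit a) → A a ua ≡ J a · A 1ℤ unit-1
    A≡J·A1 a ua = sym (begin
      J a · Π (suc h) (P1.τ)
        ≡⟨ cong (_· Π (suc h) P1.τ) (trans (J≡ΠJ a) (sym reindex)) ⟩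
      Π (suc h) (λ j → ε (a * inv (+ j)) · ε (inv (+ j))) · Π (suc h) P1.τ
        ≡⟨ cong₂ _·_ (Π.∑-∙ (suc h) (λ j → ε (a * inv (+ j))) (λ j → ε (inv (+ j))))
                     (Π.∑-cong (suc h) (λ j _ → cong ε (ℤ.*-identityˡ (inv (+ j))))) ⟩
      (A a ua · Q) · Q
        ≡⟨ Sign.*-assoc (A a ua) Q Q ⟩
      A a ua · (Q · Q)
        ≡⟨ cong (A a ua ·_) (Sign.s*s≡+ Q) ⟩
      A a ua · Sign.+
        ≡⟨ Sign.*-identityʳ (A a ua) ⟩
      A a ua ∎)
      where
      open ≡-Reasoning
      module P1 = Pairing 1ℤ unit-1
      Q = Π (suc h) (λ j → ε (inv (+ j)))
      reindex : Π (suc h) (λ j → ε (a * inv (+ j)) · ε (inv (+ j))) ≡ Π (suc h) (λ j → ε (a * + j) · ε (+ j))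
      reindex = trans
        (Π.∑-cong (suc h) (λ j _ → odd·odd-even (dilate-odd ε-odd ua) ε-odd (inv (+ j)) (+ P1.ι j)
          (≈-trans (same (≋-reflexive (sym (ℤ.*-identityˡ (inv (+ j)))))) (≈-fold (1ℤ * inv (+ j))))))
        (Π.∑-permute (suc h) P1.ι P1.ι (λ j _ → s≤s (P1.ι≤ j)) (λ j _ → s≤s (P1.ι≤ j))
          (λ j j< → P1.ιι j (ℕ.≤-pred j<)) (λ j j< → P1.ιι j (ℕ.≤-pred j<)) (λ j → ε (a * + j) · ε (+ j)))

    J≡A·A1 : ∀ a (ua : Unit a) → J a ≡ A a ua · A 1ℤ unit-1
    J≡A·A1 a ua = trans (sym (Sign.*-identityʳ (J a))) (trans (cong (J a ·_) (sym (Sign.s*s≡+ A1)))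
      (trans (sym (Sign.*-assoc (J a) A1 A1)) (cong (_· A1) (sym (A≡J·A1 a ua)))))
      where A1 = A 1ℤ unit-1

    square-neg-quotient : ∀ {a} → Square (- 1ℤ) → Square (- a) → Square a
    square-neg-quotient {a} (x , d) (y , e) = x * y , ≋-trans (≋-reflexive (alg1 a)) (≋-trans (≋-* d e) (≋-reflexive (alg2 x y)))
      where alg1 : ∀ a → a ≡ - 1ℤ * - a
            alg1 = solve-∀
            alg2 : ∀ x y → x * x * (y * y) ≡ x * y * (x * y)
            alg2 = solve-∀

    -- `J a` is the product of `A` for a and `A` for 1, and these are `-` exactly if - a,
    -- respectively - 1, is a square. If both were squares, so would be a; if just one is, the
    -- product is `-`.
    nonsquare⇒J≡- : ∀ a → Unit a → ¬ Square a → J a ≡ Sign.-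
    nonsquare⇒J≡- a ua ¬s with square? (- 1ℤ) | square? (- a)
    ... | yes s1 | yes s = contradiction (square-neg-quotient s1 s) ¬s
    ... | yes s1 | no ¬t = trans (J≡A·A1 a ua) (cong₂ _·_ (A-nonsquare a ua ¬t) (A-square 1ℤ unit-1 s1))
    ... | no ¬s1 | yes t = trans (J≡A·A1 a ua) (cong₂ _·_ (A-square a ua t) (A-nonsquare 1ℤ unit-1 ¬s1))
    -- Here J a = J (- a) = + although J (- 1) = -.
    ... | no ¬s1 | no ¬t = contradiction (trans (sym J-a) (trans (cong J (sym (ℤ.-1*i≡-i a))) (trans (J-* (unit-neg unit-1) ua)
        (cong₂ _·_ J-1≡- Ja)))) (λ ())
      where
      A1 = A-nonsquare 1ℤ unit-1 ¬s1
      Ja : J a ≡ Sign.+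
      Ja = trans (J≡A·A1 a ua) (cong₂ _·_ (A-nonsquare a ua ¬t) A1)
      J-a : J (- a) ≡ Sign.+
      J-a = trans (J≡A·A1 (- a) (unit-neg ua)) (cong₂ _·_ (A-nonsquare (- a) (unit-neg ua) (λ s → ¬s (subst Square (ℤ.neg-involutive a) s))) A1)
      J-1≡- : J (- 1ℤ) ≡ Sign.-
      J-1≡- = trans (J≡A·A1 (- 1ℤ) (unit-neg unit-1)) (cong₂ _·_ (A-square (- 1ℤ) (unit-neg unit-1) (1ℤ , ≋-refl)) A1)

    J≡+⇒square : ∀ a → Unit a → J a ≡ Sign.+ → Square a
    J≡+⇒square a ua e with square? a
    ... | yes s = s
    ... | no ¬s = contradiction (trans (sym e) (nonsquare⇒J≡- a ua ¬s)) (λ ())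

    square⇒J≡+ : ∀ a → Unit a → Square a → J a ≡ Sign.+
    square⇒J≡+ a ua (x , d) = trans (J-cong a (x * x) d) (J-square (∤⇒unit x (λ e → unit⇒∤ ua (0⇒∣ (≋-trans d (∣⇒0 (∣n⇒∣m*n x e)))))))

  -- Divisor sums of a quadratic character

  module Σ where
    open Big _+_ 0ℤ ℤ.+-0-isCommutativeMonoid public

    ∑-*ˡ : ∀ c n (f : ℕ → ℤ) → ∑ n (λ i → c * f i) ≡ c * ∑ n f
    ∑-*ˡ c zero    f = sym (ℤ.*-zeroʳ c)
    ∑-*ˡ c (suc n) f = trans (cong (_+ c * f n) (∑-*ˡ c n f)) (sym (ℤ.*-distribˡ-+ c (∑ n f) (f n)))

    ∑-≤ : ∀ n {f g : ℕ → ℤ} → (∀ i → i < n → f i ℤ.≤ g i) → ∑ n f ℤ.≤ ∑ n g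
    ∑-≤ zero    le = ℤ.≤-refl
    ∑-≤ (suc n) le = ℤ.+-mono-≤ (∑-≤ n (λ i i<n → le i (ℕ.m<n⇒m<1+n i<n))) (le n ℕ.≤-refl)

    ∑-nonneg : ∀ n {f : ℕ → ℤ} → (∀ i → i < n → 0ℤ ℤ.≤ f i) → 0ℤ ℤ.≤ ∑ n f
    ∑-nonneg n {f} le = ℤ.≤-trans (ℤ.≤-reflexive (sym (∑-ε n {λ _ → 0ℤ} (λ _ _ → refl)))) (∑-≤ n le)

  Σ : ℕ → (ℕ → ℤ) → ℤ
  Σ = Σ.∑

  signℤ : Sign → ℤ
  signℤ Sign.+ = 1ℤ
  signℤ Sign.- = - 1ℤ

  signℤ-· : ∀ s t → signℤ (s · t) ≡ signℤ s * signℤ t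
  signℤ-· Sign.+ Sign.+ = refl
  signℤ-· Sign.+ Sign.- = refl
  signℤ-· Sign.- Sign.+ = refl
  signℤ-· Sign.- Sign.- = refl

  ⌊1+n+n/2⌋ : ∀ n → ⌊ suc (n ℕ.+ n) /2⌋ ≡ n
  ⌊1+n+n/2⌋ zero    = refl
  ⌊1+n+n/2⌋ (suc n) = trans (cong (λ k → ⌊ suc (suc k) /2⌋) (ℕ.+-suc n n)) (cong suc (⌊1+n+n/2⌋ n))

  bézoutℤ : ∀ p z → Coprime p z → ∃[ a ] ∃[ b ] a * + p + b * + z ≡ 1ℤ
  bézoutℤ p z c = from (coprime-Bézout c)
    where
    from : Bézout.Identity.Identity 1 p z → ∃[ a ] ∃[ b ] a * + p + b * + z ≡ 1ℤ
    from (Bézout.Identity.+- x y e) = + x , - (+ y) , trans (cong (λ q → q + - (+ y) * + z) (trans (sym (ℤ.pos-* x p)) (trans (cong +_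
        (sym e)) (cong (_+_ 1ℤ) (ℤ.pos-* y z))))) (alg (+ y) (+ z))
      where alg : ∀ y z → 1ℤ + y * z + - y * z ≡ 1ℤ
            alg = solve-∀
    from (Bézout.Identity.-+ x y e) = - (+ x) , + y , trans (cong (_+_ (- (+ x) * + p)) (trans (sym (ℤ.pos-* y z)) (trans (cong +_
        (sym e)) (cong (_+_ 1ℤ) (ℤ.pos-* x p))))) (alg (+ x) (+ p))
      where alg : ∀ x p → - x * p + (1ℤ + x * p) ≡ 1ℤ
            alg = solve-∀

  ∤p⇒∣ : ∀ {p} → Prime p → ∀ {d} → ¬ p D.∣ d → ∀ e {y} → d D.∣ p ^ e ℕ.* y → d D.∣ y
  ∤p⇒∣ {p} pr {d} ¬p∣d zero    {y} d∣ = subst (d D.∣_) (ℕ.*-identityˡ y) d∣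
  ∤p⇒∣ {p} pr {d} ¬p∣d (suc e) {y} d∣ = ∤p⇒∣ pr ¬p∣d e (coprime-divisor cop (subst (d D.∣_) (ℕ.*-assoc p (p ^ e) y) d∣))
    where
    cop : Coprime d p
    cop (i∣d , i∣p) with prime⇒irreducible pr i∣p
    ... | inj₁ i≡1 = i≡1
    ... | inj₂ refl = contradiction i∣d ¬p∣d

  abstract
    extract : ∀ p → Prime p → ∀ y → 0 < y → ∃[ e ] ∃[ y′ ] (y ≡ p ^ e ℕ.* y′ × ¬ p D.∣ y′)
    extract p pr = <-rec _ step
      where
      step : ∀ y → (∀ {z} → z < y → 0 < z → ∃[ e ] ∃[ y′ ] (z ≡ p ^ e ℕ.* y′ × ¬ p D.∣ y′)) →
             0 < y → ∃[ e ] ∃[ y′ ] (y ≡ p ^ e ℕ.* y′ × ¬ p D.∣ y′)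
      step y rec 0<y with p D.∣? y
      ... | no ¬d = 0 , y , sym (ℕ.*-identityˡ y) , ¬d
      ... | yes (D.divides zero    refl) = contradiction 0<y (ℕ.<-irrefl refl)
      ... | yes (D.divides q@(suc _) refl) with rec (ℕ.m<m*n q p (ℕ.nonTrivial⇒n>1 p ⦃ prime⇒nonTrivial pr ⦄)) (s≤s z≤n)
      ...   | e , y′ , eq , ¬d = suc e , y′ , trans (cong (ℕ._* p) eq) (alg (p ^ e) y′ p) , ¬d
        where alg : ∀ a y p → a ℕ.* y ℕ.* p ≡ p ℕ.* a ℕ.* y
              alg = ℕ-solver.solve-∀

    prime-divisor : ∀ y → 1 < y → ∃[ p ] (Prime p × p D.∣ y)
    prime-divisor y@(suc _) 1<y with factorise y
    ... | record { factors = [] ; isFactorisation = e } = contradiction (sym e) (ℕ.<⇒≢ 1<y)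
    ... | record { factors = p ∷ ps ; isFactorisation = e ; factorsPrime = pr ∷ _ } =
      p , pr , subst (p D.∣_) (sym e) (D.m∣m*n _)

  module Genus (K : ℕ) where

    M : ℕ
    M = 4 ℕ.* K

    -- Coprimality to 4K as a Bézout identity, whose coefficient of `M` yields the inverse of -K
    -- modulo d.
    record Cop (d : ℕ) : Set where
      constructor cop
      field
        u v    : ℤ
        bezout : u * + M + v * + d ≡ 1ℤ

    cop-factor : ∀ d e → Cop (d ℕ.* e) → Cop d
    cop-factor d e (cop u v b) = cop u (v * + e) (trans (cong (_+_ (u * + M)) (alg v (+ d) (+ e))) (trans (cong (λ z → u * + M + v * z)
        (sym (ℤ.pos-* d e))) b))
      where alg : ∀ v d e → v * e * d ≡ v * (d * e)
            alg = solve-∀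

    cop-∣ : ∀ {d y} → d D.∣ y → Cop y → Cop d
    cop-∣ {d} (D.divides q refl) c = cop-factor d q (subst Cop (ℕ.*-comm q d) c)

    cop-* : ∀ d e → Cop d → Cop e → Cop (d ℕ.* e)
    cop-* d e (cop u v b) (cop u′ v′ b′) = cop (u + v * + d * u′) (v * v′)
      (trans (cong (λ z → (u + v * + d * u′) * + M + v * v′ * z) (ℤ.pos-* d e))
        (trans (alg u v u′ v′ (+ M) (+ d) (+ e)) (trans (cong (λ z → u * + M + v * + d * z) b′) (trans (cong (_+_ (u * + M))
            (ℤ.*-identityʳ (v * + d))) b))))
      where alg : ∀ u v u′ v′ m d e → (u + v * d * u′) * m + v * v′ * (d * e) ≡ u * m + v * d * (u′ * m + v′ * e)
            alg = solve-∀

    cop-odd : ∀ d → Cop d → ∃[ h ] d ≡ suc (h ℕ.+ h)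
    cop-odd d (cop u v b) with even∨odd d
    ... | h , inj₂ e = h , e
    ... | h , inj₁ refl = contradiction (small-multiple 2 1ℤ (divides (u * (+ 2 * + K) + v * + h)
        (trans (sym b) (trans (cong₂ (λ x y → u * x + v * y) (ℤ.pos-* 4 K) (ℤ.pos-+ h h)) (alg u v (+ K) (+ h))))) (s≤s (s≤s z≤n))) (λ ())
      where alg : ∀ u v k h → u * (+ 4 * k) + v * (h + h) ≡ (u * (+ 2 * k) + v * h) * + 2
            alg = solve-∀

    cop⇒unit : ∀ h → Cop (suc (h ℕ.+ h)) → Mod.Unit h (- (+ K))
    cop⇒unit h (cop u v b) = Mod.unit (- (+ 4 * u)) (Mod.mod (divides (- v)
      (trans (alg (+ K) u v (Mod.N h)) (trans (cong (λ z → - v * Mod.N h + (z - 1ℤ)) (trans (cong (λ m → u * m + v * Mod.N h) (sym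
          (ℤ.pos-* 4 K))) b)) (ℤ.+-identityʳ (- v * Mod.N h))))))
      where alg : ∀ k u v n → - k * - (+ 4 * u) - 1ℤ ≡ - v * n + (u * (+ 4 * k) + v * n - 1ℤ)
            alg = solve-∀

    abstract
      -- The symbol (-K / d): for odd d the parameter `h` of `Mod` is ⌊d/2⌋. It is abstract to keep
      -- the defining product folded.
      ψ : ℕ → Sign
      ψ d = Mod.J ⌊ d /2⌋ (- (+ K))

      ψ-J : ∀ h → ψ (suc (h ℕ.+ h)) ≡ Mod.J h (- (+ K))
      ψ-J h = cong (λ k → Mod.J k (- (+ K))) (⌊1+n+n/2⌋ h)

    ψ-* : ∀ d e → Cop d → Cop e → ψ (d ℕ.* e) ≡ ψ d · ψ e
    ψ-* d e cd ce with cop-odd d cd | cop-odd e ce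
    ... | g , refl | h , refl = trans (cong ψ (sym n-*)) (trans (ψ-J half) (trans
        (J-modulus-* (cop⇒unit half (subst Cop (sym n-*) (cop-* d e cd ce))))
        (cong₂ _·_ (sym (ψ-J g)) (sym (ψ-J h)))))
      where open Composite h g

    ψ-split : ∀ p → Prime p → Cop p → ψ p ≡ Sign.+ → ∃[ t ] + p ∣ t * t + + K
    ψ-split p pr cp e with cop-odd p cp
    ... | h , refl with PrimeModulus.J≡+⇒square h pr (- (+ K)) (cop⇒unit h cp) (trans (sym (ψ-J h)) e)
    ...   | t , Mod.mod d = t , ∣-resp (alg (+ K) t) (∣n⇒∣m*n (- 1ℤ) d)
      where alg : ∀ k t → - 1ℤ * (- k - t * t) ≡ t * t + k
            alg = solve-∀

    ψ-inert : ∀ p → Prime p → Cop p → ψ p ≡ Sign.- → ∀ t → ¬ + p ∣ t * t + + K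
    ψ-inert p pr cp e t d with cop-odd p cp
    ... | h , refl = contradiction (trans (sym e) (trans (ψ-J h) (PrimeModulus.square⇒J≡+ h pr (- (+ K)) (cop⇒unit h cp)
        (t , Mod.mod (∣-resp (alg (+ K) t) (∣n⇒∣m*n (- 1ℤ) d)))))) (λ ())
      where alg : ∀ k t → - 1ℤ * (t * t + k) ≡ - k - t * t
            alg = solve-∀

    ψℤ : ℕ → ℤ
    ψℤ d = signℤ (ψ d)

    ψℤ-* : ∀ d e → Cop d → Cop e → ψℤ (d ℕ.* e) ≡ ψℤ d * ψℤ e
    ψℤ-* d e cd ce = trans (cong signℤ (ψ-* d e cd ce)) (signℤ-· (ψ d) (ψ e))

    divisorTerm : ℕ → ℕ → ℤ
    divisorTerm y d = Σ.[ d D.∣? y ⇒ ψℤ d ]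

    g : ℕ → ℤ
    g y = Σ (suc y) (divisorTerm y)

    g-extend : ∀ y → 0 < y → ∀ B → y < B → Σ B (divisorTerm y) ≡ g y
    g-extend y@(suc _) 0<y B y<B with ℕ.m≤n⇒∃[o]m+o≡n y<B
    ... | k , refl = trans (Σ.∑-split (suc y) k (divisorTerm y)) (trans (cong (_+_ (g y))
        (Σ.∑-ε k (λ i _ → Σ.[no] ((suc y ℕ.+ i) D.∣? y) (>⇒∤ (s≤s (ℕ.m≤m+n y i)))))) (ℤ.+-identityʳ (g y)))

    ∑-multiples : ∀ p → 0 < p → ∀ B (f : ℕ → ℤ) → Σ (B ℕ.* p) (λ d → Σ.[ p D.∣? d ⇒ f d ]) ≡ Σ B (λ i → f (i ℕ.* p))
    ∑-multiples p 0<p B f = trans (Σ.∑-blocks B p _) (Σ.∑-cong B (λ i _ → trans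
        (Σ.∑-single p 0 0<p (λ l l<p l≢0 → Σ.[no] (p D.∣? (i ℕ.* p ℕ.+ l))
          (λ d → l≢0 (small l l<p (D.∣m+n∣m⇒∣n d (D.n∣m*n i))))))
        (trans (Σ.[yes] (p D.∣? (i ℕ.* p ℕ.+ 0)) (subst (p D.∣_) (sym (ℕ.+-identityʳ (i ℕ.* p))) (D.n∣m*n i)))
               (cong f (ℕ.+-identityʳ (i ℕ.* p))))))
      where
      small : ∀ l → l < p → p D.∣ l → l ≡ 0
      small zero    _   _ = refl
      small (suc l) l<p d = contradiction d (>⇒∤ l<p)

    0<p^e*y : ∀ p → Prime p → ∀ e y → 0 < y → 0 < p ^ e ℕ.* y
    0<p^e*y p pr e y 0<y = ℕ.*-mono-≤ (ℕ.m^n>0 p ⦃ prime⇒nonZero pr ⦄ e) 0<y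

    -- A divisor of p^(e+1) y is a divisor of y or p times a divisor of p^e y.
    g-step : ∀ p → Prime p → ∀ e y → 0 < y → ¬ p D.∣ y → Cop (p ^ suc e ℕ.* y) →
             g (p ^ suc e ℕ.* y) ≡ g y + ψℤ p * g (p ^ e ℕ.* y)
    g-step p pr e y 0<y ¬p∣y c = begin
      g pz
        ≡⟨ g-extend pz (0<p^e*y p pr (suc e) y 0<y) B pz<B ⟨
      Σ B (divisorTerm pz)
        ≡⟨ Σ.∑-cong B (λ d _ → split d) ⟩
      Σ B (λ d → divisorTerm y d + Σ.[ p D.∣? d ⇒ divisorTerm pz d ])
        ≡⟨ Σ.∑-∙ B (divisorTerm y) _ ⟩
      Σ B (divisorTerm y) + Σ B (λ d → Σ.[ p D.∣? d ⇒ divisorTerm pz d ])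
        ≡⟨ cong₂ _+_ (g-extend y 0<y B y<B) (trans (∑-multiples p 0<p (suc z) (divisorTerm pz))
             (trans (Σ.∑-cong (suc z) (λ i _ → multiple i)) (Σ.∑-*ˡ (ψℤ p) (suc z) (divisorTerm z)))) ⟩
      g y + ψℤ p * g z ∎
      where
      open ≡-Reasoning
      instance
        _ = prime⇒nonZero pr
      z = p ^ e ℕ.* y
      pz = p ^ suc e ℕ.* y
      B = suc z ℕ.* p
      0<p : 0 < p
      0<p = ℕ.>-nonZero⁻¹ p
      pz≡ : pz ≡ z ℕ.* p
      pz≡ = trans (ℕ.*-assoc p (p ^ e) y) (ℕ.*-comm p z)
      pz<B : pz < B
      pz<B = subst (_< B) (sym pz≡) (ℕ.m<n+m (z ℕ.* p) 0<p)
      y<B : y < B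
      y<B = ℕ.≤-<-trans (ℕ.m≤n*m y (p ^ suc e) ⦃ ℕ.m^n≢0 p (suc e) ⦄) pz<B
      cz : Cop z
      cz = cop-factor z p (subst Cop pz≡ c)
      cp : Cop p
      cp = cop-factor p z (subst Cop (trans pz≡ (ℕ.*-comm z p)) c)
      split : ∀ d → divisorTerm pz d ≡ divisorTerm y d + Σ.[ p D.∣? d ⇒ divisorTerm pz d ]
      split d with p D.∣? d
      ... | yes p∣d = sym (trans (cong (_+ divisorTerm pz d) (Σ.[no] (d D.∣? y) (λ d∣y → ¬p∣y (D.∣-trans p∣d d∣y)))) (ℤ.+-identityˡ
          (divisorTerm pz d)))
      ... | no ¬p∣d = trans (Σ.[cong] (d D.∣? pz) (d D.∣? y) (∤p⇒∣ pr ¬p∣d (suc e)) (λ d∣y → D.∣-trans d∣y (D.n∣m*n (p ^ suc e)))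
          (λ _ → refl)) (sym (ℤ.+-identityʳ (divisorTerm y d)))
      multiple : ∀ i → divisorTerm pz (i ℕ.* p) ≡ ψℤ p * divisorTerm z i
      multiple i with i D.∣? z
      ... | yes i∣z = trans (Σ.[yes] ((i ℕ.* p) D.∣? pz) (subst ((i ℕ.* p) D.∣_) (sym pz≡) (D.*-monoˡ-∣ p i∣z)))
                        (trans (ψℤ-* i p (cop-∣ i∣z cz) cp) (ℤ.*-comm (ψℤ i) (ψℤ p)))
      ... | no ¬i∣z = trans (Σ.[no] ((i ℕ.* p) D.∣? pz) (λ d → ¬i∣z (D.*-cancelʳ-∣ p (subst ((i ℕ.* p) D.∣_) pz≡ d)))) (sym (ℤ.*-zeroʳ (ψℤ p)))

    cop-pred : ∀ p e y → Cop (p ^ suc e ℕ.* y) → Cop (p ^ e ℕ.* y)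
    cop-pred p e y c = cop-factor (p ^ e ℕ.* y) p (subst Cop (trans (ℕ.*-assoc p (p ^ e) y) (ℕ.*-comm p (p ^ e ℕ.* y))) c)

    -- For ψ(p) = 1 the recursion of `g-step` yields (e + 1) g(y). For ψ(p) = -1 its values
    -- alternate between g(y) and 0 as e grows.
    module _ (p : ℕ) (pr : Prime p) (y : ℕ) (0<y : 0 < y) (¬p∣y : ¬ p D.∣ y) where
      g-split : ψ p ≡ Sign.+ → ∀ e → Cop (p ^ e ℕ.* y) → 1ℤ ℤ.≤ g y → 1ℤ ℤ.≤ g (p ^ e ℕ.* y)
      g-split s zero    c le = subst (λ z → 1ℤ ℤ.≤ g z) (sym (ℕ.*-identityˡ y)) le
      g-split s (suc e) c le = ℤ.≤-trans (ℤ.+-mono-≤ le (ℤ.≤-trans (ℤ.+≤+ z≤n) (g-split s e (cop-pred p e y c) le)))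
        (ℤ.≤-reflexive (sym (trans (g-step p pr e y 0<y ¬p∣y c) (cong (_+_ (g y)) (trans (cong (λ t → signℤ t * g (p ^ e ℕ.* y)) s)
            (ℤ.*-identityˡ (g (p ^ e ℕ.* y))))))))

      g-zero : g y ≡ 0ℤ → ∀ e → Cop (p ^ e ℕ.* y) → g (p ^ e ℕ.* y) ≡ 0ℤ
      g-zero z zero    c = trans (cong g (ℕ.*-identityˡ y)) z
      g-zero z (suc e) c = trans (g-step p pr e y 0<y ¬p∣y c) (trans (cong₂ (λ a b → a + ψℤ p * b) z (g-zero z e (cop-pred p e y c)))
        (trans (ℤ.+-identityˡ (ψℤ p * 0ℤ)) (ℤ.*-zeroʳ (ψℤ p))))

      g-inert : ψ p ≡ Sign.- → ∀ f → Cop (p ^ (f ℕ.+ f) ℕ.* y) → g (p ^ (f ℕ.+ f) ℕ.* y) ≡ g y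
      g-inert-odd : ψ p ≡ Sign.- → ∀ f → Cop (p ^ suc (f ℕ.+ f) ℕ.* y) → g (p ^ suc (f ℕ.+ f) ℕ.* y) ≡ 0ℤ
      g-inert s zero    c = cong g (ℕ.*-identityˡ y)
      g-inert s (suc f) c rewrite ℕ.+-suc f f = trans (g-step p pr (suc (f ℕ.+ f)) y 0<y ¬p∣y c)
        (trans (cong (λ b → g y + ψℤ p * b) (g-inert-odd s f (cop-pred p (suc (f ℕ.+ f)) y c)))
          (trans (cong (_+_ (g y)) (ℤ.*-zeroʳ (ψℤ p))) (ℤ.+-identityʳ (g y))))
      g-inert-odd s f c = trans (g-step p pr (f ℕ.+ f) y 0<y ¬p∣y c)
        (trans (cong₂ (λ t b → g y + signℤ t * b) s (g-inert s f (cop-pred p (f ℕ.+ f) y c)))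
          (trans (cong (_+_ (g y)) (ℤ.-1*i≡-i (g y))) (ℤ.+-inverseʳ (g y))))

    -- The second case records the inert prime of odd exponent that makes g vanish, because it is
    -- this prime that excludes norms later.
    data Class (y : ℕ) : Set where
      good : 1ℤ ℤ.≤ g y → ∀ s z t → y ≡ s ℕ.* s ℕ.* z → + z ∣ t * t + + K → Class y
      bad  : g y ≡ 0ℤ → ∀ p → Prime p → ψ p ≡ Sign.- → ∀ f x → y ≡ p ^ suc (f ℕ.+ f) ℕ.* x → ¬ p D.∣ x → Class y

    crt : ∀ p z → Prime p → ¬ p D.∣ z → ∀ t₁ t₂ → + p ∣ t₁ * t₁ + + K → + z ∣ t₂ * t₂ + + K →
          ∃[ t ] + (p ℕ.* z) ∣ t * t + + K
    crt p z pr ¬d t₁ t₂ d₁ d₂ = combine (bézoutℤ p z coprime)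
      where
      coprime : Coprime p z
      coprime (i∣p , i∣z) with prime⇒irreducible pr i∣p
      ... | inj₁ i≡1 = i≡1
      ... | inj₂ refl = contradiction i∣z ¬d
      combine : ∃[ a ] ∃[ b ] a * + p + b * + z ≡ 1ℤ → ∃[ t ] + (p ℕ.* z) ∣ t * t + + K
      combine (a , b , e) = t , result d₁ d₂
        where
        P = + p
        Z = + z
        t = b * Z * t₁ + a * P * t₂
        -- t = t₁ + (t₂ - t₁) a p = t₂ + (t₁ - t₂) b z, and ap + bz = 1 splits t² + K as ap (t² + K) + bz (t² + K).
        t≡₁ : t ≡ t₁ + (t₂ - t₁) * a * P
        t≡₁ = trans (alg a b P Z t₁ t₂) (trans (cong (λ w → w * t₁ + (t₂ - t₁) * a * P) e) (cong (_+ (t₂ - t₁) * a * P) (ℤ.*-identityˡ t₁)))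
          where alg : ∀ a b P Z t₁ t₂ → b * Z * t₁ + a * P * t₂ ≡ (a * P + b * Z) * t₁ + (t₂ - t₁) * a * P
                alg = solve-∀
        t≡₂ : t ≡ t₂ + (t₁ - t₂) * b * Z
        t≡₂ = trans (alg a b P Z t₁ t₂) (trans (cong (λ w → w * t₂ + (t₁ - t₂) * b * Z) e) (cong (_+ (t₁ - t₂) * b * Z) (ℤ.*-identityˡ t₂)))
          where alg : ∀ a b P Z t₁ t₂ → b * Z * t₁ + a * P * t₂ ≡ (a * P + b * Z) * t₂ + (t₁ - t₂) * b * Z
                alg = solve-∀
        result : P ∣ t₁ * t₁ + + K → Z ∣ t₂ * t₂ + + K → + (p ℕ.* z) ∣ t * t + + K
        result d₁ d₂ = ∣-resp (trans (alg3 a b P Z (t * t + + K)) (trans (cong (_* (t * t + + K)) e) (ℤ.*-identityˡ (t * t + + K))))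
            (∣m∣n⇒∣m+n (∣n⇒∣m*n a (pz Z∣)) (∣n⇒∣m*n b (zp P∣)))
          where
          alg3 : ∀ a b P Z w → a * (P * w) + b * (Z * w) ≡ (a * P + b * Z) * w
          alg3 = solve-∀
          sq : ∀ u c w → (u + c * w) * (u + c * w) + + K ≡ (u * u + + K) + (+ 2 * u * c + c * c * w) * w
          sq u c w = alg u c w (+ K)
            where alg : ∀ u c w k → (u + c * w) * (u + c * w) + k ≡ (u * u + k) + (+ 2 * u * c + c * c * w) * w
                  alg = solve-∀
          P∣ : P ∣ t * t + + K
          P∣ = ∣-resp (trans (sym (sq t₁ ((t₂ - t₁) * a) P)) (cong (λ t → t * t + + K) (sym t≡₁)))
                 (∣m∣n⇒∣m+n d₁ (∣n⇒∣m*n (+ 2 * t₁ * ((t₂ - t₁) * a) + (t₂ - t₁) * a * ((t₂ - t₁) * a) * P) ∣-refl))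
          Z∣ : Z ∣ t * t + + K
          Z∣ = ∣-resp (trans (sym (sq t₂ ((t₁ - t₂) * b) Z)) (cong (λ t → t * t + + K) (sym t≡₂)))
                 (∣m∣n⇒∣m+n d₂ (∣n⇒∣m*n (+ 2 * t₂ * ((t₁ - t₂) * b) + (t₁ - t₂) * b * ((t₁ - t₂) * b) * Z) ∣-refl))
          pz : Z ∣ t * t + + K → + (p ℕ.* z) ∣ P * (t * t + + K)
          pz (divides q e) = divides q (trans (cong (_*_ P) e) (trans (alg P q Z) (cong (_*_ q) (sym (ℤ.pos-* p z)))))
            where alg : ∀ P q Z → P * (q * Z) ≡ q * (P * Z)
                  alg = solve-∀
          zp : P ∣ t * t + + K → + (p ℕ.* z) ∣ Z * (t * t + + K)
          zp (divides q e) = divides q (trans (cong (_*_ Z) e) (trans (alg P q Z) (cong (_*_ q) (sym (ℤ.pos-* p z)))))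
            where alg : ∀ P q Z → Z * (q * P) ≡ q * (P * Z)
                  alg = solve-∀

    g-1 : g 1 ≡ 1ℤ
    g-1 = trans (ℤ.+-identityˡ (Σ.[ 1 D.∣? 1 ⇒ ψℤ 1 ])) (trans (Σ.[yes] (1 D.∣? 1) D.∣-refl) (cong signℤ ψ1))
      where
      ψ1 : ψ 1 ≡ Sign.+
      ψ1 = trans (ψ-J 0) (trans (cong (Mod.ε 0) (ℤ.*-zeroʳ (- (+ K)))) (Mod.ε-half 0 0 z≤n))

    -- An even exponent of p is absorbed by s. An odd exponent leaves one factor p: it joins z if
    -- ψ(p) = 1, the root modulo pz coming from the Chinese remainder theorem as p does not divide
    -- z, and it makes the number bad if ψ(p) = -1.
    module Attach (p : ℕ) (pr : Prime p) (cp : Cop p) (y : ℕ) (0<y : 0 < y) (¬d : ¬ p D.∣ y) where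

      even-square : ∀ u s z → y ≡ s ℕ.* s ℕ.* z → p ^ (u ℕ.+ u) ℕ.* y ≡ (p ^ u ℕ.* s) ℕ.* (p ^ u ℕ.* s) ℕ.* z
      even-square u s z e = trans (cong₂ ℕ._*_ (ℕ.^-distribˡ-+-* p u u) e) (alg (p ^ u) s z)
        where alg : ∀ a s z → (a ℕ.* a) ℕ.* (s ℕ.* s ℕ.* z) ≡ (a ℕ.* s) ℕ.* (a ℕ.* s) ℕ.* z
              alg = ℕ-solver.solve-∀

      odd-square : ∀ u s z → y ≡ s ℕ.* s ℕ.* z → p ^ suc (u ℕ.+ u) ℕ.* y ≡ (p ^ u ℕ.* s) ℕ.* (p ^ u ℕ.* s) ℕ.* (p ℕ.* z)
      odd-square u s z e = trans (cong₂ ℕ._*_ (cong (p ℕ.*_) (ℕ.^-distribˡ-+-* p u u)) e) (alg p (p ^ u) s z)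
        where alg : ∀ p a s z → p ℕ.* (a ℕ.* a) ℕ.* (s ℕ.* s ℕ.* z) ≡ (a ℕ.* s) ℕ.* (a ℕ.* s) ℕ.* (p ℕ.* z)
              alg = ℕ-solver.solve-∀

      root-* : ψ p ≡ Sign.+ → ∀ s z t → y ≡ s ℕ.* s ℕ.* z → + z ∣ t * t + + K → ∃[ t₂ ] + (p ℕ.* z) ∣ t₂ * t₂ + + K
      root-* ψp s z t e d =
        crt p z pr (λ p∣z → ¬d (subst (p D.∣_) (sym e) (D.∣n⇒∣m*n (s ℕ.* s) p∣z))) (proj₁ r) t (proj₂ r) d
        where r = ψ-split p pr cp ψp

      attach-good : ∀ s z t → y ≡ s ℕ.* s ℕ.* z → + z ∣ t * t + + K → 1ℤ ℤ.≤ g y → ∀ σ → ψ p ≡ σ →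
                    ∀ k → Cop (p ^ k ℕ.* y) → ∃[ u ] (k ≡ u ℕ.+ u ⊎ k ≡ suc (u ℕ.+ u)) → Class (p ^ k ℕ.* y)
      attach-good s z t e d le Sign.+ ψp k ck (u , inj₁ refl) =
        good (g-split p pr y 0<y ¬d ψp k ck le) (p ^ u ℕ.* s) z t (even-square u s z e) d
      attach-good s z t e d le Sign.- ψp k ck (u , inj₁ refl) =
        good (ℤ.≤-trans le (ℤ.≤-reflexive (sym (g-inert p pr y 0<y ¬d ψp u ck)))) (p ^ u ℕ.* s) z t (even-square u s z e) d
      attach-good s z t e d le Sign.- ψp k ck (u , inj₂ refl) =
        bad (g-inert-odd p pr y 0<y ¬d ψp u ck) p pr ψp u y refl ¬d
      attach-good s z t e d le Sign.+ ψp k ck (u , inj₂ refl) =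
        good (g-split p pr y 0<y ¬d ψp k ck le) (p ^ u ℕ.* s) (p ℕ.* z) (proj₁ r) (odd-square u s z e) (proj₂ r)
        where r = root-* ψp s z t e d

      attach : ∀ k → Cop (p ^ k ℕ.* y) → Class y → Class (p ^ k ℕ.* y)
      attach k c (good le s z t e d) = attach-good s z t e d le (ψ p) refl k c (even∨odd k)
      attach k c (bad z q qr ψq f x e ¬q∣x) = bad (g-zero p pr y 0<y ¬d z k c) q qr ψq f (p ^ k ℕ.* x)
        (trans (cong (p ^ k ℕ.*_) e) (alg (p ^ k) (q ^ suc (f ℕ.+ f)) x))
        (λ q∣ → ¬q∣x (∤p⇒∣ pr (λ p∣q → ¬d (D.∣-trans p∣q q∣y)) k q∣))
        where
        alg : ∀ a b x → a ℕ.* (b ℕ.* x) ≡ b ℕ.* (a ℕ.* x)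
        alg = ℕ-solver.solve-∀
        q∣y : q D.∣ y
        q∣y = subst (q D.∣_) (sym e) (D.∣m⇒∣m*n x (D.m∣m*n (q ^ (f ℕ.+ f))))

    -- Strong induction that splits off the full power of one prime, since `Attach` asks for a
    -- cofactor prime to p.
    classify : ∀ y → 0 < y → Cop y → Class y
    classify = <-rec _ step
      where
      factor : ∀ y → (∀ {z} → z < y → 0 < z → Cop z → Class z) → 0 < y → Cop y → ∀ p → Prime p → p D.∣ y →
               ∀ e y′ → y ≡ p ^ e ℕ.* y′ → ¬ p D.∣ y′ → Class y
      factor y rec 0<y c p pr p∣y zero    y′ eq ¬d = contradiction (subst (p D.∣_) (trans eq (ℕ.*-identityˡ y′)) p∣y) ¬d
      factor y rec 0<y c p pr p∣y (suc e) y′ eq ¬d = subst Class (sym eq)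
        (Attach.attach p pr (cop-∣ p∣y c) y′ 0<y′ ¬d (suc e) (subst Cop eq c)
          (rec y′<y 0<y′ (cop-∣ (D.n∣m*n (p ^ suc e)) (subst Cop eq c))))
        where
        0<y′ : 0 < y′
        0<y′ = ℕ.n≢0⇒n>0 (λ { refl → ¬d (p D.∣0) })
        y′<y : y′ < y
        y′<y = subst (y′ <_) (trans (ℕ.*-comm y′ (p ^ suc e)) (sym eq)) (ℕ.m<m*n y′ (p ^ suc e) ⦃ ℕ.>-nonZero 0<y′ ⦄
                 (ℕ.<-≤-trans (ℕ.nonTrivial⇒n>1 p ⦃ prime⇒nonTrivial pr ⦄)
                   (ℕ.m≤m*n p (p ^ e) ⦃ ℕ.m^n≢0 p e ⦃ prime⇒nonZero pr ⦄ ⦄)))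

      step : ∀ y → (∀ {z} → z < y → 0 < z → Cop z → Class z) → 0 < y → Cop y → Class y
      step y rec 0<y c with y ℕ.≟ 1
      ... | yes refl = good (ℤ.≤-reflexive (sym g-1)) 1 1 0ℤ refl (divides (0ℤ * 0ℤ + + K) (sym (ℤ.*-identityʳ (0ℤ * 0ℤ + + K))))
      ... | no y≢1 =
        let p , pr , p∣y = prime-divisor y (ℕ.≤∧≢⇒< 0<y (λ e → y≢1 (sym e)))
            e , y′ , eq , ¬d = extract p pr y 0<y
        in factor y rec 0<y c p pr p∣y e y′ eq ¬d

    g-nonneg : ∀ y → 0 < y → Cop y → 0ℤ ℤ.≤ g y
    g-nonneg y 0<y c with classify y 0<y c
    ... | good le _ _ _ _ _ = ℤ.≤-trans (ℤ.+≤+ z≤n) le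
    ... | bad e _ _ _ _ _ _ _ = ℤ.≤-reflexive (sym e)

    -- If p did not divide w, then a/w would be a square root of -K modulo p.
    inert∣norm : ∀ p → Prime p → Cop p → ψ p ≡ Sign.- → ∀ a w → + p ∣ a * a + + K * (w * w) → + p ∣ a × + p ∣ w
    inert∣norm p pr cp ψp a w d with cop-odd p cp
    ... | h , refl = [ (λ z → z) , (λ z → z) ]′ (P.euclid a a
              (∣-resp (alg a w (+ K)) (∣m∣n⇒∣m+n d (∣n⇒∣m*n (- (+ K * w)) p∣w)))) , p∣w
      where
      module P = PrimeModulus h pr
      alg : ∀ a w k → a * a + k * (w * w) + - (k * w) * w ≡ a * a
      alg = solve-∀
      root : Mod.Unit h w → ∃[ t ] Mod.N h ∣ t * t + + K
      root (Mod.unit w′ (Mod.mod i)) = a * w′ ,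
        ∣-resp (alg2 a w w′ (+ K)) (∣m∣n⇒∣m+n (∣n⇒∣m*n (w′ * w′) d) (∣n⇒∣m*n (- (+ K * (w * w′ + 1ℤ))) i))
        where alg2 : ∀ a w w′ k → w′ * w′ * (a * a + k * (w * w)) + - (k * (w * w′ + 1ℤ)) * (w * w′ - 1ℤ) ≡ a * w′ * (a * w′) + k
              alg2 = solve-∀
      decide : Dec (Mod.N h ∣ w) → Mod.N h ∣ w
      decide (yes d) = d
      decide (no ¬d) = contradiction (proj₂ r) (ψ-inert (Mod.n h) pr cp ψp (proj₁ r))
        where r = root (P.∤⇒unit w ¬d)
      p∣w : Mod.N h ∣ w
      p∣w = decide (Mod.N h ∣? w)

    -- Both sides of a² + K w² = p^(2f+1) x are divided by p² until p divides x.
    norm-valuation : ∀ p → Prime p → Cop p → ψ p ≡ Sign.- → ∀ f x a w →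
                     a * a + + K * (w * w) ≡ + p * (+ (p ^ (f ℕ.+ f)) * + x) → + p ∣ + x
    norm-valuation p pr cp ψp f x a w e = descend f (inert∣norm p pr cp ψp a w (divides X (trans e (ℤ.*-comm (+ p) X)))) e
      where
      X = + (p ^ (f ℕ.+ f)) * + x
      instance
        _ = prime⇒nonZero pr
      P = + p
      alg : ∀ a w k p → a * p * (a * p) + k * (w * p * (w * p)) ≡ p * (p * (a * a + k * (w * w)))
      alg = solve-∀
      cancel : ∀ a₁ w₁ X → a ≡ a₁ * P → w ≡ w₁ * P → a * a + + K * (w * w) ≡ P * X → P * (a₁ * a₁ + + K * (w₁ * w₁)) ≡ X
      cancel a₁ w₁ X ea ew e = ℤ.*-cancelˡ-≡ P (P * (a₁ * a₁ + + K * (w₁ * w₁))) X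
        (trans (sym (alg a₁ w₁ (+ K) P)) (trans (sym (cong₂ (λ a w → a * a + + K * (w * w)) ea ew)) e))
      power : ∀ f → + (p ^ (suc f ℕ.+ suc f)) ≡ P * (P * + (p ^ (f ℕ.+ f)))
      power f = trans (cong (λ k → + (p ^ suc k)) (ℕ.+-suc f f)) (trans (ℤ.pos-* p (p ^ suc (f ℕ.+ f))) (cong (_*_ P) (ℤ.pos-* p (p ^ (f ℕ.+ f)))))
      assoc : ∀ p q x → p * (p * q) * x ≡ p * (p * (q * x))
      assoc = solve-∀
      descend : ∀ f → P ∣ a × P ∣ w → a * a + + K * (w * w) ≡ P * (+ (p ^ (f ℕ.+ f)) * + x) → P ∣ + x
      descend zero    (divides a₁ ea , divides w₁ ew) e = divides (a₁ * a₁ + + K * (w₁ * w₁))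
        (trans (sym (ℤ.*-identityˡ (+ x))) (trans (sym (cancel a₁ w₁ (1ℤ * + x) ea ew e)) (ℤ.*-comm P (a₁ * a₁ + + K * (w₁ * w₁)))))
      descend (suc f) (divides a₁ ea , divides w₁ ew) e = norm-valuation p pr cp ψp f x a₁ w₁
        (ℤ.*-cancelˡ-≡ P (a₁ * a₁ + + K * (w₁ * w₁)) (P * (+ (p ^ (f ℕ.+ f)) * + x))
          (trans (cancel a₁ w₁ (+ (p ^ (suc f ℕ.+ suc f)) * + x) ea ew e)
                 (trans (cong (_* + x) (power f)) (assoc P (+ (p ^ (f ℕ.+ f))) (+ x)))))

    -- A norm has even exponent at every inert prime, so the bad case cannot occur.
    g-norm : ∀ y a w → 0 < y → Cop y → + y ≡ a * a + + K * (w * w) → 1ℤ ℤ.≤ g y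
    g-norm y a w 0<y c e = from (classify y 0<y c)
      where
      from : Class y → 1ℤ ℤ.≤ g y
      from (good le _ _ _ _ _) = le
      from (bad _ p pr ψp f x y≡ ¬d) = contradiction
        (∣⇒∣ᵤ (norm-valuation p pr (cop-∣ (D.divides (p ^ (f ℕ.+ f) ℕ.* x) (trans y≡′ (ℕ.*-comm p (p ^ (f ℕ.+ f) ℕ.* x)))) c) ψp f x a w
          (trans (sym e) (trans (cong +_ y≡′) (trans (ℤ.pos-* p (p ^ (f ℕ.+ f) ℕ.* x)) (cong (_*_ (+ p)) (ℤ.pos-* (p ^ (f ℕ.+ f)) x))))))) ¬d
        where
        y≡′ : y ≡ p ℕ.* (p ^ (f ℕ.+ f) ℕ.* x)
        y≡′ = trans y≡ (ℕ.*-assoc p (p ^ (f ℕ.+ f)) x)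

  -- Divisor sums in residue classes

  module ΣOrder where
    ∑-mono-length : ∀ {f : ℕ → ℤ} → (∀ i → 0ℤ ℤ.≤ f i) → ∀ {m n} → m ≤ n → Σ m f ℤ.≤ Σ n f
    ∑-mono-length {f} nn {m} m≤n with ℕ.m≤n⇒∃[o]m+o≡n m≤n
    ... | k , refl = ℤ.≤-trans (ℤ.≤-reflexive (sym (ℤ.+-identityʳ (Σ m f))))
      (ℤ.≤-trans (ℤ.+-monoʳ-≤ (Σ m f) (Σ.∑-nonneg k (λ i _ → nn (m ℕ.+ i)))) (ℤ.≤-reflexive (sym (Σ.∑-split m k f))))

    -- As `φ` is increasing, the Z terms of value at least 1 stand at distinct indices.
    ∑-≥-subsequence : ∀ {f : ℕ → ℤ} → (∀ i → 0ℤ ℤ.≤ f i) → ∀ (φ : ℕ → ℕ) → (∀ c → φ c < φ (suc c)) →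
                      ∀ Z L → (∀ c → c < Z → φ c < L × 1ℤ ℤ.≤ f (φ c)) → + Z ℤ.≤ Σ L f
    ∑-≥-subsequence {f} nn φ mono zero    L h = Σ.∑-nonneg L (λ i _ → nn i)
    ∑-≥-subsequence {f} nn φ mono (suc Z) L h =
      ℤ.≤-trans (go Z (λ c c≤Z → proj₂ (h c (s≤s c≤Z)))) (∑-mono-length nn (proj₁ (h Z ℕ.≤-refl)))
      where
      go : ∀ Z → (∀ c → c ≤ Z → 1ℤ ℤ.≤ f (φ c)) → + suc Z ℤ.≤ Σ (suc (φ Z)) f
      go zero    h = ℤ.+-mono-≤ (Σ.∑-nonneg (φ 0) (λ i _ → nn i)) (h 0 z≤n)
      go (suc Z) h = ℤ.≤-trans (ℤ.≤-reflexive (cong +_ (ℕ.+-comm 1 (suc Z))))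
        (ℤ.+-mono-≤ (ℤ.≤-trans (go Z (λ c c≤Z → h c (ℕ.m≤n⇒m≤1+n c≤Z))) (∑-mono-length nn (mono Z))) (h (suc Z) ℕ.≤-refl))

    ∑-positive-term : ∀ n {f : ℕ → ℤ} → 0ℤ ℤ.< Σ n f → ∃[ i ] (i < n × 0ℤ ℤ.< f i)
    ∑-positive-term zero    lt = contradiction lt (ℤ.<-irrefl refl)
    ∑-positive-term (suc n) {f} lt with 0ℤ ℤ.<? f n | 0ℤ ℤ.<? Σ n f
    ... | yes p | _     = n , ℕ.≤-refl , p
    ... | no ¬p | yes q = let i , i<n , r = ∑-positive-term n q in i , ℕ.m<n⇒m<1+n i<n , r
    ... | no ¬p | no ¬q = contradiction (ℤ.+-mono-≤ (ℤ.≮⇒≥ ¬q) (ℤ.≮⇒≥ ¬p)) (ℤ.<⇒≱ lt)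

    -- Both inequalities are assumed because multiplication by -1 exchanges them.
    signℤ-*-close : ∀ s {x y} → x ℤ.≤ y + 1ℤ → y ℤ.≤ x + 1ℤ → signℤ s * x ℤ.≤ signℤ s * y + 1ℤ
    signℤ-*-close Sign.+ {x} {y} p q = subst₂ ℤ._≤_ (sym (ℤ.*-identityˡ x)) (cong (_+ 1ℤ) (sym (ℤ.*-identityˡ y))) p
    signℤ-*-close Sign.- {x} {y} p q = subst₂ ℤ._≤_ (trans (alg x y) (sym (ℤ.-1*i≡-i x))) (trans (alg2 x y) (cong (_+ 1ℤ) (sym (ℤ.-1*i≡-i y))))
        (ℤ.+-monoˡ-≤ (- x - y) q)
      where alg : ∀ x y → y + (- x - y) ≡ - x
            alg = solve-∀
            alg2 : ∀ x y → x + 1ℤ + (- x - y) ≡ - y + 1ℤ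
            alg2 = solve-∀

  open ΣOrder

  -- S sums g(y) over y ≡ c (mod 4K), y < Y². Writing y = de, so that ψ d = ψ e, Dirichlet's hyperbola method shows
  -- that it changes by at most 3Y when c runs over the classes on which ψ = 1, while for c = 1 it is at least a large
  -- multiple of Y.
  module Counting (K : ℕ) (0<K : 0 < K) where
    open Genus K

    Cong : ℕ → ℕ → Set
    Cong c y = + M ∣ + y - + c

    cong? : ∀ c y → Dec (Cong c y)
    cong? c y = + M ∣? (+ y - + c)

    0<M : 0 < M
    0<M = ℕ.*-monoʳ-< 4 0<K

    record Admissible (c : ℕ) : Set where
      field
        coprime : Cop c
        ψ≡+     : ∀ y → Cong c y → ψ y ≡ Sign.+

    module _ {c : ℕ} (adm : Admissible c) where
      open Admissible adm

      cong⇒cop : ∀ y → Cong c y → Cop y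
      cong⇒cop y (divides q e) = from coprime
        where
        alg : ∀ u v m c y q → (u - v * q) * m + v * y ≡ u * m + v * c + v * (y - c - q * m)
        alg = solve-∀
        from : Cop c → Cop y
        from (cop u v b) = cop (u - v * q) v (trans (alg u v (+ M) (+ c) (+ y) q) (trans (cong₂ (λ s t → s + v * t) b (trans (cong
            (λ z → z - q * + M) e) (ℤ.+-inverseʳ (q * + M)))) (cong (_+_ 1ℤ) (ℤ.*-zeroʳ v))))

      cong⇒0< : ∀ y → Cong c y → 0 < y
      cong⇒0< zero    d = contradiction (cop-odd 0 (cong⇒cop 0 d)) (λ { (_ , ()) })
      cong⇒0< (suc y) d = s≤s z≤n

      -- The contribution of the factorisation y = de to the sum of g over the class, cut off at the
      -- hyperbola de = X.
      T : ℕ → ℕ → ℕ → ℤ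
      T X d e = Σ.[ d ℕ.* e ℕ.<? X ⇒ Σ.[ cong? c (d ℕ.* e) ⇒ ψℤ d ] ]

      S : ℕ → ℤ
      S X = Σ X (λ d → Σ X (T X d))

      F : ℕ → ℤ
      F y = Σ.[ cong? c y ⇒ g y ]

      F-nonneg : ∀ y → 0ℤ ℤ.≤ F y
      F-nonneg y with cong? c y
      ... | yes d = g-nonneg y (cong⇒0< y d) (cong⇒cop y d)
      ... | no _  = ℤ.≤-refl

      F-expand : ∀ X y → y < X → F y ≡ Σ X (λ d → Σ X (λ e → Σ.[ d ℕ.* e ℕ.≟ y ⇒ Σ.[ cong? c (d ℕ.* e) ⇒ ψℤ d ] ]))
      F-expand X y y<X with cong? c y
      ... | no ¬p = sym (Σ.∑-ε X (λ d _ → Σ.∑-ε X (λ e _ → none d e)))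
        where
        none : ∀ d e → Σ.[ d ℕ.* e ℕ.≟ y ⇒ Σ.[ cong? c (d ℕ.* e) ⇒ ψℤ d ] ] ≡ 0ℤ
        none d e with d ℕ.* e ℕ.≟ y
        ... | no _ = refl
        ... | yes eq = Σ.[no] (cong? c (d ℕ.* e)) (λ p → ¬p (subst (Cong c) eq p))
      ... | yes p = trans (sym (g-extend y (cong⇒0< y p) X y<X)) (Σ.∑-cong X (λ d _ → term d))
        where
        term : ∀ d → divisorTerm y d ≡ Σ X (λ e → Σ.[ d ℕ.* e ℕ.≟ y ⇒ Σ.[ cong? c (d ℕ.* e) ⇒ ψℤ d ] ])
        term d with d D.∣? y
        ... | no ¬d∣y = sym (Σ.∑-ε X (λ e _ → Σ.[no] (d ℕ.* e ℕ.≟ y) (λ eq → ¬d∣y (D.divides e (trans (sym eq) (ℕ.*-comm d e))))))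
        term zero | yes d∣y = contradiction (cong⇒0< y p) (λ 0<y → ℕ.<-irrefl (sym (D.0∣⇒≡0 d∣y)) 0<y)
        term d@(suc d′) | yes (D.divides q eq) = sym (trans
            (Σ.∑-single X q (ℕ.≤-<-trans q≤y y<X) (λ e _ e≢q → Σ.[no] (d ℕ.* e ℕ.≟ y)
              (λ de≡y → e≢q (ℕ.*-cancelˡ-≡ e q d (trans de≡y (trans eq (ℕ.*-comm q d)))))))
            (trans (Σ.[yes] (d ℕ.* q ℕ.≟ y) dq≡y) (Σ.[yes] (cong? c (d ℕ.* q)) (subst (Cong c) (sym dq≡y) p))))
          where
          dq≡y : d ℕ.* q ≡ y
          dq≡y = trans (ℕ.*-comm d q) (sym eq)
          q≤y : q ≤ y
          q≤y = ℕ.≤-trans (ℕ.m≤m*n q d) (ℕ.≤-reflexive (sym eq))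

      S≡∑F : ∀ X → S X ≡ Σ X F
      S≡∑F X = sym (begin
        Σ X F
          ≡⟨ Σ.∑-cong X (λ y y<X → F-expand X y y<X) ⟩
        Σ X (λ y → Σ X (λ d → Σ X (λ e → E y d e)))
          ≡⟨ Σ.∑-comm X X (λ y d → Σ X (λ e → E y d e)) ⟩
        Σ X (λ d → Σ X (λ y → Σ X (λ e → E y d e)))
          ≡⟨ Σ.∑-cong X (λ d _ → Σ.∑-comm X X (λ y e → E y d e)) ⟩
        Σ X (λ d → Σ X (λ e → Σ X (λ y → E y d e)))
          ≡⟨ Σ.∑-cong X (λ d _ → Σ.∑-cong X (λ e _ → collapse d e)) ⟩
        S X ∎)
        where
        open ≡-Reasoning
        E : ℕ → ℕ → ℕ → ℤ
        E y d e = Σ.[ d ℕ.* e ℕ.≟ y ⇒ Σ.[ cong? c (d ℕ.* e) ⇒ ψℤ d ] ]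
        collapse : ∀ d e → Σ X (λ y → E y d e) ≡ T X d e
        collapse d e with d ℕ.* e ℕ.<? X
        ... | yes lt = trans (Σ.∑-single X (d ℕ.* e) lt (λ y _ y≢ → Σ.[no] (d ℕ.* e ℕ.≟ y) (λ eq → y≢ (sym eq)))) (Σ.[yes] (d ℕ.* e ℕ.≟ d ℕ.* e) refl)
        ... | no ¬lt = Σ.∑-ε X (λ y y<X → Σ.[no] (d ℕ.* e ℕ.≟ y) (λ eq → ¬lt (subst (_< X) (sym eq) y<X)))

      -- On the class, ψ(d) ψ(e) = ψ(de) = 1, so both factors have the same sign.
      T-sym : ∀ X d e → T X d e ≡ T X e d
      T-sym X d e = Σ.[cong] (d ℕ.* e ℕ.<? X) (e ℕ.* d ℕ.<? X) (subst (_< X) (ℕ.*-comm d e)) (subst (_< X) (ℕ.*-comm e d))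
        (λ _ → Σ.[cong] (cong? c (d ℕ.* e)) (cong? c (e ℕ.* d)) (subst (Cong c) (ℕ.*-comm d e)) (subst (Cong c) (ℕ.*-comm e d)) same)
        where
        same : Cong c (d ℕ.* e) → ψℤ d ≡ ψℤ e
        same p = cong signℤ (equal (ψ d) (ψ e) (trans (sym (ψ-* d e (cop-factor d e cde) (cop-factor e d (subst Cop (ℕ.*-comm d e) cde))))
            (ψ≡+ (d ℕ.* e) p)))
          where
          cde = cong⇒cop (d ℕ.* e) p
          equal : ∀ s t → s · t ≡ Sign.+ → s ≡ t
          equal Sign.+ Sign.+ _ = refl
          equal Sign.- Sign.- _ = refl

      A D₀ : ℕ → ℤ
      A Y = Σ Y (λ d → Σ (Y ℕ.* Y) (T (Y ℕ.* Y) d))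
      D₀ Y = Σ Y (λ d → Σ Y (T (Y ℕ.* Y) d))

      -- No pair with de < Y² has both entries at least Y. The region is therefore covered by the
      -- strips d < Y and e < Y, whose sums agree by `T-sym`, and their overlap, the square `D₀`, is
      -- counted twice.
      hyperbola : ∀ Y → 0 < Y → S (Y ℕ.* Y) ≡ A Y + (A Y - D₀ Y)
      hyperbola Y 0<Y with ℕ.m≤n⇒∃[o]m+o≡n (ℕ.m≤m*n Y Y ⦃ ℕ.>-nonZero 0<Y ⦄)
      ... | W , Y+W≡X = begin
        S X
          ≡⟨ split (λ d → Σ X (T X d)) ⟩
        A Y + Σ W (λ i → Σ X (T X (Y ℕ.+ i)))
          ≡⟨ cong (_+_ (A Y)) (Σ.∑-cong W (λ i _ → trans (split (T X (Y ℕ.+ i))) (trans (cong (_+_ (Σ Y (T X (Y ℕ.+ i)))) (Σ.∑-ε W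
              (λ j _ → corner i j))) (ℤ.+-identityʳ (Σ Y (T X (Y ℕ.+ i))))))) ⟩
        A Y + Σ W (λ i → Σ Y (T X (Y ℕ.+ i)))
          ≡⟨ cong (_+_ (A Y)) (trans (Σ.∑-comm W Y (λ i e → T X (Y ℕ.+ i) e)) (Σ.∑-cong Y (λ e _ → Σ.∑-cong W (λ i _ → T-sym X (Y ℕ.+ i) e)))) ⟩
        A Y + R
          ≡⟨ cong (_+_ (A Y)) (trans (alg (D₀ Y) R) (cong (λ z → z - D₀ Y) (sym A≡))) ⟩
        A Y + (A Y - D₀ Y) ∎
        where
        open ≡-Reasoning
        X = Y ℕ.* Y
        R = Σ Y (λ d → Σ W (λ i → T X d (Y ℕ.+ i)))
        alg : ∀ d r → r ≡ d + r - d
        alg = solve-∀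
        split : ∀ (f : ℕ → ℤ) → Σ X f ≡ Σ Y f + Σ W (λ i → f (Y ℕ.+ i))
        split f = trans (cong (λ k → Σ k f) (sym Y+W≡X)) (Σ.∑-split Y W f)
        A≡ : A Y ≡ D₀ Y + R
        A≡ = trans (Σ.∑-cong Y (λ d _ → split (T X d))) (Σ.∑-∙ Y (λ d → Σ Y (T X d)) (λ d → Σ W (λ i → T X d (Y ℕ.+ i))))
        corner : ∀ i j → T X (Y ℕ.+ i) (Y ℕ.+ j) ≡ 0ℤ
        corner i j = Σ.[no] ((Y ℕ.+ i) ℕ.* (Y ℕ.+ j) ℕ.<? X) (λ lt → ℕ.<⇒≱ lt (ℕ.*-mono-≤ (ℕ.m≤m+n Y i) (ℕ.m≤m+n Y j)))

      count : ℕ → ℕ → ℤ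
      count d L = Σ L (λ e → Σ.[ cong? c (d ℕ.* e) ⇒ 1ℤ ])

      count-non-coprime : ∀ d L → ¬ Cop d → count d L ≡ 0ℤ
      count-non-coprime d L ¬c = Σ.∑-ε L (λ e _ → Σ.[no] (cong? c (d ℕ.* e)) (λ p → ¬c (cop-factor d e (cong⇒cop (d ℕ.* e) p))))

      -- Among M consecutive e exactly one solves de ≡ c, namely e ≡ vc, where the Bézout
      -- coefficient v is the inverse of d modulo M.
      count-period : ∀ d → Cop d → ∀ i → Σ M (λ l → Σ.[ cong? c (d ℕ.* (i ℕ.* M ℕ.+ l)) ⇒ 1ℤ ]) ≡ 1ℤ
      count-period d (cop u v b) i = trans
        (Σ.∑-single M l₀ l₀<M (λ l l<M l≢ → Σ.[no] (cong? c (d ℕ.* (i ℕ.* M ℕ.+ l))) (λ p → l≢ (unique l l<M p))))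
        (Σ.[yes] (cong? c (d ℕ.* (i ℕ.* M ℕ.+ l₀))) l₀-solves)
        where
        instance
          _ = ℕ.>-nonZero 0<M
        l₀ = (v * + c) %ℕ M
        l₀<M : l₀ < M
        l₀<M = n%ℕd<d (v * + c) M
        q = (v * + c) /ℕ M
        vc≡ : v * + c ≡ + l₀ + q * + M
        vc≡ = a≡a%ℕn+[a/ℕn]*n (v * + c) M
        pos : ∀ l → + (d ℕ.* (i ℕ.* M ℕ.+ l)) ≡ + d * (+ i * + M + + l)
        pos l = trans (ℤ.pos-* d (i ℕ.* M ℕ.+ l)) (cong (_*_ (+ d)) (cong (_+ + l) (ℤ.pos-* i M)))
        l₀-solves : Cong c (d ℕ.* (i ℕ.* M ℕ.+ l₀))
        l₀-solves = divides (+ d * + i - + d * q - u * + c) (trans (cong (λ z → z - + c) (pos l₀))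
          (trans (alg (+ d) (+ i) (+ M) (+ l₀) (+ c) q u)
            (trans (cong (λ z → (+ d * + i - + d * q - u * + c) * + M + (+ d * z - + c + u * + M * + c)) (sym vc≡))
              (trans (cong (_+_ ((+ d * + i - + d * q - u * + c) * + M)) (trans (alg2 (+ d) v (+ c) u (+ M)) (trans (cong
                  (λ z → z * + c - + c) b) (alg3 (+ c))))) (ℤ.+-identityʳ _)))))
          where
          alg : ∀ d i m l c q u → d * (i * m + l) - c ≡ (d * i - d * q - u * c) * m + (d * (l + q * m) - c + u * m * c)
          alg = solve-∀
          alg2 : ∀ d v c u m → d * (v * c) - c + u * m * c ≡ (u * m + v * d) * c - c
          alg2 = solve-∀
          alg3 : ∀ c → 1ℤ * c - c ≡ 0ℤ
          alg3 = solve-∀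
        unique : ∀ l → l < M → Cong c (d ℕ.* (i ℕ.* M ℕ.+ l)) → l ≡ l₀
        unique l l<M (divides t e) = ℤ.+-injective (ℤ.i-j≡0⇒i≡j (+ l) (+ l₀) (small-multiple M (+ l - + l₀) div lt))
          where
          lt : abs (+ l - + l₀) < M
          lt rewrite ℤ.m-n≡m⊖n l l₀ = ℕ.≤-<-trans (ℤ.∣m⊝n∣≤m⊔n l l₀) (ℕ.⊔-lub l<M l₀<M)
          alg : ∀ l d v u m i c q t → l - (v * c - q * m) ≡ (q - v * d * i + v * t + u * l) * m + v * (d * (i * m + l) - c - t * m) + l *
              (1ℤ - (u * m + v * d))
          alg = solve-∀
          alg2 : ∀ x y → x - (x + y - y) ≡ 0ℤ
          alg2 = solve-∀
          alg4 : ∀ l y → l + y - y ≡ l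
          alg4 = solve-∀
          div : + M ∣ + l - + l₀
          div = divides (q - v * + d * + i + v * t + u * + l)
            (trans (cong (λ z → + l - z) (trans (sym (alg4 (+ l₀) (q * + M))) (cong (λ z → z - q * + M) (sym vc≡))))
              (trans (alg (+ l) (+ d) v u (+ M) (+ i) (+ c) q t)
                (trans (cong₂ (λ x y → (q - v * + d * + i + v * t + u * + l) * + M + v * (x - t * + M) + + l * (1ℤ - y))
                         (trans (cong (λ z → z - + c) (sym (pos l))) e) b)
                  (zero-out ((q - v * + d * + i + v * t + u * + l) * + M) v (t * + M) (+ l)))))
            where
            zero-out : ∀ a v x l → a + v * (x - x) + l * (1ℤ - 1ℤ) ≡ a
            zero-out = solve-∀

      count-prefix : ∀ d → Cop d → ∀ q ρ → count d (q ℕ.* M ℕ.+ ρ) ≡ + q + Σ ρ (λ l → Σ.[ cong? c (d ℕ.* (q ℕ.* M ℕ.+ l)) ⇒ 1ℤ ])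
      count-prefix d cd q ρ = trans (Σ.∑-split (q ℕ.* M) ρ _) (cong (_+ Σ ρ (λ l → Σ.[ cong? c (d ℕ.* (q ℕ.* M ℕ.+ l)) ⇒ 1ℤ ]))
        (trans (Σ.∑-blocks q M _) (trans (Σ.∑-cong q (λ i _ → count-period d cd i)) (ones q))))
        where
        ones : ∀ q → Σ q (λ _ → 1ℤ) ≡ + q
        ones zero    = refl
        ones (suc q) = trans (cong (_+ 1ℤ) (ones q)) (cong +_ (ℕ.+-comm q 1))

      count-bounds : ∀ d → Cop d → ∀ q ρ → ρ < M → + q ℤ.≤ count d (q ℕ.* M ℕ.+ ρ) × count d (q ℕ.* M ℕ.+ ρ) ℤ.≤ + q + 1ℤ
      count-bounds d cd q ρ ρ<M =
        subst (+ q ℤ.≤_) (sym (count-prefix d cd q ρ)) (ℤ.≤-trans (ℤ.≤-reflexive (sym (ℤ.+-identityʳ (+ q)))) (ℤ.+-monoʳ-≤ (+ q)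
            (Σ.∑-nonneg ρ (λ l _ → term l)))) ,
        subst (ℤ._≤ + q + 1ℤ) (sym (count-prefix d cd q ρ)) (ℤ.+-monoʳ-≤ (+ q)
          (ℤ.≤-trans (∑-mono-length term (ℕ.<⇒≤ ρ<M)) (ℤ.≤-reflexive (count-period d cd q))))
        where
        term : ∀ l → 0ℤ ℤ.≤ Σ.[ cong? c (d ℕ.* (q ℕ.* M ℕ.+ l)) ⇒ 1ℤ ]
        term l with cong? c (d ℕ.* (q ℕ.* M ℕ.+ l))
        ... | yes _ = ℤ.+≤+ z≤n
        ... | no _  = ℤ.≤-refl

    cop⇒coprime : ∀ d → Cop d → Coprime M d
    cop⇒coprime d (cop u v b) {i} (i∣M , i∣d) = D.∣1⇒≡1 (∣⇒∣ᵤ (∣-resp b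
      (∣m∣n⇒∣m+n {+ i} (∣n⇒∣m*n u (∣ᵤ⇒∣ i∣M)) (∣n⇒∣m*n v (∣ᵤ⇒∣ i∣d)))))

    coprime⇒cop : ∀ d → Coprime M d → Cop d
    coprime⇒cop d c = let u , v , e = bézoutℤ M d c in cop u v e

    -- For fixed d the condition de < X holds on an initial segment of e. The end is found by search
    -- instead of division, which covers d = 0 as well.
    cutoff : ∀ X d E → ∃[ L ] (L ≤ E × ∀ e → e < E → (d ℕ.* e < X ⇔ e < L))
    cutoff X d zero    = 0 , z≤n , λ _ ()
    cutoff X d (suc E) with d ℕ.* E ℕ.<? X
    ... | yes lt = suc E , ℕ.≤-refl , λ e e≤E → mk⇔ (λ _ → e≤E) (λ _ → ℕ.≤-<-trans (ℕ.*-monoʳ-≤ d (ℕ.≤-pred e≤E)) lt)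
    ... | no ¬lt with cutoff X d E
    ...   | L , L≤E , eqv = L , ℕ.m≤n⇒m≤1+n L≤E , λ e e<1+E → extend e e<1+E (e ℕ.≟ E)
      where
      extend : ∀ e → e < suc E → Dec (e ≡ E) → (d ℕ.* e < X ⇔ e < L)
      extend e _ (yes refl) = mk⇔ (λ lt → contradiction lt ¬lt) (λ e<L → contradiction e<L (ℕ.≤⇒≯ L≤E))
      extend e e<1+E (no e≢E) = eqv e (ℕ.≤∧≢⇒< (ℕ.≤-pred e<1+E) e≢E)

    module Row {c : ℕ} (adm : Admissible c) (X d E L : ℕ) (L≤E : L ≤ E) (eqv : ∀ e → e < E → (d ℕ.* e < X ⇔ e < L)) where
      row : Σ E (T adm X d) ≡ ψℤ d * count adm d L
      row with ℕ.m≤n⇒∃[o]m+o≡n L≤E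
      ... | k , refl = trans (Σ.∑-split L k (T adm X d)) (trans (cong₂ _+_ low high) (ℤ.+-identityʳ (ψℤ d * count adm d L)))
        where
        high : Σ k (λ i → T adm X d (L ℕ.+ i)) ≡ 0ℤ
        high = Σ.∑-ε k (λ i i<k → Σ.[no] (d ℕ.* (L ℕ.+ i) ℕ.<? X)
          (λ lt → ℕ.<⇒≱ (Equivalence.to (eqv (L ℕ.+ i) (ℕ.+-monoʳ-< L i<k)) lt) (ℕ.m≤m+n L i)))
        term : ∀ e → e < L → T adm X d e ≡ ψℤ d * Σ.[ cong? c (d ℕ.* e) ⇒ 1ℤ ]
        term e e<L = trans (Σ.[yes] (d ℕ.* e ℕ.<? X) (Equivalence.from (eqv e (ℕ.<-≤-trans e<L (ℕ.m≤m+n L k))) e<L)) (pull (cong? c (d ℕ.* e)))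
          where
          pull : ∀ {P : Set} (p : Dec P) → Σ.[ p ⇒ ψℤ d ] ≡ ψℤ d * Σ.[ p ⇒ 1ℤ ]
          pull (yes _) = sym (ℤ.*-identityʳ (ψℤ d))
          pull (no _)  = sym (ℤ.*-zeroʳ (ψℤ d))
        low : Σ L (T adm X d) ≡ ψℤ d * count adm d L
        low = trans (Σ.∑-cong L term) (Σ.∑-*ˡ (ψℤ d) L _)

    module Compare {c c′ : ℕ} (adm : Admissible c) (adm′ : Admissible c′) where

      -- If d is prime to M, each count is ⌊L/M⌋ or one more, whatever the class; otherwise both
      -- counts are 0.
      count-close : ∀ d L → count adm d L ℤ.≤ count adm′ d L + 1ℤ
      count-close d L with coprime? M d
      ... | no ¬c = subst₂ (λ x y → x ℤ.≤ y + 1ℤ)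
            (sym (count-non-coprime adm d L (λ cd → ¬c (cop⇒coprime d cd))))
            (sym (count-non-coprime adm′ d L (λ cd → ¬c (cop⇒coprime d cd)))) (ℤ.+≤+ z≤n)
      ... | yes cd = subst (λ L → count adm d L ℤ.≤ count adm′ d L + 1ℤ) (sym L≡)
            (ℤ.≤-trans (proj₂ (count-bounds adm d cop-d q ρ ρ<M)) (ℤ.+-monoˡ-≤ 1ℤ (proj₁ (count-bounds adm′ d cop-d q ρ ρ<M))))
        where
        instance
          _ = ℕ.>-nonZero 0<M
        cop-d = coprime⇒cop d cd
        q = L ℕ./ M
        ρ = L ℕ.% M
        ρ<M : ρ < M
        ρ<M = ℕ.m%n<n L M
        L≡ : L ≡ q ℕ.* M ℕ.+ ρ
        L≡ = trans (ℕ.m≡m%n+[m/n]*n L M) (ℕ.+-comm ρ (q ℕ.* M))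

    module Compare₂ {c c′ : ℕ} (adm : Admissible c) (adm′ : Admissible c′) where
      open Compare adm adm′

      row-close : ∀ X d E → Σ E (T adm X d) ℤ.≤ Σ E (T adm′ X d) + 1ℤ
      row-close X d E = let L , L≤E , eqv = cutoff X d E in
        subst₂ (λ x y → x ℤ.≤ y + 1ℤ) (sym (Row.row adm X d E L L≤E eqv)) (sym (Row.row adm′ X d E L L≤E eqv))
          (signℤ-*-close (ψ d) (count-close d L) (Compare.count-close adm′ adm d L))

      rows-close : ∀ X E Y → Σ Y (λ d → Σ E (T adm X d)) ℤ.≤ Σ Y (λ d → Σ E (T adm′ X d)) + + Y
      rows-close X E zero    = ℤ.≤-refl
      rows-close X E (suc Y) = ℤ.≤-trans (ℤ.+-mono-≤ (rows-close X E Y) (row-close X Y E))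
        (ℤ.≤-reflexive (trans (alg (Σ Y (λ d → Σ E (T adm′ X d))) (+ Y) (Σ E (T adm′ X Y))) (cong (_+_ (Σ (suc Y) (λ d → Σ E
            (T adm′ X d)))) (cong +_ (ℕ.+-comm Y 1)))))
        where alg : ∀ s y t → s + y + (t + 1ℤ) ≡ s + t + (y + 1ℤ)
              alg = solve-∀

    -- By `hyperbola` the sum is 2A - D₀. Each of `A` and `D₀` consists of Y rows, and a row is ψ(d)
    -- times a count, which changes by at most 1; hence 3Y.
    S-close : ∀ {c c′} (adm : Admissible c) (adm′ : Admissible c′) → ∀ Y → 0 < Y →
              S adm (Y ℕ.* Y) ℤ.≤ S adm′ (Y ℕ.* Y) + + 3 * + Y
    S-close adm adm′ Y 0<Y = begin
      S adm X
        ≡⟨ hyperbola adm Y 0<Y ⟩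
      A adm Y + (A adm Y - D₀ adm Y)
        ≤⟨ ℤ.+-mono-≤ a (ℤ.+-mono-≤ a (ℤ.neg-mono-≤ d)) ⟩
      A adm′ Y + + Y + (A adm′ Y + + Y + - (D₀ adm′ Y - + Y))
        ≡⟨ alg (A adm′ Y) (D₀ adm′ Y) (+ Y) ⟩
      A adm′ Y + (A adm′ Y - D₀ adm′ Y) + + 3 * + Y
        ≡⟨ cong (_+ + 3 * + Y) (hyperbola adm′ Y 0<Y) ⟨
      S adm′ X + + 3 * + Y ∎
      where
      open ℤ.≤-Reasoning
      X = Y ℕ.* Y
      a : A adm Y ℤ.≤ A adm′ Y + + Y
      a = Compare₂.rows-close adm adm′ X X Y
      d : D₀ adm′ Y - + Y ℤ.≤ D₀ adm Y
      d = ℤ.≤-trans (ℤ.+-monoˡ-≤ (- (+ Y)) (Compare₂.rows-close adm′ adm X Y Y)) (ℤ.≤-reflexive (alg2 (D₀ adm Y) (+ Y)))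
        where alg2 : ∀ x y → x + y - y ≡ x
              alg2 = solve-∀
      alg : ∀ a d y → a + y + (a + y + - (d - y)) ≡ a + (a - d) + + 3 * y
      alg = solve-∀

    -- The lower bound comes from the values x² + K(Mc)² with x ≡ 1 (mod M) and c < Z; they lie between x² and (x + M)²
    -- once x exceeds KM²Z², hence are distinct.
    module LowerBound (adm : Admissible 1) (Z : ℕ) where
      X₀ : ℕ
      X₀ = 1 ℕ.+ M ℕ.* (K ℕ.* M ℕ.* (Z ℕ.* Z))

      x : ℕ → ℕ
      x u = X₀ ℕ.+ u ℕ.* M

      φ : ℕ → ℕ
      φ c = K ℕ.* (M ℕ.* c ℕ.* (M ℕ.* c))

      φ-mono : ∀ c → φ c < φ (suc c)
      φ-mono c = ℕ.*-monoʳ-< K ⦃ ℕ.>-nonZero 0<K ⦄ (ℕ.*-mono-< Mc< Mc<)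
        where Mc< = ℕ.*-monoʳ-< M ⦃ ℕ.>-nonZero 0<M ⦄ (ℕ.n<1+n c)

      φ<X₀ : ∀ c → c < Z → φ c < X₀
      φ<X₀ c c<Z = s≤s (ℕ.≤-trans (ℕ.*-monoʳ-≤ K (ℕ.*-mono-≤ le le)) (ℕ.≤-reflexive (alg K M Z)))
        where le = ℕ.*-monoʳ-≤ M (ℕ.<⇒≤ c<Z)
              alg : ∀ k m z → k ℕ.* (m ℕ.* z ℕ.* (m ℕ.* z)) ≡ m ℕ.* (k ℕ.* m ℕ.* (z ℕ.* z))
              alg = ℕ-solver.solve-∀

      F-norm : ∀ u c → 1ℤ ℤ.≤ F adm (x u ℕ.* x u ℕ.+ φ c)
      F-norm u c = ℤ.≤-trans (g-norm y (+ x u) (+ (M ℕ.* c)) (cong⇒0< adm y cong-y) (cong⇒cop adm y cong-y) y≡)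
          (ℤ.≤-reflexive (sym (Σ.[yes] (cong? 1 y) cong-y)))
        where
        y = x u ℕ.* x u ℕ.+ φ c
        B = K ℕ.* M ℕ.* (Z ℕ.* Z) ℕ.+ u
        xu≡ : x u ≡ 1 ℕ.+ B ℕ.* M
        xu≡ = alg M (K ℕ.* M ℕ.* (Z ℕ.* Z)) u
          where alg : ∀ m b u → 1 ℕ.+ m ℕ.* b ℕ.+ u ℕ.* m ≡ 1 ℕ.+ (b ℕ.+ u) ℕ.* m
                alg = ℕ-solver.solve-∀
        q = B ℕ.+ B ℕ.+ B ℕ.* B ℕ.* M ℕ.+ K ℕ.* M ℕ.* (c ℕ.* c)
        y≡1+ : y ≡ q ℕ.* M ℕ.+ 1
        y≡1+ = trans (cong (λ x → x ℕ.* x ℕ.+ φ c) xu≡) (alg B M K c)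
          where alg : ∀ b m k c → (1 ℕ.+ b ℕ.* m) ℕ.* (1 ℕ.+ b ℕ.* m) ℕ.+ k ℕ.* (m ℕ.* c ℕ.* (m ℕ.* c)) ≡
                  (b ℕ.+ b ℕ.+ b ℕ.* b ℕ.* m ℕ.+ k ℕ.* m ℕ.* (c ℕ.* c)) ℕ.* m ℕ.+ 1
                alg = ℕ-solver.solve-∀
        cong-y : Cong 1 y
        cong-y = divides (+ q) (trans (cong (λ z → + z - 1ℤ) y≡1+) (trans (cong (λ z → z + 1ℤ - 1ℤ) (ℤ.pos-* q M)) (alg (+ q * + M))))
          where alg : ∀ z → z + 1ℤ - 1ℤ ≡ z
                alg = solve-∀
        y≡ : + y ≡ + x u * + x u + + K * (+ (M ℕ.* c) * + (M ℕ.* c))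
        y≡ = cong₂ _+_ (ℤ.pos-* (x u) (x u)) (trans (ℤ.pos-* K (M ℕ.* c ℕ.* (M ℕ.* c))) (cong (_*_ (+ K)) (ℤ.pos-* (M ℕ.* c) (M ℕ.* c))))

      -- Each of the U intervals from (x u)² to (x (u + 1))² contains Z arguments at which F is at
      -- least 1.
      bound : ∀ U → + (U ℕ.* Z) ℤ.≤ Σ (x U ℕ.* x U) (F adm)
      bound zero    = Σ.∑-nonneg (x 0 ℕ.* x 0) (λ i _ → F-nonneg adm i)
      bound (suc U) = begin
        + (Z ℕ.+ U ℕ.* Z)
          ≡⟨ ℤ.+-comm (+ Z) (+ (U ℕ.* Z)) ⟩
        + (U ℕ.* Z) + + Z
          ≤⟨ ℤ.+-mono-≤ (bound U) (∑-≥-subsequence (λ i → F-nonneg adm (X ℕ.+ i)) φ φ-mono Z gap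
               (λ c c<Z → ℕ.<-≤-trans (φ<X₀ c c<Z) X₀≤gap , F-norm U c)) ⟩
        Σ X (F adm) + Σ gap (λ i → F adm (X ℕ.+ i))
          ≡⟨ Σ.∑-split X gap (F adm) ⟨
        Σ (X ℕ.+ gap) (F adm)
          ≡⟨ cong (λ k → Σ k (F adm)) (alg X₀ U M) ⟨
        Σ (x (suc U) ℕ.* x (suc U)) (F adm) ∎
        where
        open ℤ.≤-Reasoning
        X = x U ℕ.* x U
        gap = x U ℕ.* M ℕ.+ x U ℕ.* M ℕ.+ M ℕ.* M
        X₀≤gap : X₀ ≤ gap
        X₀≤gap = ℕ.≤-trans (ℕ.m≤m+n X₀ (U ℕ.* M)) (ℕ.≤-trans (ℕ.m≤m*n (x U) M ⦃ ℕ.>-nonZero 0<M ⦄)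
          (ℕ.≤-trans (ℕ.m≤m+n (x U ℕ.* M) (x U ℕ.* M)) (ℕ.m≤m+n _ (M ℕ.* M))))
        alg : ∀ a u m → (a ℕ.+ suc u ℕ.* m) ℕ.* (a ℕ.+ suc u ℕ.* m) ≡ (a ℕ.+ u ℕ.* m) ℕ.* (a ℕ.+ u ℕ.* m) ℕ.+ ((a ℕ.+ u ℕ.* m) ℕ.* m ℕ.+
            (a ℕ.+ u ℕ.* m) ℕ.* m ℕ.+ m ℕ.* m)
        alg = ℕ-solver.solve-∀

    genus : ∀ {r} → Admissible 1 → Admissible r →
            ∃[ s ] ∃[ z ] ∃[ t ] (Cong r (s ℕ.* s ℕ.* z) × + z ∣ t * t + + K)
    genus {r} adm₁ adm = result (∑-positive-term (Y ℕ.* Y) positive)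
      where
      -- With Y = X₀ + UM these choices give UZ = 1 + 3Y, one more than the error allowed by
      -- `S-close`.
      Z = 1 ℕ.+ 3 ℕ.* M
      open LowerBound adm₁ Z
      U = 1 ℕ.+ 3 ℕ.* X₀
      Y = x U
      positive : 0ℤ ℤ.< Σ (Y ℕ.* Y) (F adm)
      positive = ℤ.<-≤-trans (ℤ.+<+ (s≤s z≤n)) (ℤ.≤-trans (ℤ.≤-reflexive one) (ℤ.≤-trans
          (ℤ.+-monoˡ-≤ (- (+ 3 * + Y)) (ℤ.≤-trans (bound U) (subst₂ (λ a b → a ℤ.≤ b + + 3 * + Y) (S≡∑F adm₁ (Y ℕ.* Y)) (S≡∑F adm
              (Y ℕ.* Y)) (S-close adm₁ adm Y (s≤s z≤n)))))
          (ℤ.≤-reflexive (cancel (Σ (Y ℕ.* Y) (F adm)) (+ 3 * + Y)))))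
        where
        cancel : ∀ a b → a + b - b ≡ a
        cancel = solve-∀
        alg : ∀ x m → (1 ℕ.+ 3 ℕ.* x) ℕ.* (1 ℕ.+ 3 ℕ.* m) ≡ 1 ℕ.+ 3 ℕ.* (x ℕ.+ (1 ℕ.+ 3 ℕ.* x) ℕ.* m)
        alg = ℕ-solver.solve-∀
        one : 1ℤ ≡ + (U ℕ.* Z) - + 3 * + Y
        one = sym (trans (cong₂ (λ a b → a - b) (cong +_ (alg X₀ M)) (sym (ℤ.pos-* 3 Y))) (cancel 1ℤ (+ (3 ℕ.* Y))))
      result : ∃[ y ] (y < Y ℕ.* Y × 0ℤ ℤ.< F adm y) → ∃[ s ] ∃[ z ] ∃[ t ] (Cong r (s ℕ.* s ℕ.* z) × + z ∣ t * t + + K)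
      result (y , _ , lt) with cong? r y
      ... | no _ = contradiction lt (ℤ.<-irrefl refl)
      ... | yes p with classify y (cong⇒0< adm y p) (cong⇒cop adm y p)
      ...   | good _ s z t e d = s , z , t , subst (Cong r) e p , d
      ...   | bad e _ _ _ _ _ _ _ = contradiction lt (ℤ.<-irrefl (sym e))

  -- Reduction of ternary quadratic forms of discriminant 3

  +-nonneg : ∀ {x y} → 0ℤ ℤ.≤ x → 0ℤ ℤ.≤ y → 0ℤ ℤ.≤ x + y
  +-nonneg = ℤ.+-mono-≤

  *-nonneg : ∀ {x y} → 0ℤ ℤ.≤ x → 0ℤ ℤ.≤ y → 0ℤ ℤ.≤ x * y
  *-nonneg {+ m} {+ n} _ _ = subst (0ℤ ℤ.≤_) (ℤ.pos-* m n) (ℤ.+≤+ z≤n)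

  square-nonneg : ∀ x → 0ℤ ℤ.≤ x * x
  square-nonneg (+ n)    = *-nonneg {+ n} {+ n} (ℤ.+≤+ z≤n) (ℤ.+≤+ z≤n)
  square-nonneg ℤ.-[1+ n ] = ℤ.+≤+ z≤n

  scale-nonneg : ∀ k {x} → 0ℤ ℤ.≤ x → 0ℤ ℤ.≤ + k * x
  scale-nonneg k = *-nonneg {+ k} (ℤ.+≤+ z≤n)

  diff-nonneg : ∀ {x y} → x ℤ.≤ y → 0ℤ ℤ.≤ y - x
  diff-nonneg = ℤ.i≤j⇒0≤j-i

  ≤-from-diff : ∀ {x y} d → y - x ≡ d → 0ℤ ℤ.≤ d → x ℤ.≤ y
  ≤-from-diff d e 0≤d = ℤ.0≤i-j⇒j≤i (subst (0ℤ ℤ.≤_) (sym e) 0≤d)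

  <⇒1+≤ : ∀ {x y} → x ℤ.< y → x + 1ℤ ℤ.≤ y
  <⇒1+≤ {x} x<y = ℤ.≤-trans (ℤ.≤-reflexive (ℤ.+-comm x 1ℤ)) (ℤ.i<j⇒suc[i]≤j x<y)

  1+≤⇒< : ∀ {x y} → x + 1ℤ ℤ.≤ y → x ℤ.< y
  1+≤⇒< {x} le = ℤ.suc[i]≤j⇒i<j (ℤ.≤-trans (ℤ.≤-reflexive (ℤ.+-comm 1ℤ x)) le)

  -- The closing step of every refutation of polynomial inequalities below: a sum of nonnegative
  -- products, increased by a positive constant, is identically 0, which the ring solver confirms.
  negative-absurd : ∀ {x} k → 0ℤ ℤ.≤ x → x + + suc k ≡ 0ℤ → ⊥
  negative-absurd {+ n} k _ e = contradiction (ℤ.+-injective e) (λ e′ → ℕ.1+n≢0 (trans (sym (ℕ.+-suc n k)) e′))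

  round : ∀ n → 0ℤ ℤ.< n → ∀ x → ∃[ u ] (- n ℤ.≤ + 2 * (x + u * n) × + 2 * (x + u * n) ℤ.≤ n)
  round (+ zero) (ℤ.+<+ ()) x
  round (+ n@(suc m)) _ x = - q ,
      ≤-from-diff (+ 2 * + ρ + (+ n - + 2 * + h)) (trans (cong (λ z → + 2 * (z + - q * + n) - - + n) x≡) (alg1 (+ ρ) q (+ n) (+ h)))
        (+-nonneg {+ 2 * + ρ} (scale-nonneg 2 {+ ρ} (ℤ.+≤+ z≤n)) (diff-nonneg 2h≤n)) ,
      ≤-from-diff (+ 2 * (+ n - (+ ρ + 1ℤ)) + (+ 2 * + h + 1ℤ - + n) + 1ℤ) (trans (cong (λ z → + n - + 2 * (z + - q * + n)) x≡) (alg2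
          (+ ρ) q (+ n) (+ h)))
        (+-nonneg {+ 2 * (+ n - (+ ρ + 1ℤ)) + (+ 2 * + h + 1ℤ - + n)} (+-nonneg {+ 2 * (+ n - (+ ρ + 1ℤ))} (scale-nonneg 2
            (diff-nonneg ρ<n)) (diff-nonneg n≤2h+1)) (ℤ.+≤+ z≤n))
    where
    -- Adding ⌊n/2⌋ before the division rounds to the nearest multiple instead of down.
    h = n ℕ./ 2
    y = x + + h
    ρ = y %ℕ n
    q = y /ℕ n
    x≡ : x ≡ + ρ + q * + n - + h
    x≡ = trans (alg x (+ h)) (cong (λ z → z - + h) (a≡a%ℕn+[a/ℕn]*n y n))
      where alg : ∀ x h → x ≡ x + h - h
            alg = solve-∀
    alg1 : ∀ ρ q n h → + 2 * (ρ + q * n - h + - q * n) - - n ≡ + 2 * ρ + (n - + 2 * h)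
    alg1 = solve-∀
    alg2 : ∀ ρ q n h → n - + 2 * (ρ + q * n - h + - q * n) ≡ + 2 * (n - (ρ + 1ℤ)) + (+ 2 * h + 1ℤ - n) + 1ℤ
    alg2 = solve-∀
    ρ<n : + ρ + 1ℤ ℤ.≤ + n
    ρ<n = <⇒1+≤ (ℤ.+<+ (n%ℕd<d y n))
    n≡ : n ≡ n ℕ.% 2 ℕ.+ h ℕ.* 2
    n≡ = ℕ.m≡m%n+[m/n]*n n 2
    2h≤n : + 2 * + h ℤ.≤ + n
    2h≤n = ℤ.≤-trans (ℤ.≤-reflexive (trans (ℤ.*-comm (+ 2) (+ h)) (sym (ℤ.pos-* h 2)))) (ℤ.+≤+ (ℕ.≤-trans (ℕ.m≤n+m (h ℕ.* 2) (n ℕ.% 2))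
        (ℕ.≤-reflexive (sym n≡))))
    n≤2h+1 : + n ℤ.≤ + 2 * + h + 1ℤ
    n≤2h+1 = ℤ.≤-trans (ℤ.+≤+ (ℕ.≤-trans (ℕ.≤-reflexive n≡) (ℕ.≤-trans (ℕ.+-monoˡ-≤ (h ℕ.* 2) (ℕ.≤-pred (ℕ.m%n<n n 2))) (ℕ.≤-reflexive
        (ℕ.+-comm 1 (h ℕ.* 2))))))
      (ℤ.≤-reflexive (trans (ℤ.pos-+ (h ℕ.* 2) 1) (cong (_+ 1ℤ) (trans (ℤ.pos-* h 2) (ℤ.*-comm (+ h) (+ 2))))))

  -- The form aX² + bY² + cZ² + rYZ + sXZ + tXY.
  record Ternary : Set where
    constructor tern
    field a b c r s t : ℤ

  module _ where
    open Ternary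

    val : Ternary → ℤ → ℤ → ℤ → ℤ
    val (tern a b c r s t) X Y Z = a * X * X + b * Y * Y + c * Z * Z + r * Y * Z + s * X * Z + t * X * Y

    disc : Ternary → ℤ
    disc (tern a b c r s t) = + 4 * a * b * c + r * s * t - a * r * r - b * s * s - c * t * t

    -- 4a·f = (2aX + tY + sZ)² + αY² + 2βYZ + γZ² with αγ - β² = 4a·disc f.
    α β γ : Ternary → ℤ
    α (tern a b c r s t) = + 4 * a * b - t * t
    β (tern a b c r s t) = + 2 * a * r - s * t
    γ (tern a b c r s t) = + 4 * a * c - s * s

    αγ-β² : ∀ f → α f * γ f - β f * β f ≡ + 4 * a f * disc f
    αγ-β² (tern a b c r s t) = alg a b c r s t
      where alg : ∀ a b c r s t → (+ 4 * a * b - t * t) * (+ 4 * a * c - s * s) - (+ 2 * a * r - s * t) * (+ 2 * a * r - s * t)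
                  ≡ + 4 * a * (+ 4 * a * b * c + r * s * t - a * r * r - b * s * s - c * t * t)
            alg = solve-∀

    -- Of equivalence with p² + pq + q² + w² only the inclusion of values is carried along the
    -- reduction.
    Good : Ternary → Set
    Good f = ∀ X Y Z → ∃[ p ] ∃[ q ] ∃[ w ] val f X Y Z ≡ p * p + p * q + q * q + w * w

    -- Sylvester's criterion: 2a, α and 2·disc are the leading minors of the Hessian matrix of f.
    record Positive (f : Ternary) : Set where
      constructor positive
      field
        0<a   : 0ℤ ℤ.< a f
        0<α   : 0ℤ ℤ.< α f
        disc3 : disc f ≡ + 3

    -- The substitutions X := X + uY, X := X + uZ and Y := Y + uZ.
    shiftXY shiftXZ shiftYZ : ℤ → Ternary → Ternary
    shiftXY u (tern a b c r s t) = tern a (b + a * u * u + t * u) c (r + s * u) s (t + u * (+ 2 * a))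
    shiftXZ u (tern a b c r s t) = tern a b (c + a * u * u + s * u) (r + t * u) (s + u * (+ 2 * a)) t
    shiftYZ u (tern a b c r s t) = tern a b (c + b * u * u + r * u) (r + + 2 * b * u) (s + t * u) t

    swapXY swapYZ : Ternary → Ternary
    swapXY (tern a b c r s t) = tern b a c s r t
    swapYZ (tern a b c r s t) = tern a c b r t s

    good-shiftXY : ∀ u f → Good (shiftXY u f) → Good f
    good-shiftXY u f@(tern a b c r s t) good X Y Z = let p , q , w , e = good (X - u * Y) Y Z in p , q , w , trans (sym (alg a b c r s t u X Y Z)) e
      where alg : ∀ a b c r s t u X Y Z → a * (X - u * Y) * (X - u * Y) + (b + a * u * u + t * u) * Y * Y + c * Z * Z +
              (r + s * u) * Y * Z + s * (X - u * Y) * Z + (t + u * (+ 2 * a)) * (X - u * Y) * Y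
                  ≡ a * X * X + b * Y * Y + c * Z * Z + r * Y * Z + s * X * Z + t * X * Y
            alg = solve-∀

    good-shiftXZ : ∀ u f → Good (shiftXZ u f) → Good f
    good-shiftXZ u f@(tern a b c r s t) good X Y Z = let p , q , w , e = good (X - u * Z) Y Z in p , q , w , trans (sym (alg a b c r s t u X Y Z)) e
      where alg : ∀ a b c r s t u X Y Z → a * (X - u * Z) * (X - u * Z) + b * Y * Y + (c + a * u * u + s * u) * Z * Z +
              (r + t * u) * Y * Z + (s + u * (+ 2 * a)) * (X - u * Z) * Z + t * (X - u * Z) * Y
                  ≡ a * X * X + b * Y * Y + c * Z * Z + r * Y * Z + s * X * Z + t * X * Y
            alg = solve-∀

    good-shiftYZ : ∀ u f → Good (shiftYZ u f) → Good f
    good-shiftYZ u f@(tern a b c r s t) good X Y Z = let p , q , w , e = good X (Y - u * Z) Z in p , q , w , trans (sym (alg a b c r s t u X Y Z)) e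
      where alg : ∀ a b c r s t u X Y Z → a * X * X + b * (Y - u * Z) * (Y - u * Z) + (c + b * u * u + r * u) * Z * Z +
              (r + + 2 * b * u) * (Y - u * Z) * Z + (s + t * u) * X * Z + t * X * (Y - u * Z)
                  ≡ a * X * X + b * Y * Y + c * Z * Z + r * Y * Z + s * X * Z + t * X * Y
            alg = solve-∀

    good-swapXY : ∀ f → Good (swapXY f) → Good f
    good-swapXY (tern a b c r s t) good X Y Z = let p , q , w , e = good Y X Z in p , q , w , trans (sym (alg a b c r s t X Y Z)) e
      where alg : ∀ a b c r s t X Y Z → b * Y * Y + a * X * X + c * Z * Z + s * X * Z + r * Y * Z + t * Y * X
                  ≡ a * X * X + b * Y * Y + c * Z * Z + r * Y * Z + s * X * Z + t * X * Y
            alg = solve-∀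

    good-swapYZ : ∀ f → Good (swapYZ f) → Good f
    good-swapYZ (tern a b c r s t) good X Y Z = let p , q , w , e = good X Z Y in p , q , w , trans (sym (alg a b c r s t X Y Z)) e
      where alg : ∀ a b c r s t X Y Z → a * X * X + c * Z * Z + b * Y * Y + r * Z * Y + t * X * Y + s * X * Z
                  ≡ a * X * X + b * Y * Y + c * Z * Z + r * Y * Z + s * X * Z + t * X * Y
            alg = solve-∀

    disc-shiftXY : ∀ u f → disc (shiftXY u f) ≡ disc f
    disc-shiftXY u (tern a b c r s t) = alg a b c r s t u
      where alg : ∀ a b c r s t u → + 4 * a * (b + a * u * u + t * u) * c + (r + s * u) * s * (t + u * (+ 2 * a)) - a * (r + s * u) *
              (r + s * u) - (b + a * u * u + t * u) * s * s - c * (t + u * (+ 2 * a)) * (t + u * (+ 2 * a))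
                  ≡ + 4 * a * b * c + r * s * t - a * r * r - b * s * s - c * t * t
            alg = solve-∀

    disc-shiftXZ : ∀ u f → disc (shiftXZ u f) ≡ disc f
    disc-shiftXZ u (tern a b c r s t) = alg a b c r s t u
      where alg : ∀ a b c r s t u → + 4 * a * b * (c + a * u * u + s * u) + (r + t * u) * (s + u * (+ 2 * a)) * t - a * (r + t * u) *
              (r + t * u) - b * (s + u * (+ 2 * a)) * (s + u * (+ 2 * a)) - (c + a * u * u + s * u) * t * t
                  ≡ + 4 * a * b * c + r * s * t - a * r * r - b * s * s - c * t * t
            alg = solve-∀

    disc-shiftYZ : ∀ u f → disc (shiftYZ u f) ≡ disc f
    disc-shiftYZ u (tern a b c r s t) = alg a b c r s t u
      where alg : ∀ a b c r s t u → + 4 * a * b * (c + b * u * u + r * u) + (r + + 2 * b * u) * (s + t * u) * t - a * (r + + 2 * b * u) *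
              (r + + 2 * b * u) - b * (s + t * u) * (s + t * u) - (c + b * u * u + r * u) * t * t
                  ≡ + 4 * a * b * c + r * s * t - a * r * r - b * s * s - c * t * t
            alg = solve-∀

    disc-swapXY : ∀ f → disc (swapXY f) ≡ disc f
    disc-swapXY (tern a b c r s t) = alg a b c r s t
      where alg : ∀ a b c r s t → + 4 * b * a * c + s * r * t - b * s * s - a * r * r - c * t * t ≡ + 4 * a * b * c + r * s * t - a * r * r
              - b * s * s - c * t * t
            alg = solve-∀

    disc-swapYZ : ∀ f → disc (swapYZ f) ≡ disc f
    disc-swapYZ (tern a b c r s t) = alg a b c r s t
      where alg : ∀ a b c r s t → + 4 * a * c * b + r * t * s - a * r * r - c * t * t - b * s * s ≡ + 4 * a * b * c + r * s * t - a * r * r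
              - b * s * s - c * t * t
            alg = solve-∀

    α-shiftXY : ∀ u f → α (shiftXY u f) ≡ α f
    α-shiftXY u (tern a b c r s t) = alg a b t u
      where alg : ∀ a b t u → + 4 * a * (b + a * u * u + t * u) - (t + u * (+ 2 * a)) * (t + u * (+ 2 * a)) ≡ + 4 * a * b - t * t
            alg = solve-∀

    β-shiftXY : ∀ u f → β (shiftXY u f) ≡ β f
    β-shiftXY u (tern a b c r s t) = alg a r s t u
      where alg : ∀ a r s t u → + 2 * a * (r + s * u) - s * (t + u * (+ 2 * a)) ≡ + 2 * a * r - s * t
            alg = solve-∀

    β-shiftXZ : ∀ u f → β (shiftXZ u f) ≡ β f
    β-shiftXZ u (tern a b c r s t) = alg a r s t u
      where alg : ∀ a r s t u → + 2 * a * (r + t * u) - (s + u * (+ 2 * a)) * t ≡ + 2 * a * r - s * t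
            alg = solve-∀

    β-shiftYZ : ∀ u f → β (shiftYZ u f) ≡ β f + u * α f
    β-shiftYZ u (tern a b c r s t) = alg a b r s t u
      where alg : ∀ a b r s t u → + 2 * a * (r + + 2 * b * u) - (s + t * u) * t ≡ + 2 * a * r - s * t + u * (+ 4 * a * b - t * t)
            alg = solve-∀

    -- The binary form αY² + 2βYZ + γZ² is reduced in the sense of Gauss.
    record Reduced (f : Ternary) : Set where
      constructor reduced
      field
        β≥  : - α f ℤ.≤ + 2 * β f
        β≤  : + 2 * β f ℤ.≤ α f
        α≤γ : α f ℤ.≤ γ f

    positive-product : ∀ {x y} → 0ℤ ℤ.< x → 0ℤ ℤ.< x * y → 0ℤ ℤ.< y
    positive-product {x} {y} 0<x 0<xy with 0ℤ ℤ.<? y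
    ... | yes 0<y = 0<y
    ... | no ¬0<y = contradiction (≤-from-diff (x * - y) (alg x y) (*-nonneg (ℤ.<⇒≤ 0<x) (ℤ.neg-mono-≤ (ℤ.≮⇒≥ ¬0<y)))) (ℤ.<⇒≱ 0<xy)
      where alg : ∀ x y → 0ℤ - x * y ≡ x * - y
            alg = solve-∀

    γ-positive : ∀ {f} → Positive f → 0ℤ ℤ.< γ f
    γ-positive {f} (positive 0<a 0<α d) = positive-product 0<α (1+≤⇒< (≤-from-diff (+ 12 * (a f - 1ℤ) + β f * β f + + 11)
      (trans (cong (λ z → z - (0ℤ + 1ℤ)) αγ≡) (alg (a f) (β f))) (+-nonneg {+ 12 * (a f - 1ℤ) + β f * β f} (+-nonneg {+ 12 * (a f - 1ℤ)}
          (scale-nonneg 12 (diff-nonneg (<⇒1+≤ 0<a))) (square-nonneg (β f))) (ℤ.+≤+ z≤n))))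
      where
      αγ≡ : α f * γ f ≡ + 4 * a f * + 3 + β f * β f
      αγ≡ = trans (alg0 (α f * γ f) (β f * β f)) (cong (_+ β f * β f) (trans (αγ-β² f) (cong (_*_ (+ 4 * a f)) d)))
        where alg0 : ∀ x y → x ≡ x - y + y
              alg0 = solve-∀
      alg : ∀ a b → + 4 * a * + 3 + b * b - (0ℤ + 1ℤ) ≡ + 12 * (a - 1ℤ) + b * b + + 11
      alg = solve-∀

    -- Gauss reduction of αY² + 2βYZ + γZ²: centre β, then exchange Y and Z while γ < α, with `n`
    -- bounding the decreasing α. The substitutions leave X alone, hence also a.
    reduce-binary : ∀ n f → α f ℤ.≤ + n → Positive f →
                    ∃[ f′ ] (Positive f′ × Reduced f′ × a f′ ≡ a f × (Good f′ → Good f))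
    reduce-binary zero    f α≤0 (positive _ 0<α _) = contradiction α≤0 (ℤ.<⇒≱ 0<α)
    reduce-binary (suc n) f α≤n pos@(positive 0<a 0<α d) = go (round (α f) 0<α (β f))
      where
      go : ∃[ u ] (- α f ℤ.≤ + 2 * (β f + u * α f) × + 2 * (β f + u * α f) ℤ.≤ α f) →
           ∃[ f′ ] (Positive f′ × Reduced f′ × a f′ ≡ a f × (Good f′ → Good f))
      go (u , lo , hi) = decide (α f ℤ.≤? γ f₁)
        where
        f₁ = shiftYZ u f
        pos₁ : Positive f₁
        pos₁ = positive 0<a 0<α (trans (disc-shiftYZ u f) d)
        decide : Dec (α f ℤ.≤ γ f₁) → ∃[ f′ ] (Positive f′ × Reduced f′ × a f′ ≡ a f × (Good f′ → Good f))
        decide (yes α≤γ) = f₁ , pos₁ , reduced (subst (λ b → - α f ℤ.≤ + 2 * b) (sym (β-shiftYZ u f)) lo) (subst (λ b → + 2 * b ℤ.≤ α f)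
            (sym (β-shiftYZ u f)) hi) α≤γ , refl , good-shiftYZ u f
        decide (no α≰γ) =
          let f₂ , pos₂ , red , a≡ , good = reduce-binary n (swapYZ f₁) γ≤n (positive 0<a (γ-positive pos₁) (trans (disc-swapYZ f₁)
                (Positive.disc3 pos₁)))
          in f₂ , pos₂ , red , a≡ , λ g → good-shiftYZ u f (good-swapYZ f₁ (good g))
          where
          γ≤n : γ f₁ ℤ.≤ + n
          γ≤n = ≤-from-diff (+ suc n - (γ f₁ + 1ℤ)) (alg (+ n) (γ f₁)) (diff-nonneg (ℤ.≤-trans (<⇒1+≤ (ℤ.≰⇒> α≰γ)) α≤n))
            where alg : ∀ n g → n - g ≡ 1ℤ + n - (g + 1ℤ)
                  alg = solve-∀

    αγ≡12a+β² : ∀ {f} → Positive f → α f * γ f ≡ + 12 * a f + β f * β f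
    αγ≡12a+β² {f} (positive _ _ d) = trans (alg (α f * γ f) (β f * β f)) (cong (_+ β f * β f) (trans (αγ-β² f) (trans (cong (_*_
        (+ 4 * a f)) d) (alg2 (a f)))))
      where alg : ∀ x y → x ≡ x - y + y
            alg = solve-∀
            alg2 : ∀ a → + 4 * a * + 3 ≡ + 12 * a
            alg2 = solve-∀

    -- 4α² ≤ 4αγ = 48a + 4β² ≤ 48a + α², where 12a is 4a times the discriminant.
    α²≤16a : ∀ {f} → Positive f → Reduced f → 0ℤ ℤ.≤ + 48 * a f - + 3 * (α f * α f)
    α²≤16a {f} pos@(positive _ 0<α _) (reduced lo hi α≤γ) = subst (0ℤ ℤ.≤_)
        (trans (alg (α f) (β f) (γ f)) (trans (cong (λ z → + 4 * z - + 4 * (β f * β f) - + 3 * (α f * α f)) (αγ≡12a+β² pos)) (alg2 (a f)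
            (α f) (β f))))
        (+-nonneg {+ 4 * (α f * (γ f - α f))} (scale-nonneg 4 (*-nonneg (ℤ.<⇒≤ 0<α) (diff-nonneg α≤γ)))
          (*-nonneg (diff-nonneg hi) (diff-nonneg lo)))
      where
      alg : ∀ x y z → + 4 * (x * (z - x)) + (x - + 2 * y) * (+ 2 * y - - x) ≡ + 4 * (x * z) - + 4 * (y * y) - + 3 * (x * x)
      alg = solve-∀
      alg2 : ∀ a x y → + 4 * (+ 12 * a + y * y) - + 4 * (y * y) - + 3 * (x * x) ≡ + 48 * a - + 3 * (x * x)
      alg2 = solve-∀

    b-positive : ∀ {f} → Positive f → 0ℤ ℤ.< b f
    b-positive {f} (positive 0<a 0<α _) = positive-product 0<a (positive-product {+ 4} (ℤ.+<+ (s≤s z≤n)) (1+≤⇒<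
      (≤-from-diff ((α f - 1ℤ) + t f * t f) (alg (a f) (b f) (t f)) (+-nonneg {α f - 1ℤ} (diff-nonneg (<⇒1+≤ 0<α)) (square-nonneg (t f))))))
      where alg : ∀ a b t → + 4 * (a * b) - (0ℤ + 1ℤ) ≡ + 4 * a * b - t * t - 1ℤ + t * t
            alg = solve-∀

    -- α² ≤ 16a and |t| ≤ a give 4ab = α + t² ℤ.≤ 4√a + a².
    b<a : ∀ {f} → 0ℤ ℤ.≤ + 48 * a f - + 3 * (α f * α f) → - a f ℤ.≤ t f → t f ℤ.≤ a f → + 2 ℤ.≤ a f → b f ℤ.< a f
    b<a {f} bound lo hi 2≤a with b f ℤ.<? a f
    ... | yes lt = lt
    -- If b ≥ a, then t² ≤ a² gives α ≥ 3a², so 27a⁴ ≤ 3α² ≤ 48a. But 27a⁴ - 48a - 336 is a - 2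
    -- times a positive polynomial.
    ... | no ¬lt = contradiction (+-nonneg {+ 48 * a f - + 3 * (α f * α f) + + 3 * ((α f - + 3 * (a f * a f)) * (α f + + 3 * (a f * a f)))}
             (+-nonneg {+ 48 * a f - + 3 * (α f * α f)} bound (scale-nonneg 3 (*-nonneg small (+-nonneg small′ (scale-nonneg 3
                 (square-nonneg (a f)))))))
             (+-nonneg {(a f - + 2) * (+ 27 * ((a f * a f + + 2 * a f + + 4) * a f) + + 168)} (*-nonneg (diff-nonneg 2≤a)
                 (+-nonneg {+ 27 * ((a f * a f + + 2 * a f + + 4) * a f)} (scale-nonneg 27 (*-nonneg (+-nonneg {a f * a f + + 2 * a f}
                 (+-nonneg {a f * a f} (square-nonneg (a f)) (scale-nonneg 2 0≤a)) (ℤ.+≤+ z≤n)) 0≤a)) (ℤ.+≤+ z≤n))) (ℤ.+≤+ {0} {0} z≤n)))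
           (λ nn → negative-absurd 335 nn (alg3 (a f) (α f)))
      where
      0≤a : 0ℤ ℤ.≤ a f
      0≤a = ℤ.≤-trans (ℤ.+≤+ z≤n) 2≤a
      t²≤a² : 0ℤ ℤ.≤ (a f - t f) * (t f - - a f)
      t²≤a² = *-nonneg (diff-nonneg hi) (diff-nonneg lo)
      alg : ∀ a b t → + 4 * (a * (b - a)) + (a - t) * (t - - a) ≡ + 4 * a * b - t * t - + 3 * (a * a)
      alg = solve-∀
      small : 0ℤ ℤ.≤ α f - + 3 * (a f * a f)
      small = subst (0ℤ ℤ.≤_) (alg (a f) (b f) (t f)) (+-nonneg {+ 4 * (a f * (b f - a f))} (scale-nonneg 4 (*-nonneg 0≤a (diff-nonneg
          (ℤ.≮⇒≥ ¬lt)))) t²≤a²)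
      small′ : 0ℤ ℤ.≤ α f
      small′ = subst (0ℤ ℤ.≤_) (alg2 (α f) (+ 3 * (a f * a f))) (+-nonneg small (scale-nonneg 3 (square-nonneg (a f))))
        where alg2 : ∀ x y → x - y + y ≡ x
              alg2 = solve-∀
      alg3 : ∀ a x → + 48 * a - + 3 * (x * x) + + 3 * ((x - + 3 * (a * a)) * (x + + 3 * (a * a))) + ((a - + 2) * (+ 27 *
          ((a * a + + 2 * a + + 4) * a) + + 168) + 0ℤ) + + 336 ≡ 0ℤ
      alg3 = solve-∀

    -- The multiple 4b = x + τ of 4 lies between 1 and 5.
    unit-coefficient : ∀ b x τ → 0ℤ ℤ.< x → x ℤ.≤ + 4 → 0ℤ ℤ.≤ τ → τ ℤ.≤ 1ℤ → x ≡ + 4 * b - τ → b ≡ 1ℤ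
    unit-coefficient b x τ 0<x x≤4 0≤τ τ≤1 e = ℤ.≤-antisym upper lower
      where
      alg : ∀ b τ → + 4 - (+ 4 * b - τ) + (1ℤ - τ) + + 4 * (b - + 2) + + 3 ≡ 0ℤ
      alg = solve-∀
      upper : b ℤ.≤ 1ℤ
      upper with b ℤ.≤? 1ℤ
      ... | yes p = p
      ... | no ¬p = contradiction (+-nonneg {+ 4 - x + (1ℤ - τ)} (+-nonneg {+ 4 - x} (diff-nonneg x≤4) (diff-nonneg τ≤1)) (scale-nonneg 4
          (diff-nonneg (<⇒1+≤ (ℤ.≰⇒> ¬p)))))
              (λ nn → negative-absurd 2 nn (trans (cong (λ x → + 4 - x + (1ℤ - τ) + + 4 * (b - + 2) + + 3) e) (alg b τ)))
      alg2 : ∀ b τ → + 4 * b - τ - 1ℤ + τ + + 4 * (0ℤ - b) + 1ℤ ≡ 0ℤ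
      alg2 = solve-∀
      lower : 1ℤ ℤ.≤ b
      lower with 1ℤ ℤ.≤? b
      ... | yes p = p
      ... | no ¬p = contradiction (+-nonneg {x - 1ℤ + τ} (+-nonneg {x - 1ℤ} (diff-nonneg (<⇒1+≤ 0<x)) 0≤τ) (scale-nonneg 4 (diff-nonneg b≤0)))
              (λ nn → negative-absurd 0 nn (trans (cong (λ x → x - 1ℤ + τ + + 4 * (0ℤ - b) + 1ℤ) e) (alg2 b τ)))
        where
        b≤0 : b ℤ.≤ 0ℤ
        b≤0 = ≤-from-diff (1ℤ - (b + 1ℤ)) (alg3 b) (diff-nonneg (<⇒1+≤ (ℤ.≰⇒> ¬p)))
          where alg3 : ∀ b → 0ℤ - b ≡ 1ℤ - (b + 1ℤ)
                alg3 = solve-∀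

    square≤1 : ∀ {x} → - 1ℤ ℤ.≤ x → x ℤ.≤ 1ℤ → x * x ℤ.≤ 1ℤ
    square≤1 {x} lo hi = ≤-from-diff ((1ℤ - x) * (x - - 1ℤ)) (alg x) (*-nonneg (diff-nonneg hi) (diff-nonneg lo))
      where alg : ∀ x → 1ℤ - x * x ≡ (1ℤ - x) * (x - - 1ℤ)
            alg = solve-∀

    data Small : ℤ → Set where
      zero′ : Small 0ℤ
      plus  : Small 1ℤ
      minus : Small (- 1ℤ)

    small : ∀ x → - 1ℤ ℤ.≤ x → x ℤ.≤ 1ℤ → Small x
    small (+ 0) _ _ = zero′
    small (+ 1) _ _ = plus
    small (+ suc (suc n)) _ (ℤ.+≤+ (s≤s ()))
    small ℤ.-[1+ 0 ] _ _ = minus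
    small ℤ.-[1+ suc n ] (ℤ.-≤- ()) _

    small-square : ∀ r → r * r ≡ 1ℤ → Small r
    small-square r e with ℕ.m*n≡1⇒m≡1 (abs r) (abs r) (trans (sym (ℤ.abs-* r r)) (cong abs e))
    small-square (+ .1)      e | refl = plus
    small-square ℤ.-[1+ .0 ]   e | refl = minus

    zero-root : ∀ r → r * r ≡ 0ℤ → r ≡ 0ℤ
    zero-root r e = [ (λ z → z) , (λ z → z) ]′ (ℤ.i*j≡0⇒i≡0∨j≡0 r e)

    -- Exactly one of r, s, t is nonzero, and then it is ±1: if s and t were both ±1, the equation
    -- would become (2r - st)² + 3 = 0. A change of sign of one variable turns -1 into 1.
    good-unit : ∀ r s t → Small s → Small t → + 4 + r * s * t - r * r - s * s - t * t ≡ + 3 → Good (tern 1ℤ 1ℤ 1ℤ r s t)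
    good-unit r _ _ zero′ zero′ e = yz (small-square r (trans (alg r) (cong (λ z → + 4 - z) e)))
      where
      alg : ∀ r → r * r ≡ + 4 - (+ 4 + r * 0ℤ * 0ℤ - r * r - 0ℤ - 0ℤ)
      alg = solve-∀
      yz : Small r → Good (tern 1ℤ 1ℤ 1ℤ r 0ℤ 0ℤ)
      yz zero′ = contradiction e (λ ())
      yz plus X Y Z = Y , Z , X , v X Y Z
        where v : ∀ X Y Z → 1ℤ * X * X + 1ℤ * Y * Y + 1ℤ * Z * Z + 1ℤ * Y * Z + 0ℤ * X * Z + 0ℤ * X * Y ≡ Y * Y + Y * Z + Z * Z + X * X
              v = solve-∀
      yz minus X Y Z = Y , - Z , X , v X Y Z
        where v : ∀ X Y Z → 1ℤ * X * X + 1ℤ * Y * Y + 1ℤ * Z * Z + (- 1ℤ) * Y * Z + 0ℤ * X * Z + 0ℤ * X * Y ≡ Y * Y + Y * (- Z) + (- Z) *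
                (- Z) + X * X
              v = solve-∀
    good-unit r _ _ zero′ plus e = subst (λ r → Good (tern 1ℤ 1ℤ 1ℤ r 0ℤ 1ℤ)) (sym (zero-root r (trans (alg r) (cong (λ z → + 3 - z) e))))
        (λ X Y Z → X , Y , Z , v X Y Z)
      where
      alg : ∀ r → r * r ≡ + 3 - (+ 4 + r * 0ℤ * 1ℤ - r * r - 0ℤ - 1ℤ)
      alg = solve-∀
      v : ∀ X Y Z → 1ℤ * X * X + 1ℤ * Y * Y + 1ℤ * Z * Z + 0ℤ * Y * Z + 0ℤ * X * Z + 1ℤ * X * Y ≡ X * X + X * Y + Y * Y + Z * Z
      v = solve-∀
    good-unit r _ _ zero′ minus e = subst (λ r → Good (tern 1ℤ 1ℤ 1ℤ r 0ℤ (- 1ℤ))) (sym (zero-root r (trans (alg r) (cong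
        (λ z → + 3 - z) e)))) (λ X Y Z → X , - Y , Z , v X Y Z)
      where
      alg : ∀ r → r * r ≡ + 3 - (+ 4 + r * 0ℤ * - 1ℤ - r * r - 0ℤ - 1ℤ)
      alg = solve-∀
      v : ∀ X Y Z → 1ℤ * X * X + 1ℤ * Y * Y + 1ℤ * Z * Z + 0ℤ * Y * Z + 0ℤ * X * Z + (- 1ℤ) * X * Y ≡ X * X + X * - Y + - Y * - Y + Z * Z
      v = solve-∀
    good-unit r _ _ plus zero′ e = subst (λ r → Good (tern 1ℤ 1ℤ 1ℤ r 1ℤ 0ℤ)) (sym (zero-root r (trans (alg r) (cong (λ z → + 3 - z) e))))
        (λ X Y Z → X , Z , Y , v X Y Z)
      where
      alg : ∀ r → r * r ≡ + 3 - (+ 4 + r * 1ℤ * 0ℤ - r * r - 1ℤ - 0ℤ)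
      alg = solve-∀
      v : ∀ X Y Z → 1ℤ * X * X + 1ℤ * Y * Y + 1ℤ * Z * Z + 0ℤ * Y * Z + 1ℤ * X * Z + 0ℤ * X * Y ≡ X * X + X * Z + Z * Z + Y * Y
      v = solve-∀
    good-unit r _ _ minus zero′ e = subst (λ r → Good (tern 1ℤ 1ℤ 1ℤ r (- 1ℤ) 0ℤ)) (sym (zero-root r (trans (alg r) (cong
        (λ z → + 3 - z) e)))) (λ X Y Z → X , - Z , Y , v X Y Z)
      where
      alg : ∀ r → r * r ≡ + 3 - (+ 4 + r * - 1ℤ * 0ℤ - r * r - 1ℤ - 0ℤ)
      alg = solve-∀
      v : ∀ X Y Z → 1ℤ * X * X + 1ℤ * Y * Y + 1ℤ * Z * Z + 0ℤ * Y * Z + (- 1ℤ) * X * Z + 0ℤ * X * Y ≡ X * X + X * - Z + - Z * - Z + Y * Y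
      v = solve-∀
    good-unit r _ _ plus plus e = contradiction (square-nonneg (+ 2 * r - 1ℤ)) (λ nn → negative-absurd 2 nn (trans (alg r) (cong
        (λ z → + 4 * (+ 3 - z)) e)))
      where alg : ∀ r → (+ 2 * r - 1ℤ) * (+ 2 * r - 1ℤ) + + 3 ≡ + 4 * (+ 3 - (+ 4 + r * 1ℤ * 1ℤ - r * r - 1ℤ - 1ℤ))
            alg = solve-∀
    good-unit r _ _ minus minus e = contradiction (square-nonneg (+ 2 * r - 1ℤ)) (λ nn → negative-absurd 2 nn (trans (alg r) (cong
        (λ z → + 4 * (+ 3 - z)) e)))
      where alg : ∀ r → (+ 2 * r - 1ℤ) * (+ 2 * r - 1ℤ) + + 3 ≡ + 4 * (+ 3 - (+ 4 + r * - 1ℤ * - 1ℤ - r * r - 1ℤ - 1ℤ))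
            alg = solve-∀
    good-unit r _ _ plus minus e = contradiction (square-nonneg (+ 2 * r + 1ℤ)) (λ nn → negative-absurd 2 nn (trans (alg r) (cong
        (λ z → + 4 * (+ 3 - z)) e)))
      where alg : ∀ r → (+ 2 * r + 1ℤ) * (+ 2 * r + 1ℤ) + + 3 ≡ + 4 * (+ 3 - (+ 4 + r * 1ℤ * - 1ℤ - r * r - 1ℤ - 1ℤ))
            alg = solve-∀
    good-unit r _ _ minus plus e = contradiction (square-nonneg (+ 2 * r + 1ℤ)) (λ nn → negative-absurd 2 nn (trans (alg r) (cong
        (λ z → + 4 * (+ 3 - z)) e)))
      where alg : ∀ r → (+ 2 * r + 1ℤ) * (+ 2 * r + 1ℤ) + + 3 ≡ + 4 * (+ 3 - (+ 4 + r * - 1ℤ * 1ℤ - r * r - 1ℤ - 1ℤ))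
            alg = solve-∀

    -- For a = 1 the bound 3α² ≤ 48 gives α ≤ 4 and so b = 1. Then α = 4 - t² is 3 or 4, and αγ = 12
    -- + β² with 4β² ≤ α² gives γ ≤ 4 and so c = 1.
    good-final : ∀ f → Positive f → 0ℤ ℤ.≤ + 48 * a f - + 3 * (α f * α f) → + 4 * (β f * β f) ℤ.≤ α f * α f →
                 a f ≡ 1ℤ → - 1ℤ ℤ.≤ t f → t f ℤ.≤ 1ℤ → - 1ℤ ℤ.≤ s f → s f ℤ.≤ 1ℤ → Good f
    good-final f@(tern a b c r s t) pos@(positive 0<a 0<α d) bound β-bound refl t≥ t≤ s≥ s≤ =
      subst Good (cong₂ (λ b c → tern 1ℤ b c r s t) (sym b≡1) (sym c≡1))
        (good-unit r s t (small s s≥ s≤) (small t t≥ t≤)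
          (trans (alg0 r s t) (trans (sym (cong₂ (λ b c → disc (tern 1ℤ b c r s t)) b≡1 c≡1)) d)))
      where
      alg0 : ∀ r s t → + 4 + r * s * t - r * r - s * s - t * t ≡ + 4 * 1ℤ * 1ℤ * 1ℤ + r * s * t - 1ℤ * r * r - 1ℤ * s * s - 1ℤ * t * t
      alg0 = solve-∀
      α≤4 : α f ℤ.≤ + 4
      α≤4 with α f ℤ.≤? + 4
      ... | yes p = p
      ... | no ¬p = contradiction (+-nonneg {+ 48 - + 3 * (α f * α f)} bound (scale-nonneg 3 (*-nonneg 5≤ (+-nonneg {α f - + 5} 5≤
          (ℤ.+≤+ {0} {10} z≤n)))))
              (λ nn → negative-absurd 26 nn (alg (α f)))
        where
        5≤ : 0ℤ ℤ.≤ α f - + 5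
        5≤ = diff-nonneg (<⇒1+≤ (ℤ.≰⇒> ¬p))
        alg : ∀ x → + 48 - + 3 * (x * x) + + 3 * ((x - + 5) * (x - + 5 + + 10)) + + 27 ≡ 0ℤ
        alg = solve-∀
      b≡1 : b ≡ 1ℤ
      b≡1 = unit-coefficient b (α f) (t * t) 0<α α≤4 (square-nonneg t) (square≤1 t≥ t≤) (alg b t)
        where alg : ∀ b t → + 4 * 1ℤ * b - t * t ≡ + 4 * b - t * t
              alg = solve-∀
      τ = t * t
      α≡ : α f ≡ + 4 - τ
      α≡ = cong (λ b → + 4 * 1ℤ * b - τ) b≡1
      γ≤4 : γ f ℤ.≤ + 4
      γ≤4 with γ f ℤ.≤? + 4
      ... | yes p = p
      ... | no ¬p = contradiction
              (+-nonneg {α f * α f - + 4 * (β f * β f) + + 4 * (α f * (γ f - + 5))} (+-nonneg {α f * α f - + 4 * (β f * β f)}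
                  (diff-nonneg β-bound) (scale-nonneg 4 (*-nonneg (ℤ.<⇒≤ 0<α) (diff-nonneg (<⇒1+≤ (ℤ.≰⇒> ¬p))))))
                (*-nonneg (diff-nonneg (square≤1 t≥ t≤)) (+-nonneg {τ} (square-nonneg t) (ℤ.+≤+ {0} {13} z≤n))))
              (λ nn → negative-absurd 2 nn (trans (alg (α f) (β f) (γ f) τ) (trans (cong₂ (λ x y → x * x - + 4 *
                  (β f * β f) + + 4 * y - + 20 * x + (1ℤ - τ) * (τ + + 13) + + 3) α≡ (αγ≡12a+β² pos)) (alg2 τ (β f)))))
        where
        alg : ∀ x y z τ → x * x - + 4 * (y * y) + + 4 * (x * (z - + 5)) + (1ℤ - τ) * (τ + + 13) + + 3 ≡ x * x - + 4 * (y * y) + + 4 *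
            (x * z) - + 20 * x + (1ℤ - τ) * (τ + + 13) + + 3
        alg = solve-∀
        alg2 : ∀ τ y → (+ 4 - τ) * (+ 4 - τ) - + 4 * (y * y) + + 4 * (+ 12 * 1ℤ + y * y) - + 20 * (+ 4 - τ) + (1ℤ - τ) * (τ + + 13) + + 3 ≡ 0ℤ
        alg2 = solve-∀
      c≡1 : c ≡ 1ℤ
      c≡1 = unit-coefficient c (γ f) (s * s) (γ-positive pos) γ≤4 (square-nonneg s) (square≤1 s≥ s≤) (alg c s)
        where alg : ∀ c s → + 4 * 1ℤ * c - s * s ≡ + 4 * c - s * s
              alg = solve-∀

    halve : ∀ {x n} → + 2 * x ℤ.≤ + 2 * n → x ℤ.≤ n
    halve {x} {n} = ℤ.*-cancelˡ-≤-pos x n (+ 2)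

    -- Hermite's alternation, with `n` bounding a. Reduction of the binary part bounds α by a
    -- multiple of √a, and centring t then yields b < a unless a = 1; exchanging X and Y lowers a.
    -- For a = 1 also s is centred.
    reduce : ∀ n f → a f ℤ.≤ + n → Positive f → Good f
    reduce zero    f a≤0 (positive 0<a _ _) = contradiction a≤0 (ℤ.<⇒≱ 0<a)
    reduce (suc n) f a≤n pos@(positive 0<a 0<α _) = step (reduce-binary (abs (α f)) f (ℤ.≤-reflexive (sym (ℤ.0≤i⇒+∣i∣≡i (ℤ.<⇒≤ 0<α)))) pos)
      where
      step : ∃[ f′ ] (Positive f′ × Reduced f′ × a f′ ≡ a f × (Good f′ → Good f)) → Good f
      step (f₁ , pos₁@(positive 0<a₁ 0<α₁ d₁) , red@(reduced lo hi _) , a≡ , back) = back (center (round (+ 2 * a f₁) 0<2a (t f₁)))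
        where
        0<2a : 0ℤ ℤ.< + 2 * a f₁
        0<2a = 1+≤⇒< (≤-from-diff (+ 2 * (a f₁ - 1ℤ) + 1ℤ) (alg (a f₁)) (+-nonneg {+ 2 * (a f₁ - 1ℤ)} (scale-nonneg 2 (diff-nonneg
            (<⇒1+≤ 0<a₁))) (ℤ.+≤+ z≤n)))
          where alg : ∀ a → + 2 * a - (0ℤ + 1ℤ) ≡ + 2 * (a - 1ℤ) + 1ℤ
                alg = solve-∀
        lower : ∀ {x} → - (+ 2 * a f₁) ℤ.≤ + 2 * x → - a f₁ ℤ.≤ x
        lower le = halve (ℤ.≤-trans (ℤ.≤-reflexive (sym (ℤ.neg-distribʳ-* (+ 2) (a f₁)))) le)
        center : ∃[ u ] (- (+ 2 * a f₁) ℤ.≤ + 2 * (t f₁ + u * (+ 2 * a f₁)) × + 2 * (t f₁ + u * (+ 2 * a f₁)) ℤ.≤ + 2 * a f₁) → Good f₁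
        center (u , tlo , thi) = good-shiftXY u f₁ (decide (+ 2 ℤ.≤? a f₁))
          where
          f₂ = shiftXY u f₁
          pos₂ : Positive f₂
          pos₂ = positive 0<a₁ (subst (0ℤ ℤ.<_) (sym (α-shiftXY u f₁)) 0<α₁) (trans (disc-shiftXY u f₁) d₁)
          bound₂ : 0ℤ ℤ.≤ + 48 * a f₂ - + 3 * (α f₂ * α f₂)
          bound₂ = subst (λ x → 0ℤ ℤ.≤ + 48 * a f₁ - + 3 * (x * x)) (sym (α-shiftXY u f₁)) (α²≤16a pos₁ red)
          β-bound₁ : + 4 * (β f₁ * β f₁) ℤ.≤ α f₁ * α f₁
          β-bound₁ = ≤-from-diff ((α f₁ - + 2 * β f₁) * (+ 2 * β f₁ - - α f₁)) (alg (α f₁) (β f₁)) (*-nonneg (diff-nonneg hi) (diff-nonneg lo))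
            where alg : ∀ x y → x * x - + 4 * (y * y) ≡ (x - + 2 * y) * (+ 2 * y - - x)
                  alg = solve-∀
          decide : Dec (+ 2 ℤ.≤ a f₁) → Good f₂
          decide (yes 2≤a) = good-swapXY f₂ (reduce n (swapXY f₂) b≤n
              (positive (b-positive pos₂) (subst (0ℤ ℤ.<_) (sym (alg (a f₂) (b f₂) (t f₂))) (Positive.0<α pos₂)) (trans (disc-swapXY f₂)
                  (Positive.disc3 pos₂))))
            where
            alg : ∀ a b t → + 4 * b * a - t * t ≡ + 4 * a * b - t * t
            alg = solve-∀
            b≤n : b f₂ ℤ.≤ + n
            b≤n = ≤-from-diff (+ suc n - (b f₂ + 1ℤ)) (alg2 (+ n) (b f₂)) (diff-nonneg (ℤ.≤-trans (<⇒1+≤ (b<a {f₂} bound₂ (lower tlo)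
                (halve thi) 2≤a)) (subst (ℤ._≤ + suc n) (sym a≡) a≤n)))
              where alg2 : ∀ n g → n - g ≡ 1ℤ + n - (g + 1ℤ)
                    alg2 = solve-∀
          decide (no ¬2≤a) = last (round (+ 2 * a f₂) 0<2a (s f₂))
            where
            a≡1 : a f₁ ≡ 1ℤ
            a≡1 = ℤ.≤-antisym (≤-from-diff (+ 2 - (a f₁ + 1ℤ)) (alg (a f₁)) (diff-nonneg (<⇒1+≤ (ℤ.≰⇒> ¬2≤a)))) (<⇒1+≤ 0<a₁)
              where alg : ∀ a → 1ℤ - a ≡ + 2 - (a + 1ℤ)
                    alg = solve-∀
            last : ∃[ v ] (- (+ 2 * a f₂) ℤ.≤ + 2 * (s f₂ + v * (+ 2 * a f₂)) × + 2 * (s f₂ + v * (+ 2 * a f₂)) ℤ.≤ + 2 * a f₂) → Good f₂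
            last (v , slo , shi) = good-shiftXZ v f₂ (good-final f₃
                (positive 0<a₁ (Positive.0<α pos₂) (trans (disc-shiftXZ v f₂) (Positive.disc3 pos₂)))
                bound₂
                (subst₂ (λ x y → + 4 * (x * x) ℤ.≤ y * y) (sym (trans (β-shiftXZ v f₂) (β-shiftXY u f₁))) (sym (α-shiftXY u f₁)) β-bound₁)
                a≡1 (subst (λ z → - z ℤ.≤ t f₂) a≡1 (lower tlo)) (subst (t f₂ ℤ.≤_) a≡1 (halve thi))
                (subst (λ z → - z ℤ.≤ s f₃) a≡1 (lower slo)) (subst (s f₃ ℤ.≤_) a≡1 (halve shi)))
              where f₃ = shiftXZ v f₂

    disc3-good : ∀ f → Positive f → Good f
    disc3-good f pos@(positive 0<a _ _) = reduce (abs (a f)) f (ℤ.≤-reflexive (sym (ℤ.0≤i⇒+∣i∣≡i (ℤ.<⇒≤ 0<a)))) pos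

  -- Numbers represented by p² + pq + q² + w²

  module Reciprocity where

    J-minus : ∀ q a → Mod.Unit (q ℕ.+ q) (- a) → Mod.J (q ℕ.+ q) (- a) ≡ Mod.J (q ℕ.+ q) a
    J-minus q a u = trans (cong J (sym (ℤ.-1*i≡-i a))) (trans
        (J-* (unit-neg unit-1) (unit-≋ (≋-reflexive (ℤ.neg-involutive a)) (unit-neg u)))
        (cong (_· J a) (J-neg1 q refl)))
      where open Mod (q ℕ.+ q)

    unit-from : ∀ h a x q → + a * + x - 1ℤ ≡ q * Mod.N h → Mod.Unit h (+ a)
    unit-from h a x q e = Mod.unit (+ x) (Mod.mod (divides q e))

    unit-4aq-1 : ∀ a q h → suc h ≡ a ℕ.* (q ℕ.+ q) → Mod.Unit h (+ a)
    unit-4aq-1 a q h e = unit-from h a (4 ℕ.* q) 1ℤ (trans (cong (λ z → z - 1ℤ) (trans (sym (ℤ.pos-* a (4 ℕ.* q))) (cong +_ (trans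
        (alg a q) (cong (λ s → s ℕ.+ s) (sym e))))))
        (trans (cong +_ (ℕ.+-suc h h)) (sym (ℤ.*-identityˡ (Mod.N h)))))
      where alg : ∀ a q → a ℕ.* (4 ℕ.* q) ≡ a ℕ.* (q ℕ.+ q) ℕ.+ a ℕ.* (q ℕ.+ q)
            alg = ℕ-solver.solve-∀

    unit-4aq+1 : ∀ a q → Mod.Unit (a ℕ.* (q ℕ.+ q)) (+ a)
    unit-4aq+1 a q = Mod.unit-≋ h (Mod.≋-reflexive h (ℤ.neg-involutive (+ a))) (Mod.unit-neg h (Mod.unit (+ (4 ℕ.* q)) (Mod.mod (divides (- 1ℤ)
        (trans (alg2 (+ a) (+ (4 ℕ.* q))) (cong (λ z → - 1ℤ * z) (trans (cong (_+_ 1ℤ) (sym (ℤ.pos-* a (4 ℕ.* q)))) (cong (λ z → + suc z)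
            (alg a q)))))))))
      where h = a ℕ.* (q ℕ.+ q)
            alg : ∀ a q → a ℕ.* (4 ℕ.* q) ≡ a ℕ.* (q ℕ.+ q) ℕ.+ a ℕ.* (q ℕ.+ q)
            alg = ℕ-solver.solve-∀
            alg2 : ∀ a q → - a * q - 1ℤ ≡ - 1ℤ * (1ℤ + a * q)
            alg2 = solve-∀

    J₃-1 : ∀ j → Mod.J 1 (+ (3 ℕ.* j ℕ.+ 1)) ≡ Sign.+
    J₃-1 j = trans (J-cong (+ (3 ℕ.* j ℕ.+ 1)) 1ℤ (mod (divides (+ j) (trans (cong (λ z → z + 1ℤ - 1ℤ) (ℤ.pos-* 3 j)) (alg (+ j)))))) J-1
      where open Mod 1
            alg : ∀ j → + 3 * j + 1ℤ - 1ℤ ≡ j * + 3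
            alg = solve-∀

  open Reciprocity

  module OneClass (K : ℕ) (0<K : 0 < K) where
    open Genus K
    open Counting K 0<K

    cong⇒offset : ∀ c → c < M → ∀ y → Cong c y → ∃[ j ] y ≡ j ℕ.* M ℕ.+ c
    cong⇒offset c c<M y (divides (+ j) e) = j , ℤ.+-injective (trans (alg (+ y) (+ c)) (trans (cong (_+ + c) e) (cong (_+ + c) (sym (ℤ.pos-* j M)))))
      where alg : ∀ y c → y ≡ y - c + c
            alg = solve-∀
    cong⇒offset c c<M y (divides ℤ.-[1+ j ] e) = contradiction (ℤ.+-injective eq) (ℕ.<⇒≢ (ℕ.<-≤-trans c<M (ℕ.≤-trans (ℕ.m≤m+n M (j ℕ.* M))
        (ℕ.m≤n+m (M ℕ.+ j ℕ.* M) y))) ∘ sym)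
      where
      alg : ∀ y c → y ≡ y - c + c
      alg = solve-∀
      alg2 : ∀ j m c → - (1ℤ + j) * m + c + (m + j * m) ≡ c
      alg2 = solve-∀
      eq : + (y ℕ.+ (M ℕ.+ j ℕ.* M)) ≡ + c
      eq = trans (cong₂ _+_ (trans (alg (+ y) (+ c)) (cong (_+ + c) e)) (cong (_+_ (+ M)) (ℤ.pos-* j M))) (alg2 (+ j) (+ M) (+ c))

    ψ-4q+1 : ∀ q → Cop (suc ((q ℕ.+ q) ℕ.+ (q ℕ.+ q))) → ψ (suc ((q ℕ.+ q) ℕ.+ (q ℕ.+ q))) ≡ Mod.J (q ℕ.+ q) (+ K)
    ψ-4q+1 q c = trans (ψ-J (q ℕ.+ q)) (J-minus q (+ K) (cop⇒unit (q ℕ.+ q) c))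

    cop-shift : ∀ {c} → Cop c → ∀ y → Cong c y → Cop y
    cop-shift {c} (cop u v b) y (divides q e) = cop (u - v * q) v
        (trans (alg u v (+ M) (+ c) (+ y) q) (trans (cong₂ (λ s t → s + v * t) b (trans (cong (λ z → z - q * + M) e) (ℤ.+-inverseʳ
            (q * + M)))) (cong (_+_ 1ℤ) (ℤ.*-zeroʳ v))))
      where
      alg : ∀ u v m c y q → (u - v * q) * m + v * y ≡ u * m + v * c + v * (y - c - q * m)
      alg = solve-∀

    -- The j-th member of the class is written as 4 e(j) + 1. Modulo such a number -1 has symbol
    -- `+`, so ψ is the symbol of K itself.
    admissible : ∀ c → c < M → Cop c → (e : ℕ → ℕ) → (∀ j → j ℕ.* M ℕ.+ c ≡ suc ((e j ℕ.+ e j) ℕ.+ (e j ℕ.+ e j))) →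
                 (∀ j → Cop (suc ((e j ℕ.+ e j) ℕ.+ (e j ℕ.+ e j))) → Mod.J (e j ℕ.+ e j) (+ K) ≡ Sign.+) → Admissible c
    admissible c c<M cc e shape J≡+ = record
      { coprime = cc
      ; ψ≡+ = λ y p → let j , y≡ = cong⇒offset c c<M y p
                          y≡′ = trans y≡ (shape j)
                          cy = subst Cop y≡′ (cop-shift cc y p)
                      in trans (cong ψ y≡′) (trans (ψ-4q+1 (e j) cy) (J≡+ j cy)) }

    -- The members of the class are 4Kj + 1, which is the modulus of `J-4aq+1` with a = K.
    admissible-1 : Admissible 1
    admissible-1 = admissible 1 (ℕ.≤-trans (s≤s (s≤s z≤n)) (ℕ.*-monoʳ-≤ 4 0<K)) (cop 0ℤ 1ℤ refl) (K ℕ.*_)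
        (λ j → alg K j) (λ j _ → trans (cong (λ h → Mod.J h (+ K)) (sym (ℕ.*-distribˡ-+ K j j))) (J-4aq+1 K j))
      where alg : ∀ K j → j ℕ.* (4 ℕ.* K) ℕ.+ 1 ≡ suc ((K ℕ.* j ℕ.+ K ℕ.* j) ℕ.+ (K ℕ.* j ℕ.+ K ℕ.* j))
            alg = ℕ-solver.solve-∀

  Represented : ℤ → Set
  Represented k = ∃[ p ] ∃[ q ] ∃[ w ] k ≡ p * p + p * q + q * q + w * w

  -- The ternary form with matrix entries A, z, k, cross terms 2t₁ XY and s XZ, has discriminant 4kD - zs² = 3 and represents k.
  assemble : ∀ k z s t₁ A D → 0ℤ ℤ.< k → 0ℤ ℤ.< z → 0ℤ ℤ.< D → A * z ≡ t₁ * t₁ + D → + 4 * k * D ≡ z * s * s + + 3 → Represented k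
  assemble k z s t₁ A D 0<k 0<z 0<D Az≡ kD≡ =
    let p , q , w , e = disc3-good f (positive 0<A 0<α disc3) 0ℤ 0ℤ 1ℤ in p , q , w , trans (sym (alg0 A z k s t₁)) e
    where
    f = tern A z k 0ℤ s (+ 2 * t₁)
    alg0 : ∀ A z k s t₁ → A * 0ℤ * 0ℤ + z * 0ℤ * 0ℤ + k * 1ℤ * 1ℤ + 0ℤ * 0ℤ * 1ℤ + s * 0ℤ * 1ℤ + + 2 * t₁ * 0ℤ * 0ℤ ≡ k
    alg0 = solve-∀
    0<A : 0ℤ ℤ.< A
    0<A = positive-product 0<z (1+≤⇒< (≤-from-diff (t₁ * t₁ + (D - 1ℤ)) (trans (cong (λ x → x - (0ℤ + 1ℤ)) (trans (ℤ.*-comm z A) Az≡))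
        (alg t₁ D)) (+-nonneg {t₁ * t₁} (square-nonneg t₁) (diff-nonneg (<⇒1+≤ 0<D)))))
      where alg : ∀ t D → t * t + D - (0ℤ + 1ℤ) ≡ t * t + (D - 1ℤ)
            alg = solve-∀
    α≡ : + 4 * A * z - + 2 * t₁ * (+ 2 * t₁) ≡ + 4 * D
    α≡ = trans (alg A z t₁) (trans (cong (λ x → + 4 * x - + 4 * (t₁ * t₁)) Az≡) (alg2 t₁ D))
      where alg : ∀ A z t → + 4 * A * z - + 2 * t * (+ 2 * t) ≡ + 4 * (A * z) - + 4 * (t * t)
            alg = solve-∀
            alg2 : ∀ t D → + 4 * (t * t + D) - + 4 * (t * t) ≡ + 4 * D
            alg2 = solve-∀
    0<α : 0ℤ ℤ.< + 4 * A * z - + 2 * t₁ * (+ 2 * t₁)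
    0<α = subst (0ℤ ℤ.<_) (sym α≡) (ℤ.*-monoˡ-<-pos (+ 4) 0<D)
    disc3 : disc f ≡ + 3
    disc3 = trans (alg A z k s t₁) (trans (cong (λ x → k * x - z * s * s) α≡) (trans (alg2 k D (z * s * s)) (trans (cong
        (λ x → x - z * s * s) kD≡) (alg3 (z * s * s)))))
      where alg : ∀ A z k s t → + 4 * A * z * k + 0ℤ * s * (+ 2 * t) - A * 0ℤ * 0ℤ - z * s * s - k * (+ 2 * t) * (+ 2 * t) ≡ k *
              (+ 4 * A * z - + 2 * t * (+ 2 * t)) - z * s * s
            alg = solve-∀
            alg2 : ∀ k D x → k * (+ 4 * D) - x ≡ + 4 * k * D - x
            alg2 = solve-∀
            alg3 : ∀ x → x + + 3 - x ≡ + 3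
            alg3 = solve-∀

  positive-factor : ∀ s z → 0 < s ℕ.* s ℕ.* z → 0 < z
  positive-factor s zero    lt = contradiction (subst (0 <_) (ℕ.*-zeroʳ (s ℕ.* s)) lt) (ℕ.<-irrefl refl)
  positive-factor s (suc z) _  = s≤s z≤n

  -- k = 3k′ with k′ = 3i + 1: here 4k′D = 3y + 1 for y ≡ 4i + 1 (mod 4k′).
  module Multiple (i : ℕ) where
    k′ = suc (3 ℕ.* i)
    open Genus k′
    open Counting k′ (s≤s z≤n)
    open OneClass k′ (s≤s z≤n)

    r : ℕ
    r = 4 ℕ.* i ℕ.+ 1

    D : ℕ → ℕ
    D j = 3 ℕ.* j ℕ.+ 1

    e : ℕ → ℕ
    e j = k′ ℕ.* j ℕ.+ i

    shape : ∀ j → j ℕ.* M ℕ.+ r ≡ suc ((e j ℕ.+ e j) ℕ.+ (e j ℕ.+ e j))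
    shape j = alg i j
      where alg : ∀ i j → j ℕ.* (4 ℕ.* suc (3 ℕ.* i)) ℕ.+ (4 ℕ.* i ℕ.+ 1) ≡ suc (((suc (3 ℕ.* i) ℕ.* j ℕ.+ i) ℕ.+ (suc
              (3 ℕ.* i) ℕ.* j ℕ.+ i)) ℕ.+ ((suc (3 ℕ.* i) ℕ.* j ℕ.+ i) ℕ.+ (suc (3 ℕ.* i) ℕ.* j ℕ.+ i)))
            alg = ℕ-solver.solve-∀

    4k′D : ∀ j → 4 ℕ.* k′ ℕ.* D j ≡ 3 ℕ.* (j ℕ.* M ℕ.+ r) ℕ.+ 1
    4k′D j = alg i j
      where alg : ∀ i j → 4 ℕ.* suc (3 ℕ.* i) ℕ.* (3 ℕ.* j ℕ.+ 1) ≡ 3 ℕ.* (j ℕ.* (4 ℕ.* suc (3 ℕ.* i)) ℕ.+ (4 ℕ.* i ℕ.+ 1)) ℕ.+ 1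
            alg = ℕ-solver.solve-∀

    -- For y in the class 3y = 4k′D - 1, so the symbol of k′ modulo 3y is `+`; modulo 3 it is `+`
    -- because k′ ≡ 1. The quotient is the symbol modulo y.
    J≡+ : ∀ j → Mod.J (e j ℕ.+ e j) (+ k′) ≡ Sign.+
    J≡+ j = trans (trans (cong (_· Mod.J h (+ k′)) (sym J₃)) (sym (J-modulus-* u))) (J-4aq-1 k′ (D j) half sh)
      where
      h = e j ℕ.+ e j
      open Composite h 1
      sh : suc half ≡ k′ ℕ.* (D j ℕ.+ D j)
      sh = alg i j
        where alg : ∀ i j → suc (1 ℕ.* suc (((suc (3 ℕ.* i) ℕ.* j ℕ.+ i) ℕ.+ (suc (3 ℕ.* i) ℕ.* j ℕ.+ i)) ℕ.+ ((suc
                (3 ℕ.* i) ℕ.* j ℕ.+ i) ℕ.+ (suc (3 ℕ.* i) ℕ.* j ℕ.+ i))) ℕ.+ ((suc (3 ℕ.* i) ℕ.* j ℕ.+ i) ℕ.+ (suc (3 ℕ.* i) ℕ.* j ℕ.+ i)))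
                      ≡ suc (3 ℕ.* i) ℕ.* ((3 ℕ.* j ℕ.+ 1) ℕ.+ (3 ℕ.* j ℕ.+ 1))
              alg = ℕ-solver.solve-∀
      J₃ : Mod.J 1 (+ k′) ≡ Sign.+
      J₃ = trans (cong (λ z → Mod.J 1 (+ z)) (ℕ.+-comm 1 (3 ℕ.* i))) (J₃-1 i)
      u : Mod.Unit half (+ k′)
      u = unit-4aq-1 k′ (D j) half sh

    cop-r : Cop r
    cop-r = cop 1ℤ (- (+ 3)) (trans (cong₂ (λ a b → 1ℤ * a + - (+ 3) * b) (trans (ℤ.pos-* 4 k′) (cong (λ z → + 4 * (1ℤ + z))
        (ℤ.pos-* 3 i))) (cong (_+ 1ℤ) (ℤ.pos-* 4 i))) (alg (+ i)))
      where alg : ∀ i → 1ℤ * (+ 4 * (1ℤ + + 3 * i)) + - (+ 3) * (+ 4 * i + 1ℤ) ≡ 1ℤ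
            alg = solve-∀

    r<M : r < M
    r<M = ℕ.≤-trans (ℕ.m≤m+n _ (8 ℕ.* i ℕ.+ 2)) (ℕ.≤-reflexive (alg i))
      where alg : ∀ i → suc (4 ℕ.* i ℕ.+ 1) ℕ.+ (8 ℕ.* i ℕ.+ 2) ≡ 4 ℕ.* suc (3 ℕ.* i)
            alg = ℕ-solver.solve-∀

    admissible-r : Admissible r
    admissible-r = admissible r r<M cop-r e shape (λ j _ → J≡+ j)

    represented : Represented (+ (3 ℕ.* k′))
    represented = let s , z , t , p , d = genus admissible-1 admissible-r
                      j , y≡ = cong⇒offset r r<M (s ℕ.* s ℕ.* z) p
                  in build s z t d j y≡
      where
      build : ∀ s z t → + z ∣ t * t + + k′ → ∀ j → s ℕ.* s ℕ.* z ≡ j ℕ.* M ℕ.+ r → Represented (+ (3 ℕ.* k′))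
      -- Multiplying t² + k′ = qz by 4D² and inserting 4k′D = 3zs² + 1 gives (2Dt)² + D = z(4D²q -
      -- 3Ds²). The same relation times 3 is the discriminant condition with 3s as coefficient.
      build s z t (divides q e) j y≡ = assemble (+ (3 ℕ.* k′)) (+ z) (+ 3 * + s) (+ 2 * + D j * t)
          (+ 4 * + D j * + D j * q - + 3 * + D j * (+ s * + s)) (+ D j)
          (ℤ.+<+ (s≤s z≤n)) (ℤ.+<+ 0<z) (ℤ.+<+ (ℕ.m≤n+m 1 (3 ℕ.* j)))
          (trans (alg (+ D j) q (+ z) (+ s)) (trans (cong₂ (λ x y → + 4 * + D j * + D j * x - + 3 * + D j * y) (sym e) (sym y-ℤ))
            (trans (alg2 (+ D j) t (+ k′) Y) (trans (cong (λ x → + 2 * + D j * t * (+ 2 * + D j * t) + + D j * (x - + 3 * Y)) kD) (alg3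
                (+ 2 * + D j * t) (+ D j) Y)))))
          (trans (cong (λ x → + 4 * x * + D j) (ℤ.pos-* 3 k′)) (trans (alg4 (+ k′) (+ D j)) (trans (cong (_*_ (+ 3)) kD) (trans (cong
              (λ x → + 3 * (+ 3 * x + 1ℤ)) y-ℤ) (alg5 (+ s) (+ z))))))
        where
        Y = + (s ℕ.* s ℕ.* z)
        y-ℤ : Y ≡ + s * + s * + z
        y-ℤ = trans (ℤ.pos-* (s ℕ.* s) z) (cong (_* + z) (ℤ.pos-* s s))
        0<z : 0 < z
        0<z = positive-factor s z (subst (0 <_) (sym y≡) (ℕ.≤-trans (ℕ.m≤n+m 1 (4 ℕ.* i)) (ℕ.m≤n+m r (j ℕ.* M))))
        kD : + 4 * + k′ * + D j ≡ + 3 * Y + 1ℤ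
        kD = trans (sym (trans (ℤ.pos-* (4 ℕ.* k′) (D j)) (cong (_* + D j) (ℤ.pos-* 4 k′))))
               (trans (cong +_ (trans (4k′D j) (cong (λ y → 3 ℕ.* y ℕ.+ 1) (sym y≡)))) (cong (_+ 1ℤ) (ℤ.pos-* 3 (s ℕ.* s ℕ.* z))))
        alg : ∀ D q z s → (+ 4 * D * D * q - + 3 * D * (s * s)) * z ≡ + 4 * D * D * (q * z) - + 3 * D * (s * s * z)
        alg = solve-∀
        alg2 : ∀ D t k Y → + 4 * D * D * (t * t + k) - + 3 * D * Y ≡ + 2 * D * t * (+ 2 * D * t) + D * (+ 4 * k * D - + 3 * Y)
        alg2 = solve-∀
        alg3 : ∀ x D Y → x * x + D * (+ 3 * Y + 1ℤ - + 3 * Y) ≡ x * x + D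
        alg3 = solve-∀
        alg4 : ∀ k D → + 4 * (+ 3 * k) * D ≡ + 3 * (+ 4 * k * D)
        alg4 = solve-∀
        alg5 : ∀ s z → + 3 * (+ 3 * (s * s * z) + 1ℤ) ≡ z * (+ 3 * s) * (+ 3 * s) + + 3
        alg5 = solve-∀

  -- k = k₀ + 1 prime to 3: here 4kD = y + 3 for y ≡ 4k - 3 (mod 12k), and ψ y is the symbol of D modulo y, which two
  -- applications of the case 4Dq ± 1 (through w = (8D + 1) / 3) reduce to the symbol of D modulo 3.
  module NonMultiple (k₀ : ℕ) (¬3∣k : ¬ 3 D.∣ suc k₀) where
    k = suc k₀
    K = 3 ℕ.* k

    open Genus K
    open Counting K (s≤s z≤n)
    open OneClass K (s≤s z≤n)

    r : ℕ
    r = 4 ℕ.* k₀ ℕ.+ 1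

    D : ℕ → ℕ
    D j = 3 ℕ.* j ℕ.+ 1

    e : ℕ → ℕ
    e j = 3 ℕ.* j ℕ.* k₀ ℕ.+ k₀ ℕ.+ 3 ℕ.* j

    shape : ∀ j → j ℕ.* M ℕ.+ r ≡ suc ((e j ℕ.+ e j) ℕ.+ (e j ℕ.+ e j))
    shape j = alg k₀ j
      where alg : ∀ k j → j ℕ.* (4 ℕ.* (3 ℕ.* suc k)) ℕ.+ (4 ℕ.* k ℕ.+ 1) ≡ suc (((3 ℕ.* j ℕ.* k ℕ.+ k ℕ.+ 3 ℕ.* j) ℕ.+
              (3 ℕ.* j ℕ.* k ℕ.+ k ℕ.+ 3 ℕ.* j)) ℕ.+ ((3 ℕ.* j ℕ.* k ℕ.+ k ℕ.+ 3 ℕ.* j) ℕ.+ (3 ℕ.* j ℕ.* k ℕ.+ k ℕ.+ 3 ℕ.* j)))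
            alg = ℕ-solver.solve-∀

    4kD : ∀ j → 4 ℕ.* k ℕ.* D j ≡ (j ℕ.* M ℕ.+ r) ℕ.+ 3
    4kD j = alg k₀ j
      where alg : ∀ k j → 4 ℕ.* suc k ℕ.* (3 ℕ.* j ℕ.+ 1) ≡ (j ℕ.* (4 ℕ.* (3 ℕ.* suc k)) ℕ.+ (4 ℕ.* k ℕ.+ 1)) ℕ.+ 3
            alg = ℕ-solver.solve-∀

    module _ (j : ℕ) where
      h gw : ℕ
      h = e j ℕ.+ e j
      gw = 4 ℕ.* j ℕ.+ 1

      -- Here 3w = 8D + 1, so D has symbol `+` modulo 3w; modulo 3 it has symbol `+` because D ≡ 1.
      J-D-w : Mod.J gw (+ D j) ≡ Sign.+
      J-D-w = trans (sym (Sign.*-identityʳ (Mod.J gw (+ D j)))) (trans (cong (Mod.J gw (+ D j) ·_) (sym (J₃-1 j)))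
          (trans (sym (J-modulus-* (subst (λ h → Mod.Unit h (+ D j)) (sym half≡) (unit-4aq+1 (D j) 2))))
            (trans (cong (λ h → Mod.J h (+ D j)) half≡) (J-4aq+1 (D j) 2))))
        where
        open Composite 1 gw
        half≡ : half ≡ D j ℕ.* 4
        half≡ = alg j
          where alg : ∀ j → (4 ℕ.* j ℕ.+ 1) ℕ.* 3 ℕ.+ 1 ≡ (3 ℕ.* j ℕ.+ 1) ℕ.* 4
                alg = ℕ-solver.solve-∀

      -- The number w is chosen so that wy ≡ -1 (mod 4D): modulo D one has 3w ≡ 1 and y ≡ -3, and
      -- modulo 4 one has w ≡ 3 and y ≡ 1.
      J-D-y : Mod.J h (+ D j) ≡ Sign.+
      J-D-y = trans (cong (_· Mod.J h (+ D j)) (sym J-D-w)) (trans (sym (J-modulus-* (unit-4aq-1 (D j) q half sh))) (J-4aq-1 (D j) q half sh))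
        where
        open Composite h gw
        q = 8 ℕ.* j ℕ.* k₀ ℕ.+ 3 ℕ.* k₀ ℕ.+ 8 ℕ.* j ℕ.+ 1
        sh : suc half ≡ D j ℕ.* (q ℕ.+ q)
        sh = alg k₀ j
          where alg : ∀ k j → suc ((4 ℕ.* j ℕ.+ 1) ℕ.* suc (((3 ℕ.* j ℕ.* k ℕ.+ k ℕ.+ 3 ℕ.* j) ℕ.+ (3 ℕ.* j ℕ.* k ℕ.+ k ℕ.+ 3 ℕ.* j)) ℕ.+
                  ((3 ℕ.* j ℕ.* k ℕ.+ k ℕ.+ 3 ℕ.* j) ℕ.+ (3 ℕ.* j ℕ.* k ℕ.+ k ℕ.+ 3 ℕ.* j)))
                        ℕ.+ ((3 ℕ.* j ℕ.* k ℕ.+ k ℕ.+ 3 ℕ.* j) ℕ.+ (3 ℕ.* j ℕ.* k ℕ.+ k ℕ.+ 3 ℕ.* j)))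
                      ≡ (3 ℕ.* j ℕ.+ 1) ℕ.* ((8 ℕ.* j ℕ.* k ℕ.+ 3 ℕ.* k ℕ.+ 8 ℕ.* j ℕ.+ 1) ℕ.+ (8 ℕ.* j ℕ.* k ℕ.+ 3 ℕ.* k ℕ.+ 8 ℕ.* j ℕ.+ 1))
                alg = ℕ-solver.solve-∀

      -- Since 4kD ≡ 3 (mod y), the symbols of k and D multiply to that of 3. So 3k has the same
      -- symbol as D.
      J≡+ : Cop (suc (h ℕ.+ h)) → Mod.J h (+ K) ≡ Sign.+
      J≡+ cy = trans (cong J (ℤ.pos-* 3 k)) (trans (J-* u3 uk) (trans (Sign.*-comm (J (+ 3)) (J (+ k)))
                 (trans (sign-swap (J (+ k)) (J (+ D j)) (J (+ 3)) Sign.+ kD3) (trans (Sign.*-identityʳ (J (+ D j))) J-D-y))))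
        where
        open Mod h
        uK : Unit (+ 3 * + k)
        uK = unit-≋ (≋-reflexive (trans (ℤ.neg-involutive (+ K)) (ℤ.pos-* 3 k))) (unit-neg (cop⇒unit h cy))
        u3 : Unit (+ 3)
        u3 = unit-factor (+ 3) (+ k) uK
        uk : Unit (+ k)
        uk = unit-factorʳ (+ 3) (+ k) uK
        4kD≋3 : + 2 * + 2 * (+ k * + D j) ≋ + 3
        4kD≋3 = mod (divides 1ℤ (trans (cong (λ z → z - + 3) eq) (alg (+ n))))
          where
          alg : ∀ y → y + + 3 - + 3 ≡ 1ℤ * y
          alg = solve-∀
          alg2 : ∀ k d → + 2 * + 2 * (k * d) ≡ + 4 * k * d
          alg2 = solve-∀
          eq : + 2 * + 2 * (+ k * + D j) ≡ + n + + 3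
          eq = trans (alg2 (+ k) (+ D j)) (trans (sym (trans (ℤ.pos-* (4 ℕ.* k) (D j)) (cong (_* + D j) (ℤ.pos-* 4 k)))) (cong +_ (trans
              (4kD j) (cong (ℕ._+ 3) (shape j)))))
        u4kD : Unit (+ 2 * + 2 * (+ k * + D j))
        u4kD = unit-≋ (≋-sym 4kD≋3) u3
        u2 : Unit (+ 2)
        u2 = unit-factor (+ 2) (+ 2) (unit-factor (+ 2 * + 2) (+ k * + D j) u4kD)
        ukD : Unit (+ k * + D j)
        ukD = unit-factorʳ (+ 2 * + 2) (+ k * + D j) u4kD
        uD : Unit (+ D j)
        uD = unit-factorʳ (+ k) (+ D j) ukD
        kD3 : J (+ k) · J (+ D j) ≡ J (+ 3) · Sign.+
        kD3 = trans (sym (J-* uk uD)) (trans (cong (_· J (+ k * + D j)) (sym (J-square u2))) (trans (sym (J-* (unit-* u2 u2) ukD))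
                (trans (J-cong (+ 2 * + 2 * (+ k * + D j)) (+ 3) 4kD≋3) (sym (Sign.*-identityʳ (J (+ 3)))))))

    M-ℤ : + M ≡ + 12 * (1ℤ + + k₀)
    M-ℤ = trans (ℤ.pos-* 4 K) (trans (cong (_*_ (+ 4)) (ℤ.pos-* 3 k)) (alg (+ k)))
      where alg : ∀ k → + 4 * (+ 3 * k) ≡ + 12 * k
            alg = solve-∀

    r-ℤ : + r ≡ + 4 * + k₀ + 1ℤ
    r-ℤ = cong (_+ 1ℤ) (ℤ.pos-* 4 k₀)

    -- M = 3r + 9, and r² ≡ ±2r - 1 (mod 9).
    cop-r : Cop r
    cop-r = by (k₀ ℕ.% 3) (ℕ.m%n<n k₀ 3) (ℕ.m≡m%n+[m/n]*n k₀ 3)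
      where
      i = k₀ ℕ./ 3
      I = + i
      by : ∀ ρ → ρ < 3 → k₀ ≡ ρ ℕ.+ i ℕ.* 3 → Cop r
      by 0 _ eq = cop (+ 16 * I * I) (+ 2 - + r - + 48 * I * I)
          (trans (cong₂ (λ m r → + 16 * I * I * m + (+ 2 - r - + 48 * I * I) * r) M-ℤ r-ℤ)
            (trans (cong (λ k → + 16 * I * I * (+ 12 * (1ℤ + k)) + (+ 2 - (+ 4 * k + 1ℤ) - + 48 * I * I) * (+ 4 * k + 1ℤ)) (trans
                (cong +_ eq) (ℤ.pos-* i 3))) (alg I)))
        where alg : ∀ I → + 16 * I * I * (+ 12 * (1ℤ + I * + 3)) + (+ 2 - (+ 4 * (I * + 3) + 1ℤ) - + 48 * I * I) * (+ 4 * (I * + 3) + 1ℤ) ≡ 1ℤ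
              alg = solve-∀
      by 1 _ eq = cop (+ 4 * (+ 2 * I + 1ℤ) * (+ 2 * I + 1ℤ)) (- (+ 2) - + r - + 12 * (+ 2 * I + 1ℤ) * (+ 2 * I + 1ℤ))
          (trans (cong₂ (λ m r → + 4 * (+ 2 * I + 1ℤ) * (+ 2 * I + 1ℤ) * m + (- (+ 2) - r - + 12 * (+ 2 * I + 1ℤ) * (+ 2 * I + 1ℤ)) * r) M-ℤ r-ℤ)
            (trans (cong (λ k → + 4 * (+ 2 * I + 1ℤ) * (+ 2 * I + 1ℤ) * (+ 12 * (1ℤ + k)) + (- (+ 2) - (+ 4 * k + 1ℤ) - + 12 *
                (+ 2 * I + 1ℤ) * (+ 2 * I + 1ℤ)) * (+ 4 * k + 1ℤ)) (trans (cong +_ eq) (cong (_+_ 1ℤ) (ℤ.pos-* i 3)))) (alg I)))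
        where alg : ∀ I → + 4 * (+ 2 * I + 1ℤ) * (+ 2 * I + 1ℤ) * (+ 12 * (1ℤ + (1ℤ + I * + 3))) + (- (+ 2) - (+ 4 *
                (1ℤ + I * + 3) + 1ℤ) - + 12 * (+ 2 * I + 1ℤ) * (+ 2 * I + 1ℤ)) * (+ 4 * (1ℤ + I * + 3) + 1ℤ) ≡ 1ℤ
              alg = solve-∀
      by 2 _ eq = contradiction (D.divides (suc i) (trans (cong suc eq) refl)) ¬3∣k
      by (suc (suc (suc ρ))) (s≤s (s≤s (s≤s ()))) _

    r<M : r < M
    r<M = ℕ.≤-trans (ℕ.m≤m+n _ (8 ℕ.* k₀ ℕ.+ 10)) (ℕ.≤-reflexive (alg k₀))
      where alg : ∀ k → suc (4 ℕ.* k ℕ.+ 1) ℕ.+ (8 ℕ.* k ℕ.+ 10) ≡ 4 ℕ.* (3 ℕ.* suc k)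
            alg = ℕ-solver.solve-∀

    admissible-r : Admissible r
    admissible-r = admissible r r<M cop-r e shape (λ j c → J≡+ j c)

    represented : Represented (+ k)
    represented = let s , z , t , p , d = genus admissible-1 admissible-r
                      j , y≡ = cong⇒offset r r<M (s ℕ.* s ℕ.* z) p
                  in build s z t d j y≡ (cop-factor z (s ℕ.* s) (subst Cop (ℕ.*-comm (s ℕ.* s) z) (cop-shift cop-r (s ℕ.* s ℕ.* z) p)))
      where
      build : ∀ s z t → + z ∣ t * t + + K → ∀ j → s ℕ.* s ℕ.* z ≡ j ℕ.* M ℕ.+ r → Cop z → Represented (+ k)
      build s z t (divides q ez) j y≡ (cop u v b) = assemble (+ k) Z σ (t * i) a′ Dj
          (ℤ.+<+ (s≤s z≤n)) (ℤ.+<+ 0<z) (ℤ.+<+ (ℕ.m≤n+m 1 (3 ℕ.* j)))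
          (trans (alg q Z σ (+ k) i v Dj) (trans (cong₂ (λ x y → i * i * x + Dj * y * (1ℤ + + 2 * + k * i) + i * i * + k * (σ * σ * Z))
              (trans (sym ez) (cong (_+_ (t * t)) (ℤ.pos-* 3 k))) vZ)
            (trans (alg2 i t (+ k) Dj (σ * σ * Z)) (trans (cong (λ x → t * i * (t * i) + Dj - i * i * + k * (x - + 3 - σ * σ * Z)) kD)
                (alg3 (t * i * (t * i) + Dj) (i * i * + k) (σ * σ * Z))))))
          (trans kD (alg4 Z σ))
        where
        Z = + z
        σ = + s
        Dj = + D j
        -- The identity 12ku + vz = 1 makes i an inverse of 2k modulo z. Then (ti)² ≡ -3ki², while D
        -- ≡ (2ki)² D = ki² · 4kD ≡ 3ki², so z divides (ti)² + D; `a′` is the quotient.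
        i = + 6 * u
        a′ = i * i * q + Dj * v * (1ℤ + + 2 * + k * i) + i * i * + k * (σ * σ)
        y-ℤ : + (s ℕ.* s ℕ.* z) ≡ σ * σ * Z
        y-ℤ = trans (ℤ.pos-* (s ℕ.* s) z) (cong (_* Z) (ℤ.pos-* s s))
        0<z : 0 < z
        0<z = positive-factor s z (subst (0 <_) (sym y≡) (ℕ.≤-trans (ℕ.m≤n+m 1 (4 ℕ.* k₀)) (ℕ.m≤n+m r (j ℕ.* M))))
        kD : + 4 * + k * Dj ≡ σ * σ * Z + + 3
        kD = trans (sym (trans (ℤ.pos-* (4 ℕ.* k) (D j)) (cong (_* Dj) (ℤ.pos-* 4 k))))
               (trans (cong +_ (trans (4kD j) (cong (ℕ._+ 3) (sym y≡)))) (cong (_+ + 3) y-ℤ))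
        vZ : v * Z ≡ 1ℤ - + 2 * + k * i
        vZ = trans (alg0 (u * + M) (v * Z)) (trans (cong₂ (λ x y → x - u * y) b M-ℤ) (alg1 u (+ k)))
          where alg0 : ∀ x y → y ≡ x + y - x
                alg0 = solve-∀
                alg1 : ∀ u k → 1ℤ - u * (+ 12 * k) ≡ 1ℤ - + 2 * k * (+ 6 * u)
                alg1 = solve-∀
        alg : ∀ q Z σ k i v D → (i * i * q + D * v * (1ℤ + + 2 * k * i) + i * i * k * (σ * σ)) * Z ≡ i * i * (q * Z) + D * (v * Z) *
            (1ℤ + + 2 * k * i) + i * i * k * (σ * σ * Z)
        alg = solve-∀
        alg2 : ∀ i t k D Y → i * i * (t * t + + 3 * k) + D * (1ℤ - + 2 * k * i) * (1ℤ + + 2 * k * i) + i * i * k * Y ≡ t * i *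
            (t * i) + D - i * i * k * (+ 4 * k * D - + 3 - Y)
        alg2 = solve-∀
        alg3 : ∀ x c Y → x - c * (Y + + 3 - + 3 - Y) ≡ x
        alg3 = solve-∀
        alg4 : ∀ Z σ → σ * σ * Z + + 3 ≡ Z * σ * σ + + 3
        alg4 = solve-∀

  -- Sums of four polygonal numbers

  Parity : ℤ → Set
  Parity x = ∃[ u ] (x ≡ + 2 * u ⊎ x ≡ + 2 * u + 1ℤ)

  parity : ∀ x → Parity x
  parity x = by (x %ℕ 2) (n%ℕd<d x 2) (a≡a%ℕn+[a/ℕn]*n x 2)
    where
    alg : ∀ q → 0ℤ + q * + 2 ≡ + 2 * q
    alg = solve-∀
    alg1 : ∀ q → 1ℤ + q * + 2 ≡ + 2 * q + 1ℤ
    alg1 = solve-∀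
    by : ∀ r → r < 2 → x ≡ + r + (x /ℕ 2) * + 2 → Parity x
    by 0 _ e = x /ℕ 2 , inj₁ (trans e (alg (x /ℕ 2)))
    by 1 _ e = x /ℕ 2 , inj₂ (trans e (alg1 (x /ℕ 2)))
    by (suc (suc _)) (s≤s (s≤s ())) _

  Residue₃ : ℤ → Set
  Residue₃ x = ∃[ u ] ∃[ ρ ] (Small ρ × x ≡ + 3 * u + ρ)

  residue₃ : ∀ x → Residue₃ x
  residue₃ x = by (x %ℕ 3) (n%ℕd<d x 3) (a≡a%ℕn+[a/ℕn]*n x 3)
    where
    q = x /ℕ 3
    alg : ∀ q → 0ℤ + q * + 3 ≡ + 3 * q + 0ℤ
    alg = solve-∀
    alg1 : ∀ q → 1ℤ + q * + 3 ≡ + 3 * q + 1ℤ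
    alg1 = solve-∀
    alg2 : ∀ q → + 2 + q * + 3 ≡ + 3 * (q + 1ℤ) + - 1ℤ
    alg2 = solve-∀
    by : ∀ r → r < 3 → x ≡ + r + q * + 3 → Residue₃ x
    by 0 _ e = q , 0ℤ , zero′ , trans e (alg q)
    by 1 _ e = q , 1ℤ , plus , trans e (alg1 q)
    by 2 _ e = q + 1ℤ , - 1ℤ , minus , trans e (alg2 q)
    by (suc (suc (suc _))) (s≤s (s≤s (s≤s ()))) _

  not-multiple : ∀ n k → suc k < n → + n ∣ + suc k → ∀ {A : Set} → A
  not-multiple n k lt d = contradiction (small-multiple n (+ suc k) d lt) (λ ())

  -- A sum of three squares divisible by 3 has no or all terms prime to 3.
  small-match : ∀ {ρ σ τ} → Small ρ → Small σ → Small τ → + 3 ∣ ρ * ρ + σ * σ + τ * τ → ρ ≡ σ ⊎ ρ ≡ - σ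
  small-match zero′ zero′ _     _ = inj₁ refl
  small-match plus  plus  _     _ = inj₁ refl
  small-match minus minus _     _ = inj₁ refl
  small-match plus  minus _     _ = inj₂ refl
  small-match minus plus  _     _ = inj₂ refl
  small-match zero′ plus  zero′ d = not-multiple 3 0 (s≤s (s≤s z≤n)) d
  small-match zero′ plus  plus  d = not-multiple 3 1 (s≤s (s≤s (s≤s z≤n))) d
  small-match zero′ plus  minus d = not-multiple 3 1 (s≤s (s≤s (s≤s z≤n))) d
  small-match zero′ minus zero′ d = not-multiple 3 0 (s≤s (s≤s z≤n)) d
  small-match zero′ minus plus  d = not-multiple 3 1 (s≤s (s≤s (s≤s z≤n))) d
  small-match zero′ minus minus d = not-multiple 3 1 (s≤s (s≤s (s≤s z≤n))) d
  small-match plus  zero′ zero′ d = not-multiple 3 0 (s≤s (s≤s z≤n)) d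
  small-match plus  zero′ plus  d = not-multiple 3 1 (s≤s (s≤s (s≤s z≤n))) d
  small-match plus  zero′ minus d = not-multiple 3 1 (s≤s (s≤s (s≤s z≤n))) d
  small-match minus zero′ zero′ d = not-multiple 3 0 (s≤s (s≤s z≤n)) d
  small-match minus zero′ plus  d = not-multiple 3 1 (s≤s (s≤s (s≤s z≤n))) d
  small-match minus zero′ minus d = not-multiple 3 1 (s≤s (s≤s (s≤s z≤n))) d

  match-sign : ∀ b w δ → + 3 ∣ b * b + w * w + δ * δ → + 3 ∣ b - w ⊎ + 3 ∣ b + w
  match-sign b w δ d with residue₃ b | residue₃ w | residue₃ δ
  ... | u , ρ , sρ , refl | v , σ , sσ , refl | x , τ , sτ , refl =
    [ (λ { refl → inj₁ (divides (u - v) (alg₁ u v ρ)) }) , (λ { refl → inj₂ (divides (u + v) (alg₂ u v σ)) }) ]′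
    (small-match sρ sσ sτ (∣-resp (alg u v x ρ σ τ) (∣m∣n⇒∣m+n d (∣n⇒∣m*n Y ∣-refl))))
    where
    Y = - (+ 3 * u * u + + 2 * u * ρ + + 3 * v * v + + 2 * v * σ + + 3 * x * x + + 2 * x * τ)
    alg : ∀ u v x ρ σ τ → (+ 3 * u + ρ) * (+ 3 * u + ρ) + (+ 3 * v + σ) * (+ 3 * v + σ) + (+ 3 * x + τ) * (+ 3 * x + τ)
            + - (+ 3 * u * u + + 2 * u * ρ + + 3 * v * v + + 2 * v * σ + + 3 * x * x + + 2 * x * τ) * + 3 ≡ ρ * ρ + σ * σ + τ * τ
    alg = solve-∀
    alg₁ : ∀ u v ρ → + 3 * u + ρ - (+ 3 * v + ρ) ≡ (u - v) * + 3
    alg₁ = solve-∀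
    alg₂ : ∀ u v σ → + 3 * u + - σ + (+ 3 * v + σ) ≡ (u + v) * + 3
    alg₂ = solve-∀

  -- A 3-adic condition sufficient for n > 0 to be represented by p² + pq + q² + w².
  Favourable : ℤ → Set
  Favourable n = ¬ + 3 ∣ n ⊎ ∃[ i ] n ≡ + 3 * (+ 3 * i + 1ℤ)

  favourable⇒represented : ∀ k → 0ℤ ℤ.< k → Favourable k → Represented k
  favourable⇒represented (+ zero)  lt _ = contradiction lt (ℤ.<-irrefl refl)
  favourable⇒represented (+ suc k) _ (inj₁ ¬d) = NonMultiple.represented k (λ d → ¬d (∣ᵤ⇒∣ d))
  favourable⇒represented (+ suc k) _ (inj₂ (+ i , e)) = subst Represented
    (sym (trans e (trans (cong (_*_ (+ 3)) (trans (ℤ.+-comm (+ 3 * + i) 1ℤ) (cong (_+_ 1ℤ) (sym (ℤ.pos-* 3 i))))) (sym (ℤ.pos-* 3 (suc (3 ℕ.* i)))))))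
    (Multiple.represented i)
  favourable⇒represented (+ suc k) _ (inj₂ (ℤ.-[1+ i ] , e)) = contradiction
    (+-nonneg {+ suc k} {+ 9 * + i} (ℤ.+≤+ z≤n) (scale-nonneg 9 {+ i} (ℤ.+≤+ z≤n)))
    (λ nn → negative-absurd 5 nn (trans (cong (λ z → z + + 9 * + i + + 6) e) (alg (+ i))))
    where alg : ∀ i → + 3 * (+ 3 * - (1ℤ + i) + 1ℤ) + + 9 * i + + 6 ≡ 0ℤ
          alg = solve-∀

  -- From p² + pq + q² + w² to w² + 4(p² + pq + q²)

  Normal : ℤ → Set
  Normal n = ∃[ w ] ∃[ p ] ∃[ q ] n ≡ w * w + + 4 * (p * p + p * q + q * q)

  normal-4k : ∀ k → Represented k → Normal (+ 4 * k)
  normal-4k k (p , q , w , e) = + 2 * w , p , q , trans (cong (_*_ (+ 4)) e) (alg p q w)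
    where alg : ∀ p q w → + 4 * (p * p + p * q + q * q + w * w) ≡ + 2 * w * (+ 2 * w) + + 4 * (p * p + p * q + q * q)
          alg = solve-∀

  -- One of p, q and p + q is even, and completing the square with its half removes the mixed term.
  eisenstein : ∀ p q → ∃[ y ] ∃[ z ] p * p + p * q + q * q ≡ y * y + + 3 * (z * z)
  eisenstein p q with parity p | parity q
  ... | _ | v , inj₁ refl = p + v , v , alg p v
    where alg : ∀ p v → p * p + p * (+ 2 * v) + + 2 * v * (+ 2 * v) ≡ (p + v) * (p + v) + + 3 * (v * v)
          alg = solve-∀
  ... | u , inj₁ refl | _ , inj₂ _ = q + u , u , alg q u
    where alg : ∀ q u → + 2 * u * (+ 2 * u) + + 2 * u * q + q * q ≡ (q + u) * (q + u) + + 3 * (u * u)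
          alg = solve-∀
  ... | u , inj₂ refl | v , inj₂ refl = u - v , u + v + 1ℤ , alg u v
    where alg : ∀ u v → (+ 2 * u + 1ℤ) * (+ 2 * u + 1ℤ) + (+ 2 * u + 1ℤ) * (+ 2 * v + 1ℤ) + (+ 2 * v + 1ℤ) * (+ 2 * v + 1ℤ) ≡ (u - v) *
            (u - v) + + 3 * ((u + v + 1ℤ) * (u + v + 1ℤ))
          alg = solve-∀

  -- In y² + 3z² + w², if z has the parity of y or of w, that square together with 3z² is four times
  -- a value of p² + pq + q². Otherwise y and w have equal parity, opposite to z, and the sum is 2
  -- or 3 modulo 4.
  normal-odd : ∀ m → Represented (+ 4 * m + 1ℤ) → Normal (+ 4 * m + 1ℤ)
  normal-odd m (p , q , w , e) = from (eisenstein p q)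
    where
    from : ∃[ y ] ∃[ z ] p * p + p * q + q * q ≡ y * y + + 3 * (z * z) → Normal (+ 4 * m + 1ℤ)
    from (y , z , e′) = go (parity w) (parity y) (parity z)
      where
      n≡ : + 4 * m + 1ℤ ≡ y * y + + 3 * (z * z) + w * w
      n≡ = trans e (cong (_+ w * w) e′)
      same-y : ∀ u v ρ → y ≡ + 2 * u + ρ → z ≡ + 2 * v + ρ → Normal (+ 4 * m + 1ℤ)
      same-y u v ρ refl refl = w , + 2 * v + ρ , u - v , trans n≡ (alg u v ρ w)
        where alg : ∀ u v ρ w → (+ 2 * u + ρ) * (+ 2 * u + ρ) + + 3 * ((+ 2 * v + ρ) * (+ 2 * v + ρ)) + w * w ≡ w * w + + 4 *
                ((+ 2 * v + ρ) * (+ 2 * v + ρ) + (+ 2 * v + ρ) * (u - v) + (u - v) * (u - v))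
              alg = solve-∀
      same-w : ∀ u v ρ → w ≡ + 2 * u + ρ → z ≡ + 2 * v + ρ → Normal (+ 4 * m + 1ℤ)
      same-w u v ρ refl refl = y , + 2 * v + ρ , u - v , trans n≡ (alg u v ρ y)
        where alg : ∀ u v ρ y → y * y + + 3 * ((+ 2 * v + ρ) * (+ 2 * v + ρ)) + (+ 2 * u + ρ) * (+ 2 * u + ρ) ≡ y * y + + 4 *
                ((+ 2 * v + ρ) * (+ 2 * v + ρ) + (+ 2 * v + ρ) * (u - v) + (u - v) * (u - v))
              alg = solve-∀
      +0 : ∀ {x} u → x ≡ + 2 * u → x ≡ + 2 * u + 0ℤ
      +0 u e = trans e (sym (ℤ.+-identityʳ (+ 2 * u)))
      go : Parity w → Parity y → Parity z → Normal (+ 4 * m + 1ℤ)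
      go _ (u , inj₁ ey) (v , inj₁ ez) = same-y u v 0ℤ (+0 u ey) (+0 v ez)
      go _ (u , inj₂ ey) (v , inj₂ ez) = same-y u v 1ℤ ey ez
      go (u , inj₁ ew) _ (v , inj₁ ez) = same-w u v 0ℤ (+0 u ew) (+0 v ez)
      go (u , inj₂ ew) _ (v , inj₂ ez) = same-w u v 1ℤ ew ez
      go (t , inj₂ refl) (u , inj₂ refl) (v , inj₁ refl) = not-multiple 4 0 (s≤s (s≤s z≤n))
        (divides (m - X) (sym (trans (alg m X) (trans (cong (λ x → x - (1ℤ + + 4 * X)) n≡) (alg2 t u v)))))
        where X = t * t + t + u * u + u + + 3 * (v * v)
              alg : ∀ m X → (m - X) * + 4 ≡ + 4 * m + 1ℤ - (1ℤ + + 4 * X)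
              alg = solve-∀
              alg2 : ∀ t u v → (+ 2 * u + 1ℤ) * (+ 2 * u + 1ℤ) + + 3 * (+ 2 * v * (+ 2 * v)) + (+ 2 * t + 1ℤ) * (+ 2 * t + 1ℤ) -
                  (1ℤ + + 4 * (t * t + t + u * u + u + + 3 * (v * v))) ≡ 1ℤ
              alg2 = solve-∀
      go (t , inj₁ refl) (u , inj₁ refl) (v , inj₂ refl) = not-multiple 4 1 (s≤s (s≤s (s≤s z≤n)))
        (divides (m - X) (sym (trans (alg m X) (trans (cong (λ x → x - (1ℤ + + 4 * X)) n≡) (alg2 t u v)))))
        where X = t * t + u * u + + 3 * (v * v + v)
              alg : ∀ m X → (m - X) * + 4 ≡ + 4 * m + 1ℤ - (1ℤ + + 4 * X)
              alg = solve-∀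
              alg2 : ∀ t u v → + 2 * u * (+ 2 * u) + + 3 * ((+ 2 * v + 1ℤ) * (+ 2 * v + 1ℤ)) + + 2 * t * (+ 2 * t) - (1ℤ + + 4 *
                  (t * t + u * u + + 3 * (v * v + v))) ≡ + 2
              alg2 = solve-∀

  -- The quantity n = 6a - b² for a = b + 2l.
  residual : ℤ → ℤ → ℤ
  residual b l = + 6 * b + + 12 * l - b * b

  -- For odd b the residual is 1 modulo 4. For even b it is 4k, and division by 4 preserves both
  -- alternatives of `Favourable` because 4 ≡ 1 (mod 3).
  residual-normal : ∀ b l → 0ℤ ℤ.< residual b l → Favourable (residual b l) → Normal (residual b l)
  residual-normal b l 0<n fav = go (parity b)
    where
    go : Parity b → Normal (residual b l)
    go (c , inj₂ refl) = subst Normal (sym n≡) (normal-odd m (subst Represented n≡ (favourable⇒represented (residual b l) 0<n fav)))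
      where
      m = + 2 * c + + 3 * l - c * c + 1ℤ
      n≡ : residual b l ≡ + 4 * m + 1ℤ
      n≡ = alg c l
        where alg : ∀ c l → + 6 * (+ 2 * c + 1ℤ) + + 12 * l - (+ 2 * c + 1ℤ) * (+ 2 * c + 1ℤ) ≡ + 4 * (+ 2 * c + + 3 * l - c * c + 1ℤ) + 1ℤ
              alg = solve-∀
    go (c , inj₁ refl) = subst Normal (sym n≡) (normal-4k k (favourable⇒represented k (positive-product {+ 4} (ℤ.+<+ (s≤s z≤n)) (subst
        (0ℤ ℤ.<_) n≡ 0<n)) (quarter fav)))
      where
      k = + 3 * c + + 3 * l - c * c
      n≡ : residual b l ≡ + 4 * k
      n≡ = alg c l
        where alg : ∀ c l → + 6 * (+ 2 * c) + + 12 * l - + 2 * c * (+ 2 * c) ≡ + 4 * (+ 3 * c + + 3 * l - c * c)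
              alg = solve-∀
      quarter : Favourable (residual b l) → Favourable k
      quarter (inj₁ ¬d) = inj₁ (λ d → ¬d (∣-resp (sym n≡) (∣n⇒∣m*n (+ 4) d)))
      quarter (inj₂ (i , e)) = inj₂ (i - κ , trans k≡3κ (cong (_*_ (+ 3)) κ≡))
        where
        κ = + 3 * i + 1ℤ - k
        k≡3κ : k ≡ + 3 * κ
        k≡3κ = trans (alg1 k) (trans (cong (λ x → x - + 3 * k) (trans (sym n≡) e)) (alg2 i k))
          where alg1 : ∀ k → k ≡ + 4 * k - + 3 * k
                alg1 = solve-∀
                alg2 : ∀ i k → + 3 * (+ 3 * i + 1ℤ) - + 3 * k ≡ + 3 * (+ 3 * i + 1ℤ - k)
                alg2 = solve-∀
        κ≡ : κ ≡ + 3 * (i - κ) + 1ℤ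
        κ≡ = trans (cong (_-_ (+ 3 * i + 1ℤ)) k≡3κ) (alg3 i κ)
          where alg3 : ∀ i κ → + 3 * i + 1ℤ - + 3 * κ ≡ + 3 * (i - κ) + 1ℤ
                alg3 = solve-∀

  -- From (6x - b)² ≤ 5n < (b + 6)² one gets 6x - b > -(b + 6), that is, x > -1.
  nonnegative : ∀ x b n d → 0ℤ ℤ.≤ b → + 5 * n ℤ.< (b + + 6) * (b + + 6) → + 5 * n - (+ 6 * x - b) * (+ 6 * x - b) ≡ d → 0ℤ ℤ.≤ d → 0ℤ ℤ.≤ x
  nonnegative x b n d 0≤b lt e 0≤d with 0ℤ ℤ.≤? x
  ... | yes p = p
  ... | no ¬p = contradiction
        (+-nonneg {(b + + 6) * (b + + 6) - (+ 5 * n + 1ℤ) + d} (+-nonneg {(b + + 6) * (b + + 6) - (+ 5 * n + 1ℤ)} (diff-nonneg (<⇒1+≤ lt)) 0≤d)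
          (*-nonneg {+ 6 * - (x + 1ℤ)} (scale-nonneg 6 0≤-x-1) (+-nonneg {+ 6 * - (x + 1ℤ)} (scale-nonneg 6 0≤-x-1) (+-nonneg {+ 2 * b}
              (scale-nonneg 2 0≤b) (ℤ.+≤+ {0} {12} z≤n)))))
        (λ nn → negative-absurd 0 nn (trans (cong (λ d → (b + + 6) * (b + + 6) - (+ 5 * n + 1ℤ) + d + + 6 * - (x + 1ℤ) * (+ 6 * -
            (x + 1ℤ) + (+ 2 * b + + 12)) + 1ℤ) (sym e)) (alg x b n)))
    where
    0≤-x-1 : 0ℤ ℤ.≤ - (x + 1ℤ)
    0≤-x-1 = ℤ.neg-mono-≤ (<⇒1+≤ (ℤ.≰⇒> ¬p))
    alg : ∀ x b n → (b + + 6) * (b + + 6) - (+ 5 * n + 1ℤ) + (+ 5 * n - (+ 6 * x - b) * (+ 6 * x - b)) + + 6 * - (x + 1ℤ) * (+ 6 * -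
        (x + 1ℤ) + (+ 2 * b + + 12)) + 1ℤ ≡ 0ℤ
    alg = solve-∀

  -- Recovering four natural numbers from their weighted sum and sum of squares

  Solution : ℤ → ℤ → Set
  Solution b l = ∃[ x₁ ] ∃[ x₂ ] ∃[ x₃ ] ∃[ x₄ ]
    (+ x₁ + + x₂ + + x₃ + + 3 * + x₄ ≡ b × + x₁ * + x₁ + + x₂ * + x₂ + + x₃ * + x₃ + + 3 * (+ x₄ * + x₄) ≡ b + + 2 * l)

  module Solve (b l : ℤ) (0≤b : 0ℤ ℤ.≤ b) (small : + 5 * residual b l ℤ.< (b + + 6) * (b + + 6)) where
    n = residual b l

    from-vector : ∀ s t u v → s + t + u + + 3 * v ≡ b → s * s + t * t + u * u + + 3 * (v * v) ≡ b + + 2 * l → Solution b l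
    from-vector s t u v e₁ e₂ = naturals s t u v (bound s t u v e₁ e₂) (bound t s u v (trans (swap s t u v) e₁) (trans (swap² s t u v) e₂))
        (bound u s t v (trans (rotate s t u v) e₁) (trans (rotate² s t u v) e₂)) bound-v e₁ e₂
      where
      swap : ∀ s t u v → t + s + u + + 3 * v ≡ s + t + u + + 3 * v
      swap = solve-∀
      swap² : ∀ s t u v → t * t + s * s + u * u + + 3 * (v * v) ≡ s * s + t * t + u * u + + 3 * (v * v)
      swap² = solve-∀
      rotate : ∀ s t u v → u + s + t + + 3 * v ≡ s + t + u + + 3 * v
      rotate = solve-∀
      rotate² : ∀ s t u v → u * u + s * s + t * t + + 3 * (v * v) ≡ s * s + t * t + u * u + + 3 * (v * v)
      rotate² = solve-∀
      n-from : ∀ {A} → A ≡ b + + 2 * l → n ≡ + 6 * A - b * b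
      n-from refl = alg b l
        where alg : ∀ b l → + 6 * b + + 12 * l - b * b ≡ + 6 * (b + + 2 * l) - b * b
              alg = solve-∀
      bound : ∀ s t u v → s + t + u + + 3 * v ≡ b → s * s + t * t + u * u + + 3 * (v * v) ≡ b + + 2 * l → 0ℤ ℤ.≤ s
      -- The term d is 6 times the defect in Cauchy's inequality for t, u, v with weights 1, 1, 3;
      -- the factor 5 in front of n is the sum of these weights.
      bound s t u v e₁ e₂ = nonnegative s b n (+ 6 * ((t - u) * (t - u) + + 3 * ((t - v) * (t - v)) + + 3 * ((u - v) * (u - v)))) 0≤b small
          (trans (cong₂ (λ n b → + 5 * n - (+ 6 * s - b) * (+ 6 * s - b)) (trans (n-from e₂) (cong (λ b → + 6 *
              (s * s + t * t + u * u + + 3 * (v * v)) - b * b) (sym e₁))) (sym e₁)) (alg s t u v))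
          (scale-nonneg 6 (+-nonneg {(t - u) * (t - u) + + 3 * ((t - v) * (t - v))} (+-nonneg {(t - u) * (t - u)} (square-nonneg (t - u))
              (scale-nonneg 3 (square-nonneg (t - v)))) (scale-nonneg 3 (square-nonneg (u - v)))))
        where alg : ∀ s t u v → + 5 * (+ 6 * (s * s + t * t + u * u + + 3 * (v * v)) - (s + t + u + + 3 * v) * (s + t + u + + 3 * v)) -
                (+ 6 * s - (s + t + u + + 3 * v)) * (+ 6 * s - (s + t + u + + 3 * v))
                      ≡ + 6 * ((t - u) * (t - u) + + 3 * ((t - v) * (t - v)) + + 3 * ((u - v) * (u - v)))
              alg = solve-∀
      bound-v : 0ℤ ℤ.≤ v
      -- The variable v itself has weight 3 and the others together have weight 3, so 5n is more
      -- than enough; this is where the additional square with factor 4 comes from.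
      bound-v = nonnegative v b n (+ 4 * ((s + t + u - + 3 * v) * (s + t + u - + 3 * v)) + + 10 * ((s - t) * (s - t) + (t - u) * (t - u) +
          (s - u) * (s - u))) 0≤b small
          (trans (cong₂ (λ n b → + 5 * n - (+ 6 * v - b) * (+ 6 * v - b)) (trans (n-from e₂) (cong (λ b → + 6 *
              (s * s + t * t + u * u + + 3 * (v * v)) - b * b) (sym e₁))) (sym e₁)) (alg s t u v))
          (+-nonneg {+ 4 * ((s + t + u - + 3 * v) * (s + t + u - + 3 * v))} (scale-nonneg 4 (square-nonneg (s + t + u - + 3 * v)))
            (scale-nonneg 10 (+-nonneg {(s - t) * (s - t) + (t - u) * (t - u)} (+-nonneg {(s - t) * (s - t)} (square-nonneg (s - t))
                (square-nonneg (t - u))) (square-nonneg (s - u)))))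
        where alg : ∀ s t u v → + 5 * (+ 6 * (s * s + t * t + u * u + + 3 * (v * v)) - (s + t + u + + 3 * v) * (s + t + u + + 3 * v)) -
                (+ 6 * v - (s + t + u + + 3 * v)) * (+ 6 * v - (s + t + u + + 3 * v))
                      ≡ + 4 * ((s + t + u - + 3 * v) * (s + t + u - + 3 * v)) + + 10 * ((s - t) * (s - t) + (t - u) * (t - u) + (s - u) * (s - u))
              alg = solve-∀
      naturals : ∀ s t u v → 0ℤ ℤ.≤ s → 0ℤ ℤ.≤ t → 0ℤ ℤ.≤ u → 0ℤ ℤ.≤ v → s + t + u + + 3 * v ≡ b → s * s + t * t + u * u + + 3 *
          (v * v) ≡ b + + 2 * l → Solution b l
      naturals (+ s) (+ t) (+ u) (+ v) _ _ _ _ e₁ e₂ = s , t , u , v , e₁ , e₂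

    -- Inverts the substitution of variables: v = (b - w) / 6, and the middle variable is (b - 3v -
    -- (p - q)) / 3. Divisibility of b - w by 2 comes from b² ≡ n ≡ w² (mod 2).
    from-normal : ∀ w p q → n ≡ w * w + + 4 * (p * p + p * q + q * q) → + 3 ∣ b - w → + 3 ∣ b - (p - q) → Solution b l
    from-normal w p q n≡ (divides f ef) (divides g eg) = go (parity b) (parity w)
      where
      sum : ∀ d → b - w ≡ + 2 * d → Solution b l
      sum d ed = from-vector (g′ + p) g′ (g′ - q) v e₁ (ℤ.*-cancelˡ-≡ (+ 6) _ _ e₂)
        where
        -- As b - w equals both 2d and 3f, it is 3 · 2d - 2 · 3f = 6(d - f).
        v = d - f
        g′ = g - v
        b≡ : b ≡ + 3 * g + (p - q)
        b≡ = trans (alg b (p - q)) (trans (cong (_+ (p - q)) eg) (alg2 g (p - q)))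
          where alg : ∀ b d → b ≡ b - d + d
                alg = solve-∀
                alg2 : ∀ g d → g * + 3 + d ≡ + 3 * g + d
                alg2 = solve-∀
        w≡ : w ≡ b - + 6 * v
        w≡ = trans (alg w b) (trans (cong (_-_ b) (trans (alg2 (b - w)) (trans (cong₂ (λ x y → + 3 * x - + 2 * y) ed ef) (alg3 d f)))) refl)
          where alg : ∀ w b → w ≡ b - (b - w)
                alg = solve-∀
                alg2 : ∀ x → x ≡ + 3 * x - + 2 * x
                alg2 = solve-∀
                alg3 : ∀ d f → + 3 * (+ 2 * d) - + 2 * (f * + 3) ≡ + 6 * (d - f)
                alg3 = solve-∀
        e₁ : g′ + p + g′ + (g′ - q) + + 3 * v ≡ b
        e₁ = trans (alg g v p q) (sym b≡)
          where alg : ∀ g v p q → g - v + p + (g - v) + (g - v - q) + + 3 * v ≡ + 3 * g + (p - q)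
                alg = solve-∀
        e₂ : + 6 * ((g′ + p) * (g′ + p) + g′ * g′ + (g′ - q) * (g′ - q) + + 3 * (v * v)) ≡ + 6 * (b + + 2 * l)
        e₂ = trans (alg g v p q) (trans (cong (λ b → b * b + ((b - + 6 * v) * (b - + 6 * v) + + 4 * (p * p + p * q + q * q))) (sym b≡))
               (trans (cong (λ w → b * b + (w * w + + 4 * (p * p + p * q + q * q))) (sym w≡)) (trans (cong (_+_ (b * b)) (sym n≡)) (alg2 b l))))
          where alg : ∀ g v p q → + 6 * ((g - v + p) * (g - v + p) + (g - v) * (g - v) + (g - v - q) * (g - v - q) + + 3 * (v * v))
                        ≡ (+ 3 * g + (p - q)) * (+ 3 * g + (p - q)) + ((+ 3 * g + (p - q) - + 6 * v) * (+ 3 * g +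
                            (p - q) - + 6 * v) + + 4 * (p * p + p * q + q * q))
                alg = solve-∀
                alg2 : ∀ b l → b * b + (+ 6 * b + + 12 * l - b * b) ≡ + 6 * (b + + 2 * l)
                alg2 = solve-∀
      odd-absurd : ∀ x y → b * b ≡ x → w * w ≡ y → ∀ z → x + y ≡ + 2 * z + 1ℤ → Solution b l
      odd-absurd x y eb ew z e = not-multiple 2 0 (s≤s (s≤s z≤n))
        (divides (+ 3 * b + + 6 * l - + 2 * (p * p + p * q + q * q) - z) (sym (trans (alg b l (p * p + p * q + q * q) z) (trans (cong
            (λ n → n + b * b - + 4 * (p * p + p * q + q * q) - + 2 * z) n≡)
          (trans (alg2 (w * w) (b * b) (p * p + p * q + q * q) z) (trans (cong₂ (λ x y → x + y - + 2 * z) eb ew) (trans (cong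
              (λ t → t - + 2 * z) e) (alg3 z))))))))
        where alg : ∀ b l E z → (+ 3 * b + + 6 * l - + 2 * E - z) * + 2 ≡ + 6 * b + + 12 * l - b * b + b * b - + 4 * E - + 2 * z
              alg = solve-∀
              alg2 : ∀ w b E z → w + + 4 * E + b - + 4 * E - + 2 * z ≡ b + w - + 2 * z
              alg2 = solve-∀
              alg3 : ∀ z → + 2 * z + 1ℤ - + 2 * z ≡ 1ℤ
              alg3 = solve-∀
      go : Parity b → Parity w → Solution b l
      go (x , inj₁ ex) (y , inj₁ ey) = sum (x - y) (trans (cong₂ _-_ ex ey) (alg x y))
        where alg : ∀ x y → + 2 * x - + 2 * y ≡ + 2 * (x - y)
              alg = solve-∀
      go (x , inj₂ ex) (y , inj₂ ey) = sum (x - y) (trans (cong₂ _-_ ex ey) (alg x y))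
        where alg : ∀ x y → + 2 * x + 1ℤ - (+ 2 * y + 1ℤ) ≡ + 2 * (x - y)
              alg = solve-∀
      go (x , inj₁ ex) (y , inj₂ ey) = odd-absurd _ _ (cong₂ _*_ ex ex) (cong₂ _*_ ey ey) (+ 2 * (x * x) + + 2 * (y * y) + + 2 * y) (alg x y)
        where alg : ∀ x y → + 2 * x * (+ 2 * x) + (+ 2 * y + 1ℤ) * (+ 2 * y + 1ℤ) ≡ + 2 * (+ 2 * (x * x) + + 2 * (y * y) + + 2 * y) + 1ℤ
              alg = solve-∀
      go (x , inj₂ ex) (y , inj₁ ey) = odd-absurd _ _ (cong₂ _*_ ex ex) (cong₂ _*_ ey ey) (+ 2 * (x * x) + + 2 * (y * y) + + 2 * x) (alg x y)
        where alg : ∀ x y → (+ 2 * x + 1ℤ) * (+ 2 * x + 1ℤ) + + 2 * y * (+ 2 * y) ≡ + 2 * (+ 2 * (x * x) + + 2 * (y * y) + + 2 * x) + 1ℤ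
              alg = solve-∀

    -- Modulo 3 one has n ≡ -b² and n ≡ w² + (p - q)², so w and p - q agree with b up to sign. The
    -- signs of w and of the pair (p, q) can be changed independently.
    solve-normal : Normal n → Solution b l
    solve-normal (w , p , q , n≡) = go (match-sign b w (p - q) d₁) (match-sign b (p - q) w d₂)
      where
      alg : ∀ b l p q → + 6 * b + + 12 * l - b * b + b * b - + 3 * (p * p + p * q + q * q + p * q) ≡ (+ 2 * b + + 4 * l -
          (p * p + p * q + q * q + p * q)) * + 3
      alg = solve-∀
      alg2 : ∀ w p q b → w * w + + 4 * (p * p + p * q + q * q) + b * b - + 3 * (p * p + p * q + q * q + p * q) ≡ b * b + w * w + (p - q) * (p - q)
      alg2 = solve-∀
      alg3 : ∀ b w d → b * b + w * w + d * d ≡ b * b + d * d + w * w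
      alg3 = solve-∀
      d₁ : + 3 ∣ b * b + w * w + (p - q) * (p - q)
      d₁ = divides (+ 2 * b + + 4 * l - (p * p + p * q + q * q + p * q)) (trans (sym (alg2 w p q b)) (trans (cong (λ n → n + b * b - + 3 *
          (p * p + p * q + q * q + p * q)) (sym n≡)) (alg b l p q)))
      d₂ : + 3 ∣ b * b + (p - q) * (p - q) + w * w
      d₂ = ∣-resp (alg3 b w (p - q)) d₁
      neg : ∀ {x y} → x ≡ - y → + 3 ∣ b + y → + 3 ∣ b - x
      neg {y = y} refl d = ∣-resp (cong (_+_ b) (sym (ℤ.neg-involutive y))) d
      flip-w : ∀ w E → w * w + E ≡ - w * - w + E
      flip-w = solve-∀
      flip-pq : ∀ w p q → w * w + + 4 * (p * p + p * q + q * q) ≡ w * w + + 4 * (- p * - p + - p * - q + - q * - q)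
      flip-pq = solve-∀
      neg-diff : ∀ p q → - p - (- q) ≡ - (p - q)
      neg-diff = solve-∀
      go : + 3 ∣ b - w ⊎ + 3 ∣ b + w → + 3 ∣ b - (p - q) ⊎ + 3 ∣ b + (p - q) → Solution b l
      go (inj₁ dw) (inj₁ dp) = from-normal w p q n≡ dw dp
      go (inj₁ dw) (inj₂ dp) = from-normal w (- p) (- q) (trans n≡ (flip-pq w p q)) dw (neg (neg-diff p q) dp)
      go (inj₂ dw) (inj₁ dp) = from-normal (- w) p q (trans n≡ (flip-w w (+ 4 * (p * p + p * q + q * q)))) (neg refl dw) dp
      go (inj₂ dw) (inj₂ dp) = from-normal (- w) (- p) (- q) (trans n≡ (trans (flip-pq w p q) (flip-w w (+ 4 *
          (- p * - p + - p * - q + - q * - q))))) (neg refl dw) (neg (neg-diff p q) dp)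

  favourable-unit : ∀ b l u ρ → b ≡ + 3 * u + ρ → ρ * ρ ≡ 1ℤ → Favourable (residual b l)
  favourable-unit b l u ρ refl e = inj₁ (λ d → not-multiple 3 0 (s≤s (s≤s z≤n)) (∣-resp e
      (∣-resp (alg u ρ l) (∣m∣n⇒∣m+n (∣n⇒∣m*n (- 1ℤ) d) (∣n⇒∣m*n (+ 2 * (+ 3 * u + ρ) + + 4 * l - + 3 * u * u - + 2 * u * ρ) ∣-refl)))))
    where alg : ∀ u ρ l → - 1ℤ * (+ 6 * (+ 3 * u + ρ) + + 12 * l - (+ 3 * u + ρ) * (+ 3 * u + ρ)) + (+ 2 *
            (+ 3 * u + ρ) + + 4 * l - + 3 * u * u - + 2 * u * ρ) * + 3 ≡ ρ * ρ
          alg = solve-∀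

  favourable-multiple : ∀ b l u v → b ≡ + 3 * u → l ≡ + 3 * v + 1ℤ → Favourable (residual b l)
  favourable-multiple b l u v refl refl = inj₂ (+ 2 * u + + 4 * v + 1ℤ - u * u , alg u v)
    where alg : ∀ u v → + 6 * (+ 3 * u) + + 12 * (+ 3 * v + 1ℤ) - + 3 * u * (+ 3 * u) ≡ + 3 * (+ 3 * (+ 2 * u + + 4 * v + 1ℤ - u * u) + 1ℤ)
          alg = solve-∀

  -- With a = b + 2l one of three consecutive candidates has 3 ∤ b, or 3 ∣ b and a ≡ 2 (mod 3).
  choose : ∀ b m l → ∃[ i ] (0ℤ ℤ.≤ i × i ℤ.≤ + 2 × Favourable (residual (b + i * m) (l - i)))
  choose b m l = go (residue₃ (b + 0ℤ * m)) (residue₃ (b + 1ℤ * m)) (residue₃ l)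
    where
    0≤ : ∀ {n} → 0ℤ ℤ.≤ + n
    0≤ = ℤ.+≤+ z≤n
    go : Residue₃ (b + 0ℤ * m) → Residue₃ (b + 1ℤ * m) → Residue₃ l → ∃[ i ] (0ℤ ℤ.≤ i × i ℤ.≤ + 2 × Favourable (residual (b + i * m) (l - i)))
    go (u , _ , plus , e) _ _ = 0ℤ , 0≤ , ℤ.+≤+ z≤n , favourable-unit _ _ u 1ℤ e refl
    go (u , _ , minus , e) _ _ = 0ℤ , 0≤ , ℤ.+≤+ z≤n , favourable-unit _ _ u (- 1ℤ) e refl
    go (u , _ , zero′ , e) (v , _ , plus , f) _ = 1ℤ , 0≤ , ℤ.+≤+ (s≤s z≤n) , favourable-unit _ _ v 1ℤ f refl
    go (u , _ , zero′ , e) (v , _ , minus , f) _ = 1ℤ , 0≤ , ℤ.+≤+ (s≤s z≤n) , favourable-unit _ _ v (- 1ℤ) f refl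
    -- From here on 3 divides b and b + m, hence every candidate for b, and i is chosen to make l -
    -- i ≡ 1 (mod 3).
    go (u , _ , zero′ , e) (v , _ , zero′ , f) (x , _ , plus , g) = 0ℤ , 0≤ , ℤ.+≤+ z≤n ,
      favourable-multiple _ _ u x (trans e (ℤ.+-identityʳ (+ 3 * u))) (trans (ℤ.+-identityʳ l) g)
    go (u , _ , zero′ , e) (v , _ , zero′ , f) (x , _ , minus , g) = 1ℤ , 0≤ , ℤ.+≤+ (s≤s z≤n) ,
      favourable-multiple _ _ v (x - 1ℤ) (trans f (ℤ.+-identityʳ (+ 3 * v))) (trans (cong (λ l → l - 1ℤ) g) (alg x))
      where alg : ∀ x → + 3 * x + - 1ℤ - 1ℤ ≡ + 3 * (x - 1ℤ) + 1ℤ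
            alg = solve-∀
    go (u , _ , zero′ , e) (v , _ , zero′ , f) (x , _ , zero′ , g) = + 2 , 0≤ , ℤ.≤-refl ,
      favourable-multiple _ _ (+ 2 * v - u) (x - 1ℤ) (trans (alg1 b m) (trans (cong₂ (λ p q → + 2 * p - q) f e) (alg2 u v))) (trans (cong
          (λ l → l - + 2) g) (alg x))
      where alg : ∀ x → + 3 * x + 0ℤ - + 2 ≡ + 3 * (x - 1ℤ) + 1ℤ
            alg = solve-∀
            alg1 : ∀ b m → b + + 2 * m ≡ + 2 * (b + 1ℤ * m) - (b + 0ℤ * m)
            alg1 = solve-∀
            alg2 : ∀ u v → + 2 * (+ 3 * v + 0ℤ) - (+ 3 * u + 0ℤ) ≡ + 3 * (+ 2 * v - u)
            alg2 = solve-∀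

  -- The range of b for given N and m

  module Window (m c L : ℤ) (3≤m : + 3 ℤ.≤ m) (0≤c : 0ℤ ℤ.≤ c)
                (c²< : c * c + 1ℤ ℤ.≤ + 10 * (L + 1ℤ) + + 3 * c)
                (≤b² : + 10 * L + + 3 * (c + m) ℤ.≤ (c + m) * (c + m))
                (N≥ : + 924 * (m * m * m) ℤ.≤ m * (L + 1ℤ) + c) where
    0≤m : 0ℤ ℤ.≤ m
    0≤m = ℤ.≤-trans (ℤ.+≤+ z≤n) 3≤m

    m-3 : 0ℤ ℤ.≤ m - + 3
    m-3 = diff-nonneg 3≤m

    -- Room for the largest candidate b = c + 3m: its square exceeds c² by 6cm + 9m², and the excess
    -- of 12(L - 2) over the bound 10(L + 1) + 3c for c² must absorb this. If it did not, then c² <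
    -- 175 + 18c + 30cm + 45m², which forces c ≤ 38m and so 2N ≤ 237m³ + 114m² + 111m, contrary to N
    -- ≥ 924m³.
    wide : 0ℤ ℤ.≤ + 2 * (L + 1ℤ) - (+ 36 + + 3 * c + + 6 * c * m + + 9 * m * m)
    wide with 0ℤ ℤ.≤? + 2 * (L + 1ℤ) - (+ 36 + + 3 * c + + 6 * c * m + + 9 * m * m)
    ... | yes p = p
    ... | no ¬p = contradiction
          (+-nonneg {+ 2 * (m * (L + 1ℤ) + c - + 924 * (m * m * m)) + m * X + (+ 3 * m + + 6 * m * m + + 2) * (+ 38 * m - c)}
            (+-nonneg {+ 2 * (m * (L + 1ℤ) + c - + 924 * (m * m * m)) + m * X}
              (+-nonneg {+ 2 * (m * (L + 1ℤ) + c - + 924 * (m * m * m))} (scale-nonneg 2 (diff-nonneg N≥)) (*-nonneg 0≤m 0≤X))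
              (*-nonneg (+-nonneg {+ 3 * m + + 6 * m * m} (+-nonneg {+ 3 * m} (scale-nonneg 3 0≤m) (*-nonneg {+ 6 * m}
                  (scale-nonneg 6 0≤m) 0≤m)) (ℤ.+≤+ z≤n)) c≤38m))
            (+-nonneg {(m - + 3) * (+ 1611 * (m * m) + + 4719 * m + + 14046)}
              (*-nonneg m-3 (+-nonneg {+ 1611 * (m * m) + + 4719 * m} (+-nonneg {+ 1611 * (m * m)} (scale-nonneg 1611 (*-nonneg 0≤m 0≤m))
                  (scale-nonneg 4719 0≤m)) (ℤ.+≤+ z≤n)))
              (ℤ.+≤+ {0} {42137} z≤n)))
          (λ nn → negative-absurd 0 nn (alg m c L))
      where
      X = - (+ 2 * (L + 1ℤ) - (+ 36 + + 3 * c + + 6 * c * m + + 9 * m * m) + 1ℤ)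
      0≤X : 0ℤ ℤ.≤ X
      0≤X = ℤ.neg-mono-≤ (<⇒1+≤ (ℤ.≰⇒> ¬p))
      alg : ∀ m c L → + 2 * (m * (L + 1ℤ) + c - + 924 * (m * m * m)) + m * - (+ 2 * (L + 1ℤ) - (+ 36 + + 3 * c + + 6 * c * m + + 9 * m * m) + 1ℤ)
              + (+ 3 * m + + 6 * m * m + + 2) * (+ 38 * m - c) + ((m - + 3) * (+ 1611 * (m * m) + + 4719 * m + + 14046) + + 42137) + 1ℤ ≡ 0ℤ
      alg = solve-∀
      c≤38m : 0ℤ ℤ.≤ + 38 * m - c
      c≤38m with c ℤ.≤? + 38 * m
      ... | yes q = diff-nonneg q
      ... | no ¬q = contradiction
            (+-nonneg {+ 5 * X + (+ 10 * (L + 1ℤ) + + 3 * c - (c * c + 1ℤ)) + (c - + 38 * m) * (c + + 2 * m) + (m - + 3) * (+ 6 * c)}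
              (+-nonneg {+ 5 * X + (+ 10 * (L + 1ℤ) + + 3 * c - (c * c + 1ℤ)) + (c - + 38 * m) * (c + + 2 * m)}
                (+-nonneg {+ 5 * X + (+ 10 * (L + 1ℤ) + + 3 * c - (c * c + 1ℤ))}
                  (+-nonneg {+ 5 * X} (scale-nonneg 5 0≤X) (diff-nonneg c²<))
                  (*-nonneg (diff-nonneg (ℤ.<⇒≤ (ℤ.≰⇒> ¬q))) (+-nonneg {c} 0≤c (scale-nonneg 2 0≤m))))
                (*-nonneg m-3 (scale-nonneg 6 0≤c)))
              (*-nonneg {+ 31 * (m - + 3)} (scale-nonneg 31 m-3) (+-nonneg {m} 0≤m (ℤ.+≤+ {0} {3} z≤n))))
            (λ nn → negative-absurd 104 nn (alg2 m c L))
        where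
        alg2 : ∀ m c L → + 5 * - (+ 2 * (L + 1ℤ) - (+ 36 + + 3 * c + + 6 * c * m + + 9 * m * m) + 1ℤ) + (+ 10 * (L + 1ℤ) + + 3 * c - (c * c + 1ℤ))
                 + (c - + 38 * m) * (c + + 2 * m) + (m - + 3) * (+ 6 * c) + + 31 * (m - + 3) * (m + + 3) + + 105 ≡ 0ℤ
        alg2 = solve-∀

    module _ (i : ℤ) (0≤i : 0ℤ ℤ.≤ i) (i≤2 : i ℤ.≤ + 2) where
      b l : ℤ
      b = c + m + i * m
      l = L - i

      0≤b : 0ℤ ℤ.≤ b
      0≤b = +-nonneg {c + m} (+-nonneg {c} 0≤c 0≤m) (*-nonneg 0≤i 0≤m)

      residual-positive : 0ℤ ℤ.< residual b l
      residual-positive = 1+≤⇒< (≤-from-diff _ (alg m c L i)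
          (+-nonneg (+-nonneg (+-nonneg (+-nonneg (diff-nonneg c²<) wide) (*-nonneg (*-nonneg (diff-nonneg i≤2) 0≤m) (+-nonneg {+ 2 * c}
              (scale-nonneg 2 0≤c) (*-nonneg (+-nonneg {+ 4} (ℤ.+≤+ z≤n) 0≤i) 0≤m))))
            (scale-nonneg 6 0≤b)) (scale-nonneg 12 (diff-nonneg i≤2))))
        where
        alg : ∀ m c L i → + 6 * (c + m + i * m) + + 12 * (L - i) - (c + m + i * m) * (c + m + i * m) - (0ℤ + 1ℤ)
                ≡ + 10 * (L + 1ℤ) + + 3 * c - (c * c + 1ℤ) + (+ 2 * (L + 1ℤ) - (+ 36 + + 3 * c + + 6 * c * m + + 9 * m * m))
                  + (+ 2 - i) * m * (+ 2 * c + (+ 4 + i) * m) + + 6 * (c + m + i * m) + + 12 * (+ 2 - i)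
        alg = solve-∀

      -- The inequality amounts to 10l + 3b - 6 < b². The hypothesis `≤b²` provides it at b = c + m,
      -- and each further step raises b and lowers l.
      residual-small : + 5 * residual b l ℤ.< (b + + 6) * (b + + 6)
      residual-small = 1+≤⇒< (≤-from-diff _ (alg m c L i)
          (+-nonneg (scale-nonneg 6 (+-nonneg (+-nonneg (diff-nonneg ≤b²)
              (*-nonneg (*-nonneg 0≤i 0≤m) (+-nonneg {+ 2 * c + (m - + 3) + m} (+-nonneg {+ 2 * c + (m - + 3)} (+-nonneg {+ 2 * c}
                  (scale-nonneg 2 0≤c) m-3) 0≤m) (*-nonneg 0≤i 0≤m))))
              (scale-nonneg 10 0≤i))) (ℤ.+≤+ {0} {35} z≤n)))
        where
        alg : ∀ m c L i → (c + m + i * m + + 6) * (c + m + i * m + + 6) - (+ 5 * (+ 6 * (c + m + i * m) + + 12 * (L - i) -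
            (c + m + i * m) * (c + m + i * m)) + 1ℤ)
                ≡ + 6 * ((c + m) * (c + m) - (+ 10 * L + + 3 * (c + m)) + i * m * (+ 2 * c + (m - + 3) + m + i * m) + + 10 * i) + + 35
        alg = solve-∀

    solution : ∃[ b ] ∃[ l ] (m * (L + 1ℤ) + c ≡ m * l + b × Solution b l)
    solution = let i , 0≤i , i≤2 , fav = choose (c + m) m L in
      b i 0≤i i≤2 , l i 0≤i i≤2 , alg m c L i ,
      Solve.solve-normal (b i 0≤i i≤2) (l i 0≤i i≤2) (0≤b i 0≤i i≤2) (residual-small i 0≤i i≤2)
        (residual-normal (b i 0≤i i≤2) (l i 0≤i i≤2) (residual-positive i 0≤i i≤2) fav)
      where
      alg : ∀ m c L i → m * (L + 1ℤ) + c ≡ m * (L - i) + (c + m + i * m)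
      alg = solve-∀

  -- Among the pairs with N = ml + b, b is raised in steps of m until b² ≥ 10l + 3b; `c′` is the
  -- last b before that. The search stops before l = 0, because there b = N ≥ 3 and b² < 3b is
  -- impossible.
  find-window : ∀ m N → 3 ≤ N → ∀ L c → N ≡ m ℕ.* L ℕ.+ c → c ℕ.* c < 10 ℕ.* L ℕ.+ 3 ℕ.* c →
                ∃[ L′ ] ∃[ c′ ] (N ≡ m ℕ.* suc L′ ℕ.+ c′ × c′ ℕ.* c′ < 10 ℕ.* suc L′ ℕ.+ 3 ℕ.* c′ ×
                                 10 ℕ.* L′ ℕ.+ 3 ℕ.* (c′ ℕ.+ m) ≤ (c′ ℕ.+ m) ℕ.* (c′ ℕ.+ m))
  find-window m N 3≤N zero c N≡ lt = contradiction (ℕ.*-monoˡ-≤ c (subst (3 ≤_) (trans N≡ (cong (ℕ._+ c) (ℕ.*-zeroʳ m))) 3≤N)) (ℕ.<⇒≱ lt)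
  find-window m N 3≤N (suc L) c N≡ lt with (c ℕ.+ m) ℕ.* (c ℕ.+ m) ℕ.<? 10 ℕ.* L ℕ.+ 3 ℕ.* (c ℕ.+ m)
  ... | yes lt′ = find-window m N 3≤N L (c ℕ.+ m) (trans N≡ (alg m L c)) lt′
    where alg : ∀ m L c → m ℕ.* suc L ℕ.+ c ≡ m ℕ.* L ℕ.+ (c ℕ.+ m)
          alg = ℕ-solver.solve-∀
  ... | no ¬lt = L , c , N≡ , lt , ℕ.≮⇒≥ ¬lt

  -- Return to polygonal numbers

  binomial-square : ∀ x → 2 ℕ.* (x C 2) ℕ.+ x ≡ x ℕ.* x
  binomial-square zero    = refl
  binomial-square (suc x) = trans (cong (λ z → 2 ℕ.* z ℕ.+ suc x) (trans (sym (nCk+nC[k+1]≡[n+1]C[k+1] x 1)) (cong (ℕ._+ (x C 2)) (nC1≡n x))))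
      (trans (alg x (x C 2)) (trans (cong (λ z → z ℕ.+ (2 ℕ.* x ℕ.+ 1)) (binomial-square x)) (alg2 x)))
    where alg : ∀ x y → 2 ℕ.* (x ℕ.+ y) ℕ.+ suc x ≡ 2 ℕ.* y ℕ.+ x ℕ.+ (2 ℕ.* x ℕ.+ 1)
          alg = ℕ-solver.solve-∀
          alg2 : ∀ x → x ℕ.* x ℕ.+ (2 ℕ.* x ℕ.+ 1) ≡ suc x ℕ.* suc x
          alg2 = ℕ-solver.solve-∀

  polygonal-ℤ : ∀ m x → + polygonal m x ≡ + m * + (x C 2) + + x
  polygonal-ℤ m x = cong (_+ + x) (ℤ.pos-* m (x C 2))

  -- Since x² is twice the binomial coefficient plus x, subtracting the two equations of `Solution`
  -- shows that l is the weighted sum of the binomial coefficients.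
  polygonal-sum : ∀ m N b l → + N ≡ + m * l + b → Solution b l →
    ∃[ x₁ ] ∃[ x₂ ] ∃[ x₃ ] ∃[ x₄ ]
      (N ≡ polygonal m x₁ ℕ.+ polygonal m x₂ ℕ.+ polygonal m x₃ ℕ.+ 3 ℕ.* polygonal m x₄)
  polygonal-sum m N b l N≡ (x₁ , x₂ , x₃ , x₄ , e₁ , e₂) = x₁ , x₂ , x₃ , x₄ , ℤ.+-injective (trans N≡ (trans (cong₂
      (λ l b → + m * l + b) l≡ (sym e₁)) (trans
      (alg (+ m) (B x₁) (B x₂) (B x₃) (B x₄) (+ x₁) (+ x₂) (+ x₃) (+ x₄))
      (sym (cong₂ _+_ (cong₂ _+_ (cong₂ _+_ (polygonal-ℤ m x₁) (polygonal-ℤ m x₂)) (polygonal-ℤ m x₃)) (trans (ℤ.pos-* 3 (polygonal m x₄))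
          (cong (_*_ (+ 3)) (polygonal-ℤ m x₄))))))))
    where
    B : ℕ → ℤ
    B x = + (x C 2)
    alg : ∀ m a b c d x y z w → m * (a + b + c + + 3 * d) + (x + y + z + + 3 * w) ≡ m * a + x + (m * b + y) + (m * c + z) + + 3 * (m * d + w)
    alg = solve-∀
    square : ∀ x → + x * + x ≡ + 2 * B x + + x
    square x = trans (sym (ℤ.pos-* x x)) (trans (cong +_ (sym (binomial-square x))) (cong (_+ + x) (ℤ.pos-* 2 (x C 2))))
    alg2 : ∀ a b c d x y z w → + 2 * (a + b + c + + 3 * d) ≡ + 2 * a + x + (+ 2 * b + y) + (+ 2 * c + z) + + 3 * (+ 2 * d + w) - (x + y + z + + 3 * w)
    alg2 = solve-∀
    alg3 : ∀ b l → + 2 * l ≡ b + + 2 * l - b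
    alg3 = solve-∀
    l≡ : l ≡ B x₁ + B x₂ + B x₃ + + 3 * B x₄
    l≡ = ℤ.*-cancelˡ-≡ (+ 2) l (B x₁ + B x₂ + B x₃ + + 3 * B x₄) (trans (alg3 b l) (trans (cong₂ _-_ (sym e₂) (sym e₁)) (trans
        (cong (λ z → z - (+ x₁ + + x₂ + + x₃ + + 3 * + x₄)) (cong₂ _+_ (cong₂ _+_ (cong₂ _+_ (square x₁) (square x₂)) (square x₃)) (cong
            (_*_ (+ 3)) (square x₄))))
        (sym (alg2 (B x₁) (B x₂) (B x₃) (B x₄) (+ x₁) (+ x₂) (+ x₃) (+ x₄))))))

  sum-of-polygonals : ∀ m → 3 ≤ m → ∀ N → 924 ℕ.* m ^ 3 ≤ N →
    ∃[ x₁ ] ∃[ x₂ ] ∃[ x₃ ] ∃[ x₄ ]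
      (N ≡ polygonal m x₁ ℕ.+ polygonal m x₂ ℕ.+ polygonal m x₃ ℕ.+ 3 ℕ.* polygonal m x₄)
  sum-of-polygonals m@(suc _) 3≤m N N≥ = finish (find-window m N 3≤N (N ℕ./ m) (N ℕ.% m) N≡ start)
    where
    m³≤N : m ℕ.* m ℕ.* m ≤ N
    m³≤N = ℕ.≤-trans (ℕ.≤-reflexive (alg m)) (ℕ.≤-trans (ℕ.m≤n*m (m ^ 3) 924) N≥)
      where alg : ∀ m → m ℕ.* m ℕ.* m ≡ m ℕ.* (m ℕ.* (m ℕ.* 1))
            alg = ℕ-solver.solve-∀
    3≤N : 3 ≤ N
    3≤N = ℕ.≤-trans 3≤m (ℕ.≤-trans (ℕ.m≤n*m m (m ℕ.* m)) m³≤N)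
    N≡ : N ≡ m ℕ.* (N ℕ./ m) ℕ.+ N ℕ.% m
    N≡ = trans (ℕ.m≡m%n+[m/n]*n N m) (trans (ℕ.+-comm (N ℕ.% m) ((N ℕ./ m) ℕ.* m)) (cong (ℕ._+ N ℕ.% m) (ℕ.*-comm (N ℕ./ m) m)))
    m²≤N/m : m ℕ.* m ≤ N ℕ./ m
    m²≤N/m = ℕ.≤-trans (ℕ.≤-reflexive (sym (ℕ.m*n/n≡m (m ℕ.* m) m))) (ℕ./-monoˡ-≤ m m³≤N)
    -- The search begins at b = N mod m, where b² < m² ≤ ⌊N/m⌋ because N ≥ m³.
    start : (N ℕ.% m) ℕ.* (N ℕ.% m) < 10 ℕ.* (N ℕ./ m) ℕ.+ 3 ℕ.* (N ℕ.% m)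
    start = ℕ.<-≤-trans (ℕ.*-mono-< r< r<) (ℕ.≤-trans m²≤N/m (ℕ.≤-trans (ℕ.m≤n*m (N ℕ./ m) 10) (ℕ.m≤m+n _ (3 ℕ.* (N ℕ.% m)))))
      where r< = ℕ.m%n<n N m
    finish : ∃[ L ] ∃[ c ] (N ≡ m ℕ.* suc L ℕ.+ c × c ℕ.* c < 10 ℕ.* suc L ℕ.+ 3 ℕ.* c ×
                            10 ℕ.* L ℕ.+ 3 ℕ.* (c ℕ.+ m) ≤ (c ℕ.+ m) ℕ.* (c ℕ.+ m)) →
             ∃[ x₁ ] ∃[ x₂ ] ∃[ x₃ ] ∃[ x₄ ]
               (N ≡ polygonal m x₁ ℕ.+ polygonal m x₂ ℕ.+ polygonal m x₃ ℕ.+ 3 ℕ.* polygonal m x₄)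
    finish (L , c , N≡ , lt , le) = let b , l , e , sol = Window.solution (+ m) (+ c) (+ L) (ℤ.+≤+ 3≤m) (ℤ.+≤+ z≤n) lt-ℤ le-ℤ N≥-ℤ
                                    in polygonal-sum m N b l (trans N-ℤ e) sol
      where
      suc-ℤ : + suc L ≡ + L + 1ℤ
      suc-ℤ = cong +_ (ℕ.+-comm 1 L)
      N-ℤ : + N ≡ + m * (+ L + 1ℤ) + + c
      N-ℤ = trans (cong +_ N≡) (cong (_+ + c) (trans (ℤ.pos-* m (suc L)) (cong (_*_ (+ m)) suc-ℤ)))
      lt-ℤ : + c * + c + 1ℤ ℤ.≤ + 10 * (+ L + 1ℤ) + + 3 * + c
      lt-ℤ = subst₂ ℤ._≤_ (trans (cong +_ (ℕ.+-comm 1 (c ℕ.* c))) (cong (_+ 1ℤ) (ℤ.pos-* c c)))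
        (cong₂ _+_ (trans (ℤ.pos-* 10 (suc L)) (cong (_*_ (+ 10)) suc-ℤ)) (ℤ.pos-* 3 c)) (ℤ.+≤+ lt)
      le-ℤ : + 10 * + L + + 3 * (+ c + + m) ℤ.≤ (+ c + + m) * (+ c + + m)
      le-ℤ = subst₂ ℤ._≤_ (cong₂ _+_ (ℤ.pos-* 10 L) (ℤ.pos-* 3 (c ℕ.+ m))) (ℤ.pos-* (c ℕ.+ m) (c ℕ.+ m)) (ℤ.+≤+ le)
      N≥-ℤ : + 924 * (+ m * + m * + m) ℤ.≤ + m * (+ L + 1ℤ) + + c
      N≥-ℤ = subst₂ ℤ._≤_ (trans (ℤ.pos-* 924 (m ^ 3)) (cong (_*_ (+ 924)) cube)) N-ℤ (ℤ.+≤+ N≥)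
        where
        cube : + (m ^ 3) ≡ + m * + m * + m
        cube = trans (cong +_ (alg m)) (trans (ℤ.pos-* (m ℕ.* m) m) (cong (_* + m) (ℤ.pos-* m m)))
          where alg : ∀ m → m ℕ.* (m ℕ.* (m ℕ.* 1)) ≡ m ℕ.* m ℕ.* m
                alg = ℕ-solver.solve-∀

open import Data.Nat using (ℕ; _+_; _*_; _^_; _≤_; _≥_)
open import Data.Product using (∃-syntax; _×_)
open import Relation.Binary.PropositionalEquality using (_≡_)

theorem1p3 : (m : ℕ) → 3 ≤ m → (N : ℕ) → N ≥ 924 * m ^ 3 →
    ∃[ x₁ ] ∃[ x₂ ] ∃[ x₃ ] ∃[ x₄ ]
    (N ≡ polygonal m x₁ + polygonal m x₂ + polygonal m x₃ + 3 * polygonal m x₄)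
theorem1p3 = PolygonalSums.sum-of-polygonals
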